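{- There is an absolute constant $C$ such that for every odd integer $p\ge 3$ and every $k\in\mathbb{Z}_p$, the block walk on $\mathbb{Z}_p$ associated with the Pollard Rho walk with parameter $k$ has mixing time in separation distance satisfying $$\tau_s(1/2)\le C\,\log p\,\log\log p .$$
   Context: Block walk: the Pollard Rho walk with parameter $k$ on $\mathbb{Z}_p$ moves at each step from $i$ to $i+1$, to $i+k$, or to $2i$ (all modulo $p$), each with probability $1/3$ (probabilities of coinciding targets are added). A single step of the block walk consists of running the Pollard Rho walk until and including its next doubling move $i\to 2i$. Equivalently, the block walk is the Markov chain $Z_i=2(Z_{i-1}+b_i)$ on $\mathbb{Z}_p$, where $b_1,b_2,\ldots$ are i.i.d. $\mathbb{Z}_p$-valued random variables, $b_i$ being the sum of $N$ independent increments each equal to $1$ or $k$ with probability $1/2$, with $N$ independent of the increments and $\Pr[N=n]=\frac13(2/3)^n$ for $n=0,1,2,\ldots$. Its stationary distribution $\pi$ is uniform on $\mathbb{Z}_p$. For a Markov chain with transition matrix $P$ on a finite state space $V$ and stationary distribution $\pi$, the mixing time in separation distance is $$\tau_s(\epsilon)=\min\Bigl\{n:\ \forall x,y\in V,\ 1-\frac{P^n(x,y)}{\pi(y)}\le\epsilon\Bigr\}.$$ Logarithms are natural. -}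

module Defs where

open import Data.Nat.Base as ℕ using (ℕ; zero; suc; _!)
import Data.Nat.Properties as ℕ
open import Data.Nat.Properties using (_!≢0)
open import Data.Nat.DivMod using (_mod_)
open import Data.Integer.Base as ℤ using (-[1+_])
import Data.Integer.Properties as ℤ
open import Data.Fin.Base using (Fin; zero; suc; toℕ)
open import Data.Fin.Properties using (_≟_)
open import Data.Bool.Base using (if_then_else_)
open import Data.Rational.Base
open import Data.Rational.Properties hiding (_≟_)
open import Data.Rational.Solver using (module +-*-Solver)
open import Data.Product.Base using (∃; ∃-syntax; _×_; _,_; proj₁; proj₂)
open import Data.Unit.Base using (tt)
open import Algebra.Bundles using (CommutativeRing)
open import Algebra.Properties.Semiring.Exp (CommutativeRing.semiring +-*-commutativeRing) using (_^_)
open import Algebra.Properties.Semiring.Sum (CommutativeRing.semiring +-*-commutativeRing)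
open import Function.Base using (_∘_)
open import Relation.Nullary.Decidable.Core using (does)
open import Relation.Binary.PropositionalEquality

Kernel : ℕ → Set
Kernel m = Fin m → Fin m → ℚ

δ : ∀ {m} → Kernel m
δ x y = if does (x ≟ y) then 1ℚ else 0ℚ

power : ∀ {m} → Kernel m → ℕ → Kernel m
power P zero    x y = δ x y
power P (suc n) x y = ∑[ z < _ ] (P x z * power P n z y)

SeparatedWithin : ∀ {m} → Kernel m → (π : Fin m → ℚ) → (∀ y → NonZero (π y)) →
                  ℚ → ℕ → Set
SeparatedWithin P π π≢0 ε n =
  ∀ x y → 1ℚ - (power P n x y ÷ π y) {{π≢0 y}} ≤ ε

IsSeparationMixingTime : ∀ {m} → Kernel m → (π : Fin m → ℚ) → (∀ y → NonZero (π y)) →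
                         ℚ → ℕ → Set
IsSeparationMixingTime P π π≢0 ε τ =
  SeparatedWithin P π π≢0 ε τ ×
  (∀ n → SeparatedWithin P π π≢0 ε n → τ ℕ.≤ n)

uniform : ∀ p → .{{ℕ.NonZero p}} → Fin p → ℚ
uniform p _ = ℤ.+ 1 / p

uniform≢0 : ∀ p .{{_ : ℕ.NonZero p}} (y : Fin p) → NonZero (uniform p y)
uniform≢0 p _ = pos⇒nonZero (ℤ.+ 1 / p) {{normalize-pos 1 p}}

data Move : Set where
  increment shift double : Move

move : ∀ p → .{{ℕ.NonZero p}} → Fin p → Move → Fin p → Fin p
move p k increment i = (toℕ i ℕ.+ 1) mod p
move p k shift     i = (toℕ i ℕ.+ toℕ k) mod p
move p k double    i = (2 ℕ.* toℕ i) mod p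

⅓ : ℚ
⅓ = ℤ.+ 1 / 3

-- The probability that the Pollard Rho walk started at x makes exactly n
-- non-doubling moves before its first doubling move, and that this doubling
-- move lands on y.
firstDoubling : ∀ p → .{{ℕ.NonZero p}} → Fin p → ℕ → Kernel p
firstDoubling p k zero    x y = ⅓ * δ (move p k double x) y
firstDoubling p k (suc n) x y =
    ⅓ * firstDoubling p k n (move p k increment x) y
  + ⅓ * firstDoubling p k n (move p k shift x) y

partialSum : (ℕ → ℚ) → ℕ → ℚ
partialSum a n = ∑[ i < n ] a (toℕ i)

HasSum : (ℕ → ℚ) → ℚ → Set
HasSum a s = ∀ ε → 0ℚ < ε → ∃[ N ] (∀ n → N ℕ.≤ n → ∣ s - partialSum a n ∣ ≤ ε)

IsBlockWalk : ∀ p → .{{ℕ.NonZero p}} → Fin p → Kernel p → Set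
IsBlockWalk p k P = ∀ x y → HasSum (λ n → firstDoubling p k n x y) (P x y)

-- The series in IsBlockWalk has a rational sum.  Conditioning on the first move,
-- the sums u x (for a fixed target y) satisfy
--   u x = ⅓ * δ (2x) y + ⅓ * u (x+1) + ⅓ * u (x+k),
-- a system with nonnegative coefficients and row sums ⅔ < 1.
private

  ⅔ : ℚ
  ⅔ = ℤ.+ 2 / 3

  2ℚ : ℚ
  2ℚ = ℤ.+ 2 / 1

  nn : ∀ {q} → 0ℚ ≤ q → NonNegative q
  nn = nonNegative

  *-nonNeg : ∀ {a b} → 0ℚ ≤ a → 0ℚ ≤ b → 0ℚ ≤ a * b
  *-nonNeg {a} {b} 0≤a 0≤b =
    nonNegative⁻¹ (a * b) {{nonNeg*nonNeg⇒nonNeg a {{nn 0≤a}} b {{nn 0≤b}}}}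

  +-nonNeg : ∀ {a b} → 0ℚ ≤ a → 0ℚ ≤ b → 0ℚ ≤ a + b
  +-nonNeg 0≤a 0≤b = +-mono-≤ 0≤a 0≤b

  p≤p+q : ∀ {a b} → 0ℚ ≤ b → a ≤ a + b
  p≤p+q {a} {b} 0≤b = subst (_≤ a + b) (+-identityʳ a) (+-monoʳ-≤ a 0≤b)

  q≤p+q : ∀ {a b} → 0ℚ ≤ a → b ≤ a + b
  q≤p+q {a} {b} 0≤a = subst (_≤ a + b) (+-identityˡ b) (+-monoˡ-≤ b 0≤a)

  sum-nonNeg : ∀ {n} (f : Fin n → ℚ) → (∀ i → 0ℚ ≤ f i) → 0ℚ ≤ sum f
  sum-nonNeg {zero}  f 0≤f = ≤-refl
  sum-nonNeg {suc n} f 0≤f = +-nonNeg (0≤f zero) (sum-nonNeg (f ∘ suc) (0≤f ∘ suc))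

  term≤sum : ∀ {n} (f : Fin n → ℚ) → (∀ i → 0ℚ ≤ f i) → ∀ i → f i ≤ sum f
  term≤sum f 0≤f zero    = p≤p+q (sum-nonNeg (f ∘ suc) (0≤f ∘ suc))
  term≤sum f 0≤f (suc i) = ≤-trans (term≤sum (f ∘ suc) (0≤f ∘ suc) i) (q≤p+q (0≤f zero))

  module _ where
    open +-*-Solver

    cancel : ∀ x y → (x + y) - x ≡ y
    cancel = solve 2 (λ x y → (x :+ y) :- x := y) refl

    split : ∀ x y → y ≡ (1ℚ - x) * y + x * y
    split = solve 2 (λ x y → y := (con 1ℚ :- x) :* y :+ x :* y) refl

    swap : ∀ x y z → 1ℚ * (x + y) + z ≡ x + (z + y)
    swap = solve 3 (λ x y z → con 1ℚ :* (x :+ y) :+ z := x :+ (z :+ y)) refl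

    expand : ∀ x y z w → (x + y * z) * w ≡ x * w + y * (z * w)
    expand = solve 4 (λ x y z w → (x :+ y :* z) :* w := x :* w :+ y :* (z :* w)) refl

    regroup : ∀ x y z w v m →
              (x + (y * z) * w) + (v + (y * z) * m) ≡ x + (y * (z * (w + m)) + v)
    regroup = solve 6 (λ x y z w v m →
      (x :+ (y :* z) :* w) :+ (v :+ (y :* z) :* m) := x :+ (y :* (z :* (w :+ m)) :+ v)) refl

    difference : ∀ β c v w s t →
                 (β + (c * v + c * w)) - (β + (c * s + c * t)) ≡ c * (v - s) + c * (w - t)
    difference = solve 6 (λ β c v w s t →
      (β :+ (c :* v :+ c :* w)) :- (β :+ (c :* s :+ c :* t)) := c :* (v :- s) :+ c :* (w :- t)) refl

    distribute : ∀ c x y z → (c * x + c * y) * z ≡ c * (x * z) + c * (y * z)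
    distribute = solve 4 (λ c x y z →
      (c :* x :+ c :* y) :* z := c :* (x :* z) :+ c :* (y :* z)) refl

    swapʳ : ∀ x y z → x * y * z ≡ x * z * y
    swapʳ = solve 3 (λ x y z → x :* y :* z := x :* z :* y) refl

    swapˡ : ∀ x y z → (x * y) * z ≡ y * (x * z)
    swapˡ = solve 3 (λ x y z → (x :* y) :* z := y :* (x :* z)) refl

  solveSystem : ∀ {n} (A : Fin n → Fin n → ℚ) (b : Fin n → ℚ) →
                (∀ i j → 0ℚ ≤ A i j) → (∀ i → sum (A i) ≤ ⅔) →
                ∃ λ (u : Fin n → ℚ) → ∀ i → u i ≡ b i + ∑[ j < n ] (A i j * u j)
  solveSystem {zero}  A b _ _ = (λ ()) , λ ()
  solveSystem {suc n} A b 0≤A A≤⅔ = u , u-solves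
    where
    a = A zero zero
    r = ∑[ j < n ] A zero (suc j)

    r≤⅔-a : r ≤ ⅔ - a
    r≤⅔-a = subst (_≤ ⅔ - a)
      (cancel a r) (+-monoˡ-≤ (- a) (A≤⅔ zero))

    a≤⅔ : a ≤ ⅔
    a≤⅔ = ≤-trans (p≤p+q (sum-nonNeg (λ j → A zero (suc j)) (λ j → 0≤A zero (suc j)))) (A≤⅔ zero)

    ⅔<1 : ⅔ < 1ℚ
    ⅔<1 = *<* (ℤ.+<+ (ℕ.s≤s (ℕ.s≤s (ℕ.s≤s ℕ.z≤n))))

    0<1-a : 0ℚ < 1ℚ - a
    0<1-a = subst (_< 1ℚ - a) (+-inverseʳ a) (+-monoˡ-< (- a) (≤-<-trans a≤⅔ ⅔<1))

    instance
      1-a>0 : Positive (1ℚ - a)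
      1-a>0 = positive 0<1-a
      1-a≢0 : NonZero (1ℚ - a)
      1-a≢0 = pos⇒nonZero (1ℚ - a)

    d = 1/ (1ℚ - a)

    0≤d : 0ℚ ≤ d
    0≤d = <⇒≤ (positive⁻¹ d {{1/pos⇒pos (1ℚ - a)}})

    dr≤1 : d * r ≤ 1ℚ
    dr≤1 = subst (d * r ≤_) (*-inverseˡ (1ℚ - a))
      (*-monoˡ-≤-nonNeg d {{nn 0≤d}} (≤-trans r≤⅔-a (+-monoˡ-≤ (- a) (<⇒≤ ⅔<1))))

    A′ : Fin n → Fin n → ℚ
    A′ i j = A (suc i) (suc j) + (A (suc i) zero * d) * A zero (suc j)

    b′ : Fin n → ℚ
    b′ i = b (suc i) + (A (suc i) zero * d) * b zero

    0≤A′ : ∀ i j → 0ℚ ≤ A′ i j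
    0≤A′ i j = +-nonNeg (0≤A _ _) (*-nonNeg (*-nonNeg (0≤A _ _) 0≤d) (0≤A _ _))

    A′≤⅔ : ∀ i → sum (A′ i) ≤ ⅔
    A′≤⅔ i = begin
      sum (A′ i)
        ≡⟨ ∑-distrib-+ {n} (λ j → A (suc i) (suc j)) (λ j → (c * d) * A zero (suc j)) ⟩
      s + ∑[ j < n ] ((c * d) * A zero (suc j))
        ≡⟨ cong (s +_) (*-distribˡ-sum {n} (c * d) (λ j → A zero (suc j))) ⟨
      s + (c * d) * r
        ≡⟨ cong (s +_) (*-assoc c d r) ⟩
      s + c * (d * r)
        ≤⟨ +-monoʳ-≤ s (*-monoˡ-≤-nonNeg c {{nn (0≤A _ _)}} dr≤1) ⟩
      s + c * 1ℚ
        ≡⟨ trans (cong (s +_) (*-identityʳ c)) (+-comm s c) ⟩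
      c + s
        ≤⟨ A≤⅔ (suc i) ⟩
      ⅔ ∎
      where
      open ≤-Reasoning
      c = A (suc i) zero
      s = ∑[ j < n ] A (suc i) (suc j)

    ih = solveSystem A′ b′ 0≤A′ A′≤⅔
    u′ = proj₁ ih

    t = ∑[ j < n ] (A zero (suc j) * u′ j)

    u₀ = d * (b zero + t)

    u : Fin (suc n) → ℚ
    u zero    = u₀
    u (suc j) = u′ j

    u-solves : ∀ i → u i ≡ b i + ∑[ j < suc n ] (A i j * u j)
    u-solves zero = begin
      u₀
        ≡⟨ split a u₀ ⟩
      (1ℚ - a) * (d * (b zero + t)) + a * u₀
        ≡⟨ cong (_+ a * u₀) (trans (sym (*-assoc (1ℚ - a) d (b zero + t)))
             (cong (_* (b zero + t)) (*-inverseʳ (1ℚ - a)))) ⟩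
      1ℚ * (b zero + t) + a * u₀
        ≡⟨ swap (b zero) t (a * u₀) ⟩
      b zero + (a * u₀ + t) ∎
      where open ≡-Reasoning
    u-solves (suc i) = begin
      u′ i
        ≡⟨ proj₂ ih i ⟩
      b′ i + ∑[ j < n ] (A′ i j * u′ j)
        ≡⟨ cong (b′ i +_) (sum-cong-≗ {n} (λ j →
             expand (A (suc i) (suc j)) (c * d) (A zero (suc j)) (u′ j))) ⟩
      b′ i + ∑[ j < n ] (A (suc i) (suc j) * u′ j + (c * d) * (A zero (suc j) * u′ j))
        ≡⟨ cong (b′ i +_) (∑-distrib-+ {n} (λ j → A (suc i) (suc j) * u′ j) (λ j → (c * d) * (A zero (suc j) * u′ j))) ⟩
      b′ i + (s + ∑[ j < n ] ((c * d) * (A zero (suc j) * u′ j)))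
        ≡⟨ cong (λ z → b′ i + (s + z)) (*-distribˡ-sum {n} (c * d) (λ j → A zero (suc j) * u′ j)) ⟨
      b′ i + (s + (c * d) * t)
        ≡⟨ regroup (b (suc i)) c d (b zero) s t ⟩
      b (suc i) + (c * u₀ + s) ∎
      where
      open ≡-Reasoning
      c = A (suc i) zero
      s = ∑[ j < n ] (A (suc i) (suc j) * u′ j)

  δ-nonNeg : ∀ {n} (x y : Fin n) → 0ℚ ≤ δ x y
  δ-nonNeg zero    zero    = nonNegative⁻¹ 1ℚ
  δ-nonNeg zero    (suc y) = ≤-refl
  δ-nonNeg (suc x) zero    = ≤-refl
  δ-nonNeg (suc x) (suc y) = δ-nonNeg x y

  sum-δ : ∀ {n} (a : Fin n) (f : Fin n → ℚ) → ∑[ z < n ] (δ a z * f z) ≡ f a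
  sum-δ {suc n} zero f = begin
    1ℚ * f zero + ∑[ z < n ] (0ℚ * f (suc z))
      ≡⟨ cong₂ _+_ (*-identityˡ (f zero)) (sym (*-distribˡ-sum {n} 0ℚ (f ∘ suc))) ⟩
    f zero + 0ℚ * sum (f ∘ suc)
      ≡⟨ cong (f zero +_) (*-zeroˡ (sum (f ∘ suc))) ⟩
    f zero + 0ℚ
      ≡⟨ +-identityʳ (f zero) ⟩
    f zero ∎
    where open ≡-Reasoning
  sum-δ {suc n} (suc a) f =
    trans (cong₂ _+_ (*-zeroˡ (f zero)) (sum-δ a (f ∘ suc))) (+-identityˡ (f (suc a)))

  ι : ℕ → ℚ
  ι zero    = 0ℚ
  ι (suc n) = 1ℚ + ι n

  ι-nonNeg : ∀ n → 0ℚ ≤ ι n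
  ι-nonNeg zero    = ≤-refl
  ι-nonNeg (suc n) = +-nonNeg (nonNegative⁻¹ 1ℚ) (ι-nonNeg n)

  ι-mono : ∀ {m n} → m ℕ.≤ n → ι m ≤ ι n
  ι-mono {n = n} ℕ.z≤n = ι-nonNeg n
  ι-mono (ℕ.s≤s m≤n)   = +-monoʳ-≤ 1ℚ (ι-mono m≤n)

  ι≡/1 : ∀ n → ι n ≡ ℤ.+ n / 1
  ι≡/1 zero    = refl
  ι≡/1 (suc n) = trans (cong (1ℚ +_) (ι≡/1 n))
    (toℚᵘ-injective (ℚᵘ.≃-trans (toℚᵘ-homo-+ 1ℚ (ℤ.+ n / 1))
      (ℚᵘ.≃-trans (ℚᵘ.+-cong (ℚᵘ.≃-refl {toℚᵘ 1ℚ}) (toℚᵘ-fromℚᵘ (mkℚᵘ (ℤ.+ n) 0)))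
        (ℚᵘ.≃-trans (*≡* (cong (ℤ._* ℤ.+ 1) (cong (λ i → ℤ.1ℤ ℤ.+ i) (ℤ.*-identityʳ (ℤ.+ n)))))
          (ℚᵘ.≃-sym (toℚᵘ-fromℚᵘ (mkℚᵘ (ℤ.+ suc n) 0)))))))
    where
    open import Data.Rational.Unnormalised.Base using (mkℚᵘ; *≡*)
    import Data.Rational.Unnormalised.Properties as ℚᵘ

  archimedean : ∀ q → ∃[ n ] q ≤ ι n
  archimedean q@record{} = ℤ.∣ ↥ q ∣ , subst (q ≤_) (sym (ι≡/1 ℤ.∣ ↥ q ∣)) q≤
    where
    open import Data.Rational.Unnormalised.Base using (mkℚᵘ; *≤*)
    import Data.Rational.Unnormalised.Properties as ℚᵘ
    i≤∣i∣ : ∀ i → i ℤ.≤ ℤ.+ ℤ.∣ i ∣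
    i≤∣i∣ (ℤ.+ _)    = ℤ.≤-refl
    i≤∣i∣ -[1+ _ ] = ℤ.-≤+
    q≤ : q ≤ ℤ.+ ℤ.∣ ↥ q ∣ / 1
    q≤ = toℚᵘ-cancel-≤ (ℚᵘ.≤-respʳ-≃ (ℚᵘ.≃-sym (toℚᵘ-fromℚᵘ (mkℚᵘ (ℤ.+ ℤ.∣ ↥ q ∣) 0)))
      (*≤* (ℤ.≤-trans (ℤ.≤-reflexive (ℤ.*-identityʳ (↥ q)))
        (ℤ.≤-trans (i≤∣i∣ (↥ q))
          (subst (ℤ.+ ℤ.∣ ↥ q ∣ ℤ.≤_) (ℤ.pos-* ℤ.∣ ↥ q ∣ (↧ₙ q))
            (ℤ.+≤+ (ℕ.m≤m*n ℤ.∣ ↥ q ∣ (↧ₙ q))))))))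

  ⅔^n*[n+2]≤2 : ∀ n → (⅔ ^ n) * ι (2 ℕ.+ n) ≤ 2ℚ
  ⅔^n*[n+2]≤2 zero    = ≤-refl
  ⅔^n*[n+2]≤2 (suc n) = begin
    (⅔ * ⅔ ^ n) * ι (3 ℕ.+ n)
      ≡⟨ swapˡ ⅔ (⅔ ^ n) (ι (3 ℕ.+ n)) ⟩
    ⅔ ^ n * (⅔ * ι (3 ℕ.+ n))
      ≤⟨ *-monoˡ-≤-nonNeg (⅔ ^ n) {{nn (0≤⅔^ n)}} ⅔ι≤ι ⟩
    ⅔ ^ n * ι (2 ℕ.+ n)
      ≤⟨ ⅔^n*[n+2]≤2 n ⟩
    2ℚ ∎
    where
    open ≤-Reasoning
    open +-*-Solver
    0≤⅔^ : ∀ n → 0ℚ ≤ ⅔ ^ n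
    0≤⅔^ zero    = nonNegative⁻¹ 1ℚ
    0≤⅔^ (suc n) = *-nonNeg (nonNegative⁻¹ ⅔) (0≤⅔^ n)
    ⅔ι≤ι : ⅔ * ι (3 ℕ.+ n) ≤ ι (2 ℕ.+ n)
    ⅔ι≤ι = begin
      ⅔ * ι (3 ℕ.+ n)
        ≡⟨ solve 1 (λ x → con ⅔ :* (con 1ℚ :+ (con 1ℚ :+ (con 1ℚ :+ x))) := (con 2ℚ :+ con ⅔ :* x)) refl (ι n) ⟩
      2ℚ + ⅔ * ι n
        ≤⟨ p≤p+q (*-nonNeg (nonNegative⁻¹ ⅓) (ι-nonNeg n)) ⟩
      2ℚ + ⅔ * ι n + ⅓ * ι n
        ≡⟨ solve 1 (λ x → con 2ℚ :+ con ⅔ :* x :+ con ⅓ :* x := con 1ℚ :+ (con 1ℚ :+ x)) refl (ι n) ⟩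
      ι (2 ℕ.+ n) ∎

  ⅔^n*M→0 : ∀ M ε → 0ℚ ≤ M → 0ℚ < ε → ∃[ N ] (∀ n → N ℕ.≤ n → ⅔ ^ n * M ≤ ε)
  ⅔^n*M→0 M ε 0≤M 0<ε = N , bound
    where
    instance
      ε>0 : Positive ε
      ε>0 = positive 0<ε
      ε≢0 : NonZero ε
      ε≢0 = pos⇒nonZero ε
    Nq = archimedean (1/ ε * (2ℚ * M))
    N = proj₁ Nq
    2M≤εN : 2ℚ * M ≤ ε * ι N
    2M≤εN = subst (_≤ ε * ι N)
      (trans (sym (*-assoc ε (1/ ε) (2ℚ * M)))
        (trans (cong (_* (2ℚ * M)) (*-inverseʳ ε)) (*-identityˡ (2ℚ * M))))
      (*-monoˡ-≤-nonNeg ε {{pos⇒nonNeg ε}} (proj₂ Nq))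
    bound : ∀ n → N ℕ.≤ n → ⅔ ^ n * M ≤ ε
    bound n N≤n = *-cancelʳ-≤-pos (ι (2 ℕ.+ n)) {{ι>0}} (begin
      ⅔ ^ n * M * ι (2 ℕ.+ n)
        ≡⟨ swapʳ (⅔ ^ n) M (ι (2 ℕ.+ n)) ⟩
      ⅔ ^ n * ι (2 ℕ.+ n) * M
        ≤⟨ *-monoʳ-≤-nonNeg M {{nn 0≤M}} (⅔^n*[n+2]≤2 n) ⟩
      2ℚ * M
        ≤⟨ 2M≤εN ⟩
      ε * ι N
        ≤⟨ *-monoˡ-≤-nonNeg ε {{pos⇒nonNeg ε}} (ι-mono (ℕ.m≤n⇒m≤o+n 2 N≤n)) ⟩
      ε * ι (2 ℕ.+ n) ∎)
      where
      open ≤-Reasoning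
      ι>0 : Positive (ι (2 ℕ.+ n))
      ι>0 = positive (<-≤-trans (positive⁻¹ 1ℚ) (p≤p+q (ι-nonNeg (suc n))))

  module Existence (p : ℕ) .{{_ : ℕ.NonZero p}} (k : Fin p) (y : Fin p) where

    s₁ s₂ : Fin p → Fin p
    s₁ = move p k increment
    s₂ = move p k shift

    b : Fin p → ℚ
    b x = firstDoubling p k 0 x y

    A : Fin p → Fin p → ℚ
    A x z = ⅓ * δ (s₁ x) z + ⅓ * δ (s₂ x) z

    A-apply : ∀ x f → ∑[ z < p ] (A x z * f z) ≡ ⅓ * f (s₁ x) + ⅓ * f (s₂ x)
    A-apply x f = begin
      ∑[ z < p ] (A x z * f z)
        ≡⟨ sum-cong-≗ {p} (λ z → distribute ⅓ (δ (s₁ x) z) (δ (s₂ x) z) (f z)) ⟩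
      ∑[ z < p ] (⅓ * (δ (s₁ x) z * f z) + ⅓ * (δ (s₂ x) z * f z))
        ≡⟨ ∑-distrib-+ {p} (λ z → ⅓ * (δ (s₁ x) z * f z)) (λ z → ⅓ * (δ (s₂ x) z * f z)) ⟩
      ∑[ z < p ] (⅓ * (δ (s₁ x) z * f z)) + ∑[ z < p ] (⅓ * (δ (s₂ x) z * f z))
        ≡⟨ cong₂ _+_ (scaled (s₁ x)) (scaled (s₂ x)) ⟩
      ⅓ * f (s₁ x) + ⅓ * f (s₂ x) ∎
      where
      open ≡-Reasoning
      scaled : ∀ a → ∑[ z < p ] (⅓ * (δ a z * f z)) ≡ ⅓ * f a
      scaled a = trans (sym (*-distribˡ-sum {p} ⅓ (λ z → δ a z * f z))) (cong (⅓ *_) (sum-δ a f))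

    0≤A : ∀ x z → 0ℚ ≤ A x z
    0≤A x z = +-nonNeg (*-nonNeg (nonNegative⁻¹ ⅓) (δ-nonNeg (s₁ x) z))
                       (*-nonNeg (nonNegative⁻¹ ⅓) (δ-nonNeg (s₂ x) z))

    A≤⅔ : ∀ x → sum (A x) ≤ ⅔
    A≤⅔ x = ≤-reflexive (trans (sum-cong-≗ {p} (λ z → sym (*-identityʳ (A x z)))) (A-apply x (λ _ → 1ℚ)))

    sol = solveSystem A b 0≤A A≤⅔

    u : Fin p → ℚ
    u = proj₁ sol

    u-step : ∀ x → u x ≡ b x + (⅓ * u (s₁ x) + ⅓ * u (s₂ x))
    u-step x = trans (proj₂ sol x) (cong (λ q → b x + q) (A-apply x u))

    S : ℕ → Fin p → ℚ
    S n x = partialSum (λ m → firstDoubling p k m x y) n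

    S-step : ∀ n x → S (suc n) x ≡ b x + (⅓ * S n (s₁ x) + ⅓ * S n (s₂ x))
    S-step n x = cong (b x +_) (trans
      (∑-distrib-+ {n} (λ i → ⅓ * firstDoubling p k (toℕ i) (s₁ x) y)
                       (λ i → ⅓ * firstDoubling p k (toℕ i) (s₂ x) y))
      (sym (cong₂ _+_ (*-distribˡ-sum {n} ⅓ (λ i → firstDoubling p k (toℕ i) (s₁ x) y))
                      (*-distribˡ-sum {n} ⅓ (λ i → firstDoubling p k (toℕ i) (s₂ x) y)))))

    M : ℚ
    M = ∑[ x < p ] ∣ u x ∣

    error : ∀ n x → ∣ u x - S n x ∣ ≤ ⅔ ^ n * M
    error zero x = subst₂ _≤_ (cong ∣_∣ (sym (+-identityʳ (u x)))) (sym (*-identityˡ M))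
      (term≤sum (λ z → ∣ u z ∣) (λ z → 0≤∣p∣ (u z)) x)
    error (suc n) x = begin
      ∣ u x - S (suc n) x ∣
        ≡⟨ cong ∣_∣ (cong₂ _-_ (u-step x) (S-step n x)) ⟩
      ∣ (b x + (⅓ * u (s₁ x) + ⅓ * u (s₂ x))) - (b x + (⅓ * S n (s₁ x) + ⅓ * S n (s₂ x))) ∣
        ≡⟨ cong ∣_∣ (difference
             (b x) ⅓ (u (s₁ x)) (u (s₂ x)) (S n (s₁ x)) (S n (s₂ x))) ⟩
      ∣ ⅓ * e₁ + ⅓ * e₂ ∣
        ≤⟨ ∣p+q∣≤∣p∣+∣q∣ (⅓ * e₁) (⅓ * e₂) ⟩
      ∣ ⅓ * e₁ ∣ + ∣ ⅓ * e₂ ∣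
        ≡⟨ cong₂ _+_ (∣p*q∣≡∣p∣*∣q∣ ⅓ e₁) (∣p*q∣≡∣p∣*∣q∣ ⅓ e₂) ⟩
      ⅓ * ∣ e₁ ∣ + ⅓ * ∣ e₂ ∣
        ≤⟨ +-mono-≤ (*-monoˡ-≤-nonNeg ⅓ (error n (s₁ x))) (*-monoˡ-≤-nonNeg ⅓ (error n (s₂ x))) ⟩
      ⅓ * (⅔ ^ n * M) + ⅓ * (⅔ ^ n * M)
        ≡⟨ trans (sym (*-distribʳ-+ (⅔ ^ n * M) ⅓ ⅓)) (sym (*-assoc ⅔ (⅔ ^ n) M)) ⟩
      ⅔ ^ suc n * M ∎
      where
      open ≤-Reasoning
      e₁ = u (s₁ x) - S n (s₁ x)
      e₂ = u (s₂ x) - S n (s₂ x)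

    hasSum : ∀ x → HasSum (λ n → firstDoubling p k n x y) (u x)
    hasSum x ε 0<ε =
      let N , bound = ⅔^n*M→0 M ε (sum-nonNeg (λ z → ∣ u z ∣) (λ z → 0≤∣p∣ (u z))) 0<ε
      in N , λ n N≤n → ≤-trans (error n x) (bound n N≤n)

-- The unique kernel satisfying IsBlockWalk.
abstract

  blockWalk : ∀ p → .{{ℕ.NonZero p}} → Fin p → Kernel p
  blockWalk p k x y = Existence.u p k y x

  blockWalk-isBlockWalk : ∀ p .{{_ : ℕ.NonZero p}} (k : Fin p) → IsBlockWalk p k (blockWalk p k)
  blockWalk-isBlockWalk p k x y = Existence.hasSum p k y x

-- A nonnegative real number x as a one-sided Dedekind cut: Above q means x < q.
record ℝ≥0 : Set₁ where
  field
    Above     : ℚ → Set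
    positive′ : ∀ {q} → Above q → 0ℚ < q
    inhabited : ∃[ q ] Above q
    upward    : ∀ {q r} → Above q → q ≤ r → Above r
    rounded   : ∀ {q} → Above q → ∃[ r ] (Above r × r < q)

open ℝ≥0

infix  4 _≤ᴿ_
infixl 7 _*ᴿ_

_≤ᴿ_ : ℝ≥0 → ℝ≥0 → Set
x ≤ᴿ y = ∀ q → Above y q → Above x q

fromℕ : ℕ → ℝ≥0
fromℕ n = record
  { Above     = λ q → ℤ.+ n / 1 < q
  ; positive′ = ≤-<-trans (nonNegative⁻¹ (ℤ.+ n / 1) {{normalize-nonNeg n 1}})
  ; inhabited = ℤ.+ n / 1 + 1ℚ ,
      subst (_< ℤ.+ n / 1 + 1ℚ) (+-identityʳ (ℤ.+ n / 1)) (+-monoʳ-< (ℤ.+ n / 1) (positive⁻¹ 1ℚ))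
  ; upward    = <-≤-trans
  ; rounded   = λ n<q → let r , n<r , r<q = <-dense n<q in r , n<r , r<q
  }

_*ᴿ_ : ℝ≥0 → ℝ≥0 → ℝ≥0
x *ᴿ y = record
  { Above     = λ q → ∃[ a ] ∃[ b ] (Above x a × Above y b × a * b < q)
  ; positive′ = λ (a , b , x<a , y<b , ab<q) → ≤-<-trans
      (*-nonNeg (<⇒≤ (positive′ x x<a)) (<⇒≤ (positive′ y y<b))) ab<q
  ; inhabited =
      let a , x<a = inhabited x
          b , y<b = inhabited y
      in a * b + 1ℚ , a , b , x<a , y<b ,
         subst (_< a * b + 1ℚ) (+-identityʳ (a * b)) (+-monoʳ-< (a * b) (positive⁻¹ 1ℚ))
  ; upward    = λ (a , b , x<a , y<b , ab<q) q≤r → a , b , x<a , y<b , <-≤-trans ab<q q≤r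
  ; rounded   = λ (a , b , x<a , y<b , ab<q) →
      let r , ab<r , r<q = <-dense ab<q in r , (a , b , x<a , y<b , ab<r) , r<q
  }

expPartial : ℚ → ℕ → ℚ
expPartial q = partialSum (λ i → q ^ i * (ℤ.+ 1 / (i !)) {{i !≢0}})

-- The logarithm as the inverse of exp q = ∑ qⁱ/i!.  For q ≥ 0 the partial sums
-- of exp q increase, so x < exp q iff x lies below one of them; hence the cut
-- consists of the rationals exceeding some r ≥ 0 with x < exp r.  This is the
-- natural logarithm of x if x ≥ 1 (and 0 if x ≤ 1).
log : ℝ≥0 → ℝ≥0
log x = record
  { Above     = λ q → ∃[ r ] ∃[ n ] (0ℚ ≤ r × r < q × Above x (expPartial r n))
  ; positive′ = λ (r , n , 0≤r , r<q , _) → ≤-<-trans 0≤r r<q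
  ; inhabited =
      let s , x<s = inhabited x
          0≤s = <⇒≤ (positive′ x x<s)
      in s + 1ℚ , s , 2 , 0≤s ,
         subst (_< s + 1ℚ) (+-identityʳ s) (+-monoʳ-< s (positive⁻¹ 1ℚ)) ,
         upward x x<s (subst (s ≤_) (1+s≡exp₂ s) (q≤p+q (nonNegative⁻¹ 1ℚ)))
  ; upward    = λ (r , n , 0≤r , r<q , x<e) q≤q′ → r , n , 0≤r , <-≤-trans r<q q≤q′ , x<e
  ; rounded   = λ (r , n , 0≤r , r<q , x<e) →
      let q′ , r<q′ , q′<q = <-dense r<q in q′ , (r , n , 0≤r , r<q′ , x<e) , q′<q
  }
  where
  1+s≡exp₂ : ∀ s → 1ℚ + s ≡ expPartial s 2
  1+s≡exp₂ = +-*-Solver.solve 1 (λ s →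
    con 1ℚ :+ s := con 1ℚ :* con 1ℚ :+ ((s :* con 1ℚ) :* con 1ℚ :+ con 0ℚ)) refl
    where open +-*-Solver

module Submission where

-- Write γ for the law of one step from 0 and u for the uniform distribution.  The law of n steps
-- is the convolution of the dilations of γ by 1, 2, …, 2ⁿ⁻¹.  A step contains a uniform bit
-- with constant probability, and if all t ≈ log₂ p steps of a block did, then the block would be
-- nearly uniform, its value being 2j mod p for a uniform j < 2ᵗ.  Now run 2ˢ⁺¹ consecutive
-- blocks, with 2ˢ of order log t.  Their laws are dilations of one another, so by Hölder's
-- inequality for Fourier coefficients (proved here in the group algebra over ℚ, by repeated
-- Cauchy–Schwarz) their convolution is as close to u as if the blocks were independent copies of the
-- same block.  In the sum of 2ˢ such copies, each of the t binary positions lacks a uniform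
-- bit only with probability (7/9)^2ˢ ≪ 1/t, which gives density at most (3/2)u and hence
-- squared L²-distance at most u/2 from u.

open import Data.Nat.Base as ℕ using (ℕ; zero; suc; _!)
import Data.Nat.Properties as ℕ
open import Data.Nat.Properties using (_!≢0)
open import Data.Nat.DivMod
  using (_%_; _mod_; m%n<n; m%n≤n; m/n*n≤m; %-distribˡ-+; %-distribˡ-*;
          m<n⇒m%n≡m; [m+kn]%n≡m%n; m%n%n≡m%n; m≡m%n+[m/n]*n)
open import Data.Nat.Divisibility using (_∣_; m%n≡0⇒n∣m)
import Data.Integer.Base as ℤ
import Data.Integer.Properties as ℤ
open import Data.Fin.Base using (Fin; zero; suc; toℕ)
open import Data.Fin.Properties using (toℕ-fromℕ<; toℕ-injective; toℕ<n; all?) renaming (_≟_ to _≟ᶠ_)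
open import Data.Fin.Permutation using (permutation)
open import Data.Rational.Base
open import Data.Rational.Properties
import Data.Rational.Unnormalised.Base as ℚᵘ
import Data.Rational.Unnormalised.Properties as ℚᵘ
open import Data.Rational.Solver using (module +-*-Solver)
open import Data.Product.Base using (∃-syntax; _×_; _,_)
open import Data.Sum.Base using (inj₁; inj₂)
open import Algebra.Bundles using (CommutativeRing; CommutativeMonoid; AbelianGroup)
open import Algebra.Core using (Op₁; Op₂)
open import Algebra.Structures using (IsAbelianGroup)
import Algebra.Properties.AbelianGroup
import Algebra.Properties.CommutativeSemigroup
open import Algebra.Properties.Semiring.Exp (CommutativeRing.semiring +-*-commutativeRing) using (_^_; ^-assocʳ)
open import Algebra.Properties.Semiring.Sum (CommutativeRing.semiring +-*-commutativeRing)
open import Function.Base using (_∘_; case_of_)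
open import Relation.Nullary.Decidable.Core using (Dec; yes; no)
open import Relation.Nullary.Negation using (¬_; contradiction)
open import Relation.Binary.Bundles using (Setoid)
open import Relation.Binary.PropositionalEquality
open import Defs

-- Rational arithmetic

-- Different dilations of a block do not share binary positions, so a position that misses its bit
-- in one block is not repaired directly by the next block. Squared norms, however, do not see
-- dilations: `p` is odd, multiplication by 2 is an automorphism, and in a bound by norms each
-- dilation can be undone separately. Over ℚ there are no characters, so power sums of Fourier
-- coefficients are represented by values at 0 of convolutions, and absolute values by passing to
-- `f ⋆ reflect f`. The last doubling, from `2^s` to `2^(s+1)` blocks, turns the L²-estimate, by one
-- more Cauchy-Schwarz, into a lower bound at every point, as separation distance demands. The bit
-- comes from the walk at 0: it doubles at once with probability 1/3, reaching 0, and increments and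
-- then doubles with probability 1/9, reaching 2. Taking 1/9 from each leaves 7/9, and
-- `(7/9)^3 < 1/2` turns `2^s ≥ 3a` copies into a failure probability of at most `2^(-a)`.

ι : ℕ → ℚ
ι n = ℤ.+ n / 1

toℚᵘ-ι : ∀ n → toℚᵘ (ι n) ℚᵘ.≃ ℚᵘ.mkℚᵘ (ℤ.+ n) 0
toℚᵘ-ι n = toℚᵘ-fromℚᵘ (ℚᵘ.mkℚᵘ (ℤ.+ n) 0)

ι-+ : ∀ m n → ι (m ℕ.+ n) ≡ ι m + ι n
ι-+ m n = toℚᵘ-injective (begin
  toℚᵘ (ι (m ℕ.+ n))                             ≈⟨ toℚᵘ-ι (m ℕ.+ n) ⟩
  ℚᵘ.mkℚᵘ (ℤ.+ (m ℕ.+ n)) 0                       ≈⟨ ℚᵘ.*≡* (cong (ℤ._* ℤ.+ 1)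
                                                   (sym (cong₂ ℤ._+_ (ℤ.*-identityʳ (ℤ.+ m)) (ℤ.*-identityʳ (ℤ.+ n))))) ⟩
  ℚᵘ.mkℚᵘ (ℤ.+ m) 0 ℚᵘ.+ ℚᵘ.mkℚᵘ (ℤ.+ n) 0         ≈⟨ ℚᵘ.+-cong (toℚᵘ-ι m) (toℚᵘ-ι n) ⟨
  toℚᵘ (ι m) ℚᵘ.+ toℚᵘ (ι n)                      ≈⟨ toℚᵘ-homo-+ (ι m) (ι n) ⟨
  toℚᵘ (ι m + ι n)                               ∎)
  where open ℚᵘ.≃-Reasoning

ι-* : ∀ m n → ι (m ℕ.* n) ≡ ι m * ι n
ι-* m n = toℚᵘ-injective (begin
  toℚᵘ (ι (m ℕ.* n))                             ≈⟨ toℚᵘ-ι (m ℕ.* n) ⟩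
  ℚᵘ.mkℚᵘ (ℤ.+ (m ℕ.* n)) 0                       ≈⟨ ℚᵘ.*≡* (cong (ℤ._* ℤ.+ 1) (ℤ.pos-* m n)) ⟩
  ℚᵘ.mkℚᵘ (ℤ.+ m) 0 ℚᵘ.* ℚᵘ.mkℚᵘ (ℤ.+ n) 0         ≈⟨ ℚᵘ.*-cong (toℚᵘ-ι m) (toℚᵘ-ι n) ⟨
  toℚᵘ (ι m) ℚᵘ.* toℚᵘ (ι n)                      ≈⟨ toℚᵘ-homo-* (ι m) (ι n) ⟨
  toℚᵘ (ι m * ι n)                               ∎)
  where open ℚᵘ.≃-Reasoning

ι-mono-≤ : ∀ {m n} → m ℕ.≤ n → ι m ≤ ι n
ι-mono-≤ {m} {n} m≤n = toℚᵘ-cancel-≤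
  (ℚᵘ.≤-respˡ-≃ (ℚᵘ.≃-sym (toℚᵘ-ι m)) (ℚᵘ.≤-respʳ-≃ (ℚᵘ.≃-sym (toℚᵘ-ι n))
    (ℚᵘ.*≤* (ℤ.*-monoʳ-≤-nonNeg (ℤ.+ 1) (ℤ.+≤+ m≤n)))))

0≤ι : ∀ n → 0ℚ ≤ ι n
0≤ι n = ι-mono-≤ {0} {n} ℕ.z≤n

ι-recip : ∀ n .{{_ : ℕ.NonZero n}} → ι n * (ℤ.+ 1 / n) ≡ 1ℚ
ι-recip (suc n) = toℚᵘ-injective (begin
  toℚᵘ (ι (suc n) * (ℤ.+ 1 / suc n))              ≈⟨ toℚᵘ-homo-* (ι (suc n)) (ℤ.+ 1 / suc n) ⟩
  toℚᵘ (ι (suc n)) ℚᵘ.* toℚᵘ (ℤ.+ 1 / suc n)       ≈⟨ ℚᵘ.*-cong (toℚᵘ-ι (suc n)) (toℚᵘ-fromℚᵘ (ℚᵘ.mkℚᵘ (ℤ.+ 1) n)) ⟩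
  ℚᵘ.mkℚᵘ (ℤ.+ suc n) 0 ℚᵘ.* ℚᵘ.mkℚᵘ (ℤ.+ 1) n      ≈⟨ ℚᵘ.*≡* (trans (ℤ.*-identityʳ _)
                                                    (trans (ℤ.*-comm (ℤ.+ suc n) (ℤ.+ 1)) (cong (ℤ.+ 1 ℤ.*_) (cong ℤ.+_ (sym (ℕ.+-identityʳ (suc n))))))) ⟩
  toℚᵘ 1ℚ                                         ∎)
  where open ℚᵘ.≃-Reasoning

0≤1/ : ∀ n .{{_ : ℕ.NonZero n}} → 0ℚ ≤ ℤ.+ 1 / n
0≤1/ n = nonNegative⁻¹ (ℤ.+ 1 / n) {{normalize-nonNeg 1 n}}

+-nonNeg : ∀ {a b} → 0ℚ ≤ a → 0ℚ ≤ b → 0ℚ ≤ a + b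
+-nonNeg = +-mono-≤

*-nonNeg : ∀ {a b} → 0ℚ ≤ a → 0ℚ ≤ b → 0ℚ ≤ a * b
*-nonNeg {a} {b} 0≤a 0≤b =
  nonNegative⁻¹ (a * b) {{nonNeg*nonNeg⇒nonNeg a {{nonNegative 0≤a}} b {{nonNegative 0≤b}}}}

*-monoʳ : ∀ {a b c} → 0ℚ ≤ c → a ≤ b → c * a ≤ c * b
*-monoʳ {c = c} 0≤c = *-monoˡ-≤-nonNeg c {{nonNegative 0≤c}}

*-mono : ∀ {a b c d} → 0ℚ ≤ a → 0ℚ ≤ d → a ≤ b → c ≤ d → a * c ≤ b * d
*-mono {a} {b} {c} {d} 0≤a 0≤d a≤b c≤d =
  ≤-trans (*-monoʳ 0≤a c≤d) (*-monoʳ-≤-nonNeg d {{nonNegative 0≤d}} a≤b)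

^-nonNeg : ∀ {a} n → 0ℚ ≤ a → 0ℚ ≤ a ^ n
^-nonNeg zero    0≤a = nonNegative⁻¹ 1ℚ
^-nonNeg (suc n) 0≤a = *-nonNeg 0≤a (^-nonNeg n 0≤a)

^-mono-≤ : ∀ {a b} n → 0ℚ ≤ a → a ≤ b → a ^ n ≤ b ^ n
^-mono-≤ zero    0≤a a≤b = ≤-refl
^-mono-≤ (suc n) 0≤a a≤b = *-mono 0≤a (^-nonNeg n (≤-trans 0≤a a≤b)) a≤b (^-mono-≤ n 0≤a a≤b)

^-distribʳ-* : ∀ a b n → (a * b) ^ n ≡ a ^ n * b ^ n
^-distribʳ-* a b zero    = refl
^-distribʳ-* a b (suc n) = trans (cong (a * b *_) (^-distribʳ-* a b n))
  (solve 4 (λ a b c d → a :* b :* (c :* d) := a :* c :* (b :* d)) refl a b (a ^ n) (b ^ n))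
  where open +-*-Solver

1^n≡1 : ∀ n → 1ℚ ^ n ≡ 1ℚ
1^n≡1 zero    = refl
1^n≡1 (suc n) = trans (*-identityˡ (1ℚ ^ n)) (1^n≡1 n)

^-anti-≤ : ∀ {a m n} → 0ℚ ≤ a → a ≤ 1ℚ → m ℕ.≤ n → a ^ n ≤ a ^ m
^-anti-≤ {a} {n = n} 0≤a a≤1 ℕ.z≤n = subst (a ^ n ≤_) (1^n≡1 n) (^-mono-≤ n 0≤a a≤1)
^-anti-≤ 0≤a a≤1 (ℕ.s≤s m≤n) = *-monoʳ 0≤a (^-anti-≤ 0≤a a≤1 m≤n)

ι-^ : ∀ m n → ι (m ℕ.^ n) ≡ ι m ^ n
ι-^ m zero    = refl
ι-^ m (suc n) = trans (ι-* m (m ℕ.^ n)) (cong (ι m *_) (ι-^ m n))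

p-q≥0 : ∀ {a b} → b ≤ a → 0ℚ ≤ a - b
p-q≥0 {a} {b} b≤a = subst (_≤ a - b) (+-inverseʳ b) (+-monoˡ-≤ (- b) b≤a)

p-q≥0⁻¹ : ∀ {a b} → 0ℚ ≤ a - b → b ≤ a
p-q≥0⁻¹ {a} {b} 0≤a-b = subst₂ _≤_ (+-identityˡ b)
  (solve 2 (λ a b → a :- b :+ b := a) refl a b) (+-monoˡ-≤ b 0≤a-b)
  where open +-*-Solver

x²-nonNeg : ∀ a → 0ℚ ≤ a * a
x²-nonNeg a with ≤-total 0ℚ a
... | inj₁ 0≤a = *-nonNeg 0≤a 0≤a
... | inj₂ a≤0 = subst (0ℚ ≤_) (solve 1 (λ a → (:- a) :* (:- a) := a :* a) refl a)
                   (*-nonNeg (neg-antimono-≤ a≤0) (neg-antimono-≤ a≤0))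
  where open +-*-Solver

ab≤½[a²+b²] : ∀ a b → a * b ≤ ½ * (a * a + b * b)
ab≤½[a²+b²] a b = p-q≥0⁻¹ (subst (0ℚ ≤_)
  (solve 2 (λ a b → con ½ :* ((a :- b) :* (a :- b)) := con ½ :* (a :* a :+ b :* b) :- a :* b) refl a b)
  (*-nonNeg (nonNegative⁻¹ ½) (x²-nonNeg (a - b))))
  where open +-*-Solver

-- Induction, because (1 + x)(1 - (n + 1) x) ≤ 1 - n x.
bernoulli : ∀ x n → 0ℚ ≤ x → (1ℚ + x) ^ n * (1ℚ - ι n * x) ≤ 1ℚ
bernoulli x zero    0≤x = ≤-reflexive (solve 1 (λ x → con 1ℚ :* (con 1ℚ :- con 0ℚ :* x) := con 1ℚ) refl x)
  where open +-*-Solver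
bernoulli x (suc n) 0≤x = begin
  (1ℚ + x) * (1ℚ + x) ^ n * (1ℚ - ι (suc n) * x)
    ≡⟨ cong (λ i → (1ℚ + x) * (1ℚ + x) ^ n * (1ℚ - i * x)) (ι-+ 1 n) ⟩
  (1ℚ + x) * (1ℚ + x) ^ n * (1ℚ - (1ℚ + ι n) * x)
    ≡⟨ solve 3 (λ x e i → (con 1ℚ :+ x) :* e :* (con 1ℚ :- (con 1ℚ :+ i) :* x)
                       := e :* (con 1ℚ :- i :* x :- (con 1ℚ :+ i) :* (x :* x))) refl x ((1ℚ + x) ^ n) (ι n) ⟩
  (1ℚ + x) ^ n * (1ℚ - ι n * x - (1ℚ + ι n) * (x * x))
    ≤⟨ *-monoʳ (^-nonNeg n (+-nonNeg (nonNegative⁻¹ 1ℚ) 0≤x))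
         (p-q≥0⁻¹ (subst (0ℚ ≤_) (solve 2 (λ a b → b := a :- (a :- b)) refl (1ℚ - ι n * x) ((1ℚ + ι n) * (x * x)))
           (*-nonNeg (+-nonNeg (nonNegative⁻¹ 1ℚ) (0≤ι n)) (x²-nonNeg x)))) ⟩
  (1ℚ + x) ^ n * (1ℚ - ι n * x)
    ≤⟨ bernoulli x n 0≤x ⟩
  1ℚ ∎
  where
  open ≤-Reasoning
  open +-*-Solver

-- Finite sums

sum-mono-≤ : ∀ {n} (f g : Fin n → ℚ) → (∀ i → f i ≤ g i) → sum f ≤ sum g
sum-mono-≤ {zero}  f g f≤g = ≤-refl
sum-mono-≤ {suc n} f g f≤g = +-mono-≤ (f≤g zero) (sum-mono-≤ (f ∘ suc) (g ∘ suc) (f≤g ∘ suc))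

sum-nonNeg : ∀ {n} (f : Fin n → ℚ) → (∀ i → 0ℚ ≤ f i) → 0ℚ ≤ sum f
sum-nonNeg {zero}  f 0≤f = ≤-refl
sum-nonNeg {suc n} f 0≤f = +-nonNeg (0≤f zero) (sum-nonNeg (f ∘ suc) (0≤f ∘ suc))

sum-const : ∀ n c → ∑[ i < n ] c ≡ ι n * c
sum-const zero    c = sym (*-zeroˡ c)
sum-const (suc n) c = begin
  c + ∑[ i < n ] c  ≡⟨ cong (c +_) (sum-const n c) ⟩
  c + ι n * c       ≡⟨ solve 2 (λ c i → c :+ i :* c := (con 1ℚ :+ i) :* c) refl c (ι n) ⟩
  (1ℚ + ι n) * c    ≡⟨ cong (_* c) (ι-+ 1 n) ⟨
  ι (suc n) * c     ∎
  where
  open ≡-Reasoning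
  open +-*-Solver

-- Partial sums of the exponential series and lower bounds for logarithms

partialSum-mono-≤ : ∀ {a b : ℕ → ℚ} n → (∀ i → a i ≤ b i) → partialSum a n ≤ partialSum b n
partialSum-mono-≤ {a} {b} n a≤b = sum-mono-≤ {n} (a ∘ toℕ) (b ∘ toℕ) (a≤b ∘ toℕ)

partialSum-suc-≤ : ∀ {a : ℕ → ℚ} n → (∀ i → 0ℚ ≤ a i) → partialSum a n ≤ partialSum a (suc n)
partialSum-suc-≤ {a} zero    0≤a = +-nonNeg (0≤a 0) ≤-refl
partialSum-suc-≤ {a} (suc n) 0≤a = +-monoʳ-≤ (a 0) (partialSum-suc-≤ {a ∘ suc} n (0≤a ∘ suc))

1/! : ℕ → ℚ
1/! i = (ℤ.+ 1 / (i !)) {{i !≢0}}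

0≤1/! : ∀ i → 0ℚ ≤ 1/! i
0≤1/! i = 0≤1/ (i !) {{i !≢0}}

1/!-suc : ∀ i → ι (suc i) * 1/! (suc i) ≡ 1/! i
1/!-suc i = begin
  ι (suc i) * 1/! (suc i)                        ≡⟨ *-identityʳ _ ⟨
  ι (suc i) * 1/! (suc i) * 1ℚ                   ≡⟨ cong (ι (suc i) * 1/! (suc i) *_) (ι-recip (i !) {{i !≢0}}) ⟨
  ι (suc i) * 1/! (suc i) * (ι (i !) * 1/! i)    ≡⟨ solve 4 (λ a b c d → a :* b :* (c :* d) := a :* c :* b :* d) refl
                                                      (ι (suc i)) (1/! (suc i)) (ι (i !)) (1/! i) ⟩
  ι (suc i) * ι (i !) * 1/! (suc i) * 1/! i      ≡⟨ cong (λ z → z * 1/! (suc i) * 1/! i) (ι-* (suc i) (i !)) ⟨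
  ι (suc i !) * 1/! (suc i) * 1/! i              ≡⟨ cong (_* 1/! i) (ι-recip (suc i !) {{suc i !≢0}}) ⟩
  1ℚ * 1/! i                                     ≡⟨ *-identityˡ (1/! i) ⟩
  1/! i                                          ∎
  where
  open ≡-Reasoning
  open +-*-Solver

module _ {x h : ℚ} (0≤x : 0ℚ ≤ x) (0≤h : 0ℚ ≤ h) where

  private
    0≤x+h : 0ℚ ≤ x + h
    0≤x+h = +-nonNeg 0≤x 0≤h

    x≤x+h : x ≤ x + h
    x≤x+h = subst (_≤ x + h) (+-identityʳ x) (+-monoʳ-≤ x 0≤h)

  -- Mean value bound: on `[x, x + h]` the derivative of the power is largest at the right end,
  -- where it is `(n + 1) (x + h)^n`.
  ^-meanValue : ∀ n → (x + h) ^ suc n ≤ x ^ suc n + ι (suc n) * (h * (x + h) ^ n)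
  ^-meanValue zero    = ≤-reflexive
    (solve 2 (λ x h → (x :+ h) :* con 1ℚ := x :* con 1ℚ :+ con 1ℚ :* (h :* con 1ℚ)) refl x h)
    where open +-*-Solver
  ^-meanValue (suc n) = begin
    (x + h) * (x + h) ^ suc n
      ≤⟨ *-monoʳ 0≤x+h (^-meanValue n) ⟩
    (x + h) * (x ^ suc n + ι (suc n) * (h * (x + h) ^ n))
      ≡⟨ solve 5 (λ x h a i b → (x :+ h) :* (a :+ i :* (h :* b)) :=
                   x :* a :+ (h :* a :+ i :* (h :* ((x :+ h) :* b)))) refl x h (x ^ suc n) (ι (suc n)) ((x + h) ^ n) ⟩
    x * x ^ suc n + (h * x ^ suc n + ι (suc n) * (h * (x + h) ^ suc n))
      ≤⟨ +-monoʳ-≤ (x * x ^ suc n) (+-monoˡ-≤ (ι (suc n) * (h * (x + h) ^ suc n))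
           (*-monoʳ 0≤h (^-mono-≤ (suc n) 0≤x x≤x+h))) ⟩
    x * x ^ suc n + (h * (x + h) ^ suc n + ι (suc n) * (h * (x + h) ^ suc n))
      ≡⟨ cong (x * x ^ suc n +_) (solve 2 (λ a i → a :+ i :* a := (con 1ℚ :+ i) :* a) refl (h * (x + h) ^ suc n) (ι (suc n))) ⟩
    x * x ^ suc n + (1ℚ + ι (suc n)) * (h * (x + h) ^ suc n)
      ≡⟨ cong (λ i → x * x ^ suc n + i * (h * (x + h) ^ suc n)) (ι-+ 1 (suc n)) ⟨
    x * x ^ suc n + ι (suc (suc n)) * (h * (x + h) ^ suc n) ∎
    where
    open ≤-Reasoning
    open +-*-Solver

  -- Termwise `^-meanValue`: by `1/!-suc`, differentiation shifts the series, so the derivative is a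
  -- partial sum of exp with one term fewer. Rearranged, one step of length `h` satisfies
  -- `(1 - h) E(x + h) ≤ E(x)`.
  expPartial-meanValue : ∀ n → expPartial (x + h) n ≤ expPartial x n + h * expPartial (x + h) n
  expPartial-meanValue zero    = ≤-reflexive (sym (trans (+-identityˡ (h * 0ℚ)) (*-zeroʳ h)))
  expPartial-meanValue (suc n) = begin
    1ℚ * 1/! 0 + partialSum (λ i → (x + h) ^ suc i * 1/! (suc i)) n
      ≤⟨ +-monoʳ-≤ (1ℚ * 1/! 0) (partialSum-mono-≤ n term) ⟩
    1ℚ * 1/! 0 + partialSum (λ i → x ^ suc i * 1/! (suc i) + h * ((x + h) ^ i * 1/! i)) n
      ≡⟨ cong (1ℚ * 1/! 0 +_) (∑-distrib-+ {n} (λ i → x ^ suc (toℕ i) * 1/! (suc (toℕ i))) (λ i → h * ((x + h) ^ toℕ i * 1/! (toℕ i)))) ⟩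
    1ℚ * 1/! 0 + (partialSum (λ i → x ^ suc i * 1/! (suc i)) n + ∑[ i < n ] (h * ((x + h) ^ toℕ i * 1/! (toℕ i))))
      ≡⟨ +-assoc (1ℚ * 1/! 0) (partialSum (λ i → x ^ suc i * 1/! (suc i)) n) _ ⟨
    expPartial x (suc n) + ∑[ i < n ] (h * ((x + h) ^ toℕ i * 1/! (toℕ i)))
      ≡⟨ cong (expPartial x (suc n) +_) (*-distribˡ-sum {n} h (λ i → (x + h) ^ toℕ i * 1/! (toℕ i))) ⟨
    expPartial x (suc n) + h * expPartial (x + h) n
      ≤⟨ +-monoʳ-≤ (expPartial x (suc n)) (*-monoʳ 0≤h
           (partialSum-suc-≤ n (λ i → *-nonNeg (^-nonNeg i 0≤x+h) (0≤1/! i)))) ⟩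
    expPartial x (suc n) + h * expPartial (x + h) (suc n) ∎
    where
    open ≤-Reasoning
    open +-*-Solver
    term : ∀ i → (x + h) ^ suc i * 1/! (suc i) ≤ x ^ suc i * 1/! (suc i) + h * ((x + h) ^ i * 1/! i)
    term i = begin
      (x + h) ^ suc i * 1/! (suc i)
        ≤⟨ *-monoʳ-≤-nonNeg (1/! (suc i)) {{nonNegative (0≤1/! (suc i))}} (^-meanValue i) ⟩
      (x ^ suc i + ι (suc i) * (h * (x + h) ^ i)) * 1/! (suc i)
        ≡⟨ solve 5 (λ a i h b c → (a :+ i :* (h :* b)) :* c := a :* c :+ h :* (b :* (i :* c))) refl
             (x ^ suc i) (ι (suc i)) h ((x + h) ^ i) (1/! (suc i)) ⟩
      x ^ suc i * 1/! (suc i) + h * ((x + h) ^ i * (ι (suc i) * 1/! (suc i)))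
        ≡⟨ cong (λ c → x ^ suc i * 1/! (suc i) + h * ((x + h) ^ i * c)) (1/!-suc i) ⟩
      x ^ suc i * 1/! (suc i) + h * ((x + h) ^ i * 1/! i) ∎

expPartial-mono-≤ : ∀ {x y} n → 0ℚ ≤ x → x ≤ y → expPartial x n ≤ expPartial y n
expPartial-mono-≤ n 0≤x x≤y = partialSum-mono-≤ n (λ i →
  *-monoʳ-≤-nonNeg (1/! i) {{nonNegative (0≤1/! i)}} (^-mono-≤ i 0≤x x≤y))

expPartial-0 : ∀ n → expPartial 0ℚ n ≤ 1ℚ
expPartial-0 zero    = nonNegative⁻¹ 1ℚ
expPartial-0 (suc n) = +-monoʳ-≤ 1ℚ (begin
  partialSum (λ i → 0ℚ * 0ℚ ^ i * 1/! (suc i)) n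
    ≡⟨ sum-cong-≗ {n} (λ i → trans (cong (_* 1/! (suc (toℕ i))) (*-zeroˡ (0ℚ ^ toℕ i))) (*-zeroˡ (1/! (suc (toℕ i))))) ⟩
  ∑[ i < n ] 0ℚ                                  ≡⟨ sum-const n 0ℚ ⟩
  ι n * 0ℚ                                       ≡⟨ *-zeroʳ (ι n) ⟩
  0ℚ                                             ∎)
  where open ≤-Reasoning

-- Each increment of the argument by `h` multiplies the partial sum by at most `b = 1/(1 - h)`,
-- uniformly in the number `n` of terms, so exp is bounded above without a limit.
expPartial-≤ : ∀ {h b} → 0ℚ ≤ h → 0ℚ ≤ b → b * (1ℚ - h) ≡ 1ℚ → ∀ j n → expPartial (ι j * h) n ≤ b ^ j
expPartial-≤ {h} {b} 0≤h 0≤b b[1-h]≡1 zero    n =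
  subst (λ z → expPartial z n ≤ 1ℚ) (sym (*-zeroˡ h)) (expPartial-0 n)
expPartial-≤ {h} {b} 0≤h 0≤b b[1-h]≡1 (suc j) n = begin
  expPartial (ι (suc j) * h) n
    ≡⟨ cong (λ z → expPartial z n) (trans (cong (_* h) (ι-+ 1 j))
         (solve 2 (λ i h → (con 1ℚ :+ i) :* h := i :* h :+ h) refl (ι j) h)) ⟩
  e                  ≡⟨ *-identityˡ e ⟨
  1ℚ * e             ≡⟨ cong (_* e) b[1-h]≡1 ⟨
  b * (1ℚ - h) * e   ≡⟨ solve 3 (λ b h e → b :* (con 1ℚ :- h) :* e := b :* (e :- h :* e)) refl b h e ⟩
  b * (e - h * e)    ≤⟨ *-monoʳ 0≤b (≤-trans (+-monoˡ-≤ (- (h * e)) (expPartial-meanValue (*-nonNeg (0≤ι j) 0≤h) 0≤h n))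
                          (≤-reflexive (solve 2 (λ a c → a :+ c :- c := a) refl (expPartial (ι j * h) n) (h * e)))) ⟩
  b * expPartial (ι j * h) n
                     ≤⟨ *-monoʳ 0≤b (expPartial-≤ 0≤h 0≤b b[1-h]≡1 j n) ⟩
  b * b ^ j          ∎
  where
  e = expPartial (ι j * h + h) n
  open ≤-Reasoning
  open +-*-Solver

-- With `h = ½` and `b = 2`, `expPartial-≤` bounds exp (j/2) by `2^j`. This is the crude estimate
-- `log 2 ≥ ½`, which costs only a constant factor.
2^j<exp⇒j/2<x : ∀ {x} j n → 0ℚ ≤ x → ι (2 ℕ.^ j) < expPartial x n → ι j * ½ < x
2^j<exp⇒j/2<x {x} j n 0≤x 2^j<e = ≰⇒> (λ x≤j/2 → <-irrefl refl (<-≤-trans 2^j<e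
  (≤-trans (expPartial-mono-≤ n 0≤x x≤j/2)
    (≤-trans (expPartial-≤ (nonNegative⁻¹ ½) (0≤ι 2) refl j n) (≤-reflexive (sym (ι-^ 2 j)))))))

-- exp (17/16) ≤ (16/15)^17 < 3.  Hence log 3 stays above 1, so log log p is bounded away from 0.
3<exp⇒17/16<x : ∀ {x} n → 0ℚ ≤ x → ι 3 < expPartial x n → ℤ.+ 17 / 16 < x
3<exp⇒17/16<x {x} n 0≤x 3<e = ≰⇒> (λ x≤ → <-irrefl refl (<-≤-trans 3<e
  (≤-trans (expPartial-mono-≤ n 0≤x x≤)
    (≤-trans (expPartial-≤ {ℤ.+ 1 / 16} {ℤ.+ 16 / 15} (nonNegative⁻¹ _) (nonNegative⁻¹ _) refl 17 n)
      (≤ᵇ⇒≤ _)))))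

-- One step of `expPartial-≤` with `h = 1/17`, for which `1/(1 - h) = 17/16`. Together with the
-- preceding bound it keeps log log p above 1/17.
17/16<exp⇒1/17<x : ∀ {x} n → 0ℚ ≤ x → ℤ.+ 17 / 16 < expPartial x n → ℤ.+ 1 / 17 < x
17/16<exp⇒1/17<x {x} n 0≤x 3<e = ≰⇒> (λ x≤ → <-irrefl refl (<-≤-trans 3<e
  (≤-trans (expPartial-mono-≤ n 0≤x x≤)
    (expPartial-≤ {ℤ.+ 1 / 17} {ℤ.+ 17 / 16} (nonNegative⁻¹ _) (nonNegative⁻¹ _) refl 1 n))))

*-cancel-½ : ∀ {a b} → a * ½ ≤ b → a ≤ ι 2 * b
*-cancel-½ {a} {b} a/2≤b = subst (_≤ ι 2 * b)
  (solve 1 (λ a → con (ι 2) :* (a :* con ½) := a) refl a) (*-monoʳ (0≤ι 2) a/2≤b)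
  where open +-*-Solver

-- 11616 = 48 · 2 · 121, where L ≤ 2 log p and j + 6 ≤ 121 log log p.
≤ᴿ-log*loglog : ∀ {p L j n} → 3 ℕ.≤ p → 2 ℕ.^ L ℕ.≤ p → 2 ℕ.^ j ℕ.≤ L →
                n ℕ.≤ 48 ℕ.* (L ℕ.* (j ℕ.+ 6)) →
                fromℕ n ≤ᴿ fromℕ 11616 *ᴿ (log (fromℕ p) *ᴿ log (log (fromℕ p)))
-- A rational above the product unpacks into witnesses: `r` and `v` are two upper bounds of log p,
-- one from the factor log p and one from inside log log p, and `s` bounds log log p because
-- `v < exp s`.
≤ᴿ-log*loglog {p} {L} {j} {n} 3≤p 2^L≤p 2^j≤L n≤
  q (a , b , C<a , (x , y , (r , n₁ , 0≤r , r<x , p<eʳ) , (s , n₂ , 0≤s , s<y , (v , n₃ , 0≤v , v<eˢ , p<eᵛ)) , xy<b) , ab<q) =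
  ≤-<-trans (begin
    ι n
      ≤⟨ ι-mono-≤ n≤ ⟩
    ι (48 ℕ.* (L ℕ.* (j ℕ.+ 6)))
      ≡⟨ trans (ι-* 48 (L ℕ.* (j ℕ.+ 6))) (cong (ι 48 *_) (ι-* L (j ℕ.+ 6))) ⟩
    ι 48 * (ι L * ι (j ℕ.+ 6))
      ≤⟨ *-monoʳ (0≤ι 48) (*-mono (0≤ι L) (*-nonNeg (0≤ι 121) 0≤s) L≤2r j+6≤121s) ⟩
    ι 48 * (ι 2 * r * (ι 121 * s))
      ≡⟨ solve 2 (λ r s → con (ι 48) :* (con (ι 2) :* r :* (con (ι 121) :* s)) := con (ι 11616) :* (r :* s)) refl r s ⟩
    ι 11616 * (r * s)
      ≤⟨ *-monoʳ (0≤ι 11616) (*-mono 0≤r (≤-trans 0≤s (<⇒≤ s<y)) (<⇒≤ r<x) (<⇒≤ s<y)) ⟩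
    ι 11616 * (x * y)
      ≤⟨ *-mono (0≤ι 11616) (≤-trans (*-nonNeg (≤-trans 0≤r (<⇒≤ r<x)) (≤-trans 0≤s (<⇒≤ s<y))) (<⇒≤ xy<b)) (<⇒≤ C<a) (<⇒≤ xy<b) ⟩
    a * b ∎) ab<q
  where
  open ≤-Reasoning
  open +-*-Solver

  L/2<log : ∀ {z m} → 0ℚ ≤ z → ι p < expPartial z m → ι L * ½ < z
  L/2<log {m = m} 0≤z p<e = 2^j<exp⇒j/2<x L m 0≤z (≤-<-trans (ι-mono-≤ 2^L≤p) p<e)

  L≤2r : ι L ≤ ι 2 * r
  L≤2r = *-cancel-½ (<⇒≤ (L/2<log {m = n₁} 0≤r p<eʳ))

  17/16<eˢ : ℤ.+ 17 / 16 < expPartial s n₂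
  17/16<eˢ = <-trans (3<exp⇒17/16<x n₃ 0≤v (≤-<-trans (ι-mono-≤ 3≤p) p<eᵛ)) v<eˢ

  1≤17s : 1ℚ ≤ ι 17 * s
  1≤17s = *-monoʳ {c = ι 17} (0≤ι 17) (<⇒≤ (17/16<exp⇒1/17<x n₂ 0≤s 17/16<eˢ))

  -- Only `L/2` is known to lie below `v`, so `2^(i+1) ≤ L` yields `2^i < exp s`, one exponent less;
  -- hence the summand 1.
  j≤1+2s : ∀ i → 2 ℕ.^ i ℕ.≤ L → ι i ≤ 1ℚ + ι 2 * s
  j≤1+2s zero    _ = +-nonNeg (nonNegative⁻¹ 1ℚ) (*-nonNeg (0≤ι 2) 0≤s)
  j≤1+2s (suc i) 2^i≤L = begin
    ι (suc i)       ≡⟨ ι-+ 1 i ⟩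
    1ℚ + ι i        ≤⟨ +-monoʳ-≤ 1ℚ (*-cancel-½ {ι i} (<⇒≤ (2^j<exp⇒j/2<x i n₂ 0≤s 2^i<eˢ))) ⟩
    1ℚ + ι 2 * s    ∎
    where
    2^i<eˢ : ι (2 ℕ.^ i) < expPartial s n₂
    2^i<eˢ = begin-strict
      ι (2 ℕ.^ i)               ≡⟨ solve 1 (λ z → z := con (ι 2) :* z :* con ½) refl (ι (2 ℕ.^ i)) ⟩
      ι 2 * ι (2 ℕ.^ i) * ½     ≡⟨ cong (_* ½) (ι-* 2 (2 ℕ.^ i)) ⟨
      ι (2 ℕ.^ suc i) * ½       ≤⟨ *-monoʳ-≤-nonNeg ½ (ι-mono-≤ 2^i≤L) ⟩
      ι L * ½                   <⟨ L/2<log {m = n₃} 0≤v p<eᵛ ⟩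
      v                         <⟨ v<eˢ ⟩
      expPartial s n₂           ∎

  -- The additive constant `1 + 6 = 7` is absorbed through `1 ≤ 17 s`, giving `2 + 7 * 17 = 121`.
  j+6≤121s : ι (j ℕ.+ 6) ≤ ι 121 * s
  j+6≤121s = begin
    ι (j ℕ.+ 6)                       ≡⟨ ι-+ j 6 ⟩
    ι j + ι 6                         ≤⟨ +-monoˡ-≤ (ι 6) (j≤1+2s j 2^j≤L) ⟩
    1ℚ + ι 2 * s + ι 6
      ≡⟨ solve 1 (λ s → con 1ℚ :+ con (ι 2) :* s :+ con (ι 6) := con (ι 2) :* s :+ con (ι 7) :* con 1ℚ) refl s ⟩
    ι 2 * s + ι 7 * 1ℚ                ≤⟨ +-monoʳ-≤ (ι 2 * s) (*-monoʳ (0≤ι 7) 1≤17s) ⟩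
    ι 2 * s + ι 7 * (ι 17 * s)
      ≡⟨ solve 1 (λ s → con (ι 2) :* s :+ con (ι 7) :* (con (ι 17) :* s) := con (ι 121) :* s) refl s ⟩
    ι 121 * s                         ∎

-- Choice of the parameters

dyadic : ∀ n → 1 ℕ.≤ n → ∃[ k ] (2 ℕ.^ k ℕ.≤ n × n ℕ.< 2 ℕ.^ suc k)
dyadic (suc zero)    _ = 0 , ℕ.≤-refl , ℕ.≤-refl
dyadic (suc (suc n)) _ with dyadic (suc n) (ℕ.s≤s ℕ.z≤n)
... | k , 2^k≤ , <2^1+k with suc (suc n) ℕ.<? 2 ℕ.^ suc k
...   | yes < = k , ℕ.m≤n⇒m≤1+n 2^k≤ , <
...   | no  ≮ = suc k , ℕ.≮⇒≥ ≮ , ℕ.≤-<-trans <2^1+k (ℕ.m<m+n (2 ℕ.^ suc k) (ℕ.m≤n⇒m≤n+o 0 (ℕ.m^n>0 2 (suc k))))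

module _ where
  open ℕ.≤-Reasoning

  L+3≤4L : ∀ L → 1 ℕ.≤ L → L ℕ.+ 3 ℕ.≤ 4 ℕ.* L
  L+3≤4L L 1≤L = ℕ.+-monoʳ-≤ L (ℕ.*-monoʳ-≤ 3 1≤L)

  4p≤2^[L+3] : ∀ p L → p ℕ.< 2 ℕ.^ suc L → 4 ℕ.* p ℕ.≤ 2 ℕ.^ (L ℕ.+ 3)
  4p≤2^[L+3] p L p<2^1+L = begin
    4 ℕ.* p                 ≤⟨ ℕ.*-monoʳ-≤ 4 (ℕ.<⇒≤ p<2^1+L) ⟩
    4 ℕ.* (2 ℕ.* 2 ℕ.^ L)    ≡⟨ ℕ.*-assoc 4 2 (2 ℕ.^ L) ⟨
    8 ℕ.* 2 ℕ.^ L           ≡⟨ ℕ.*-comm 8 (2 ℕ.^ L) ⟩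
    2 ℕ.^ L ℕ.* 8           ≡⟨ ℕ.^-distribˡ-+-* 2 L 3 ⟨
    2 ℕ.^ (L ℕ.+ 3)         ∎

  8t≤2^[j+6] : ∀ L j → 1 ℕ.≤ L → L ℕ.< 2 ℕ.^ suc j → 8 ℕ.* (L ℕ.+ 3) ℕ.≤ 2 ℕ.^ (j ℕ.+ 6)
  8t≤2^[j+6] L j 1≤L L<2^1+j = begin
    8 ℕ.* (L ℕ.+ 3)         ≤⟨ ℕ.*-monoʳ-≤ 8 (L+3≤4L L 1≤L) ⟩
    8 ℕ.* (4 ℕ.* L)         ≡⟨ ℕ.*-assoc 8 4 L ⟨
    32 ℕ.* L                ≤⟨ ℕ.*-monoʳ-≤ 32 (ℕ.<⇒≤ L<2^1+j) ⟩
    32 ℕ.* (2 ℕ.* 2 ℕ.^ j)  ≡⟨ ℕ.*-assoc 32 2 (2 ℕ.^ j) ⟨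
    64 ℕ.* 2 ℕ.^ j          ≡⟨ ℕ.*-comm 64 (2 ℕ.^ j) ⟩
    2 ℕ.^ j ℕ.* 64          ≡⟨ ℕ.^-distribˡ-+-* 2 j 6 ⟨
    2 ℕ.^ (j ℕ.+ 6)         ∎

  3[j+6]≤2^s : ∀ j s → 6 ℕ.* (j ℕ.+ 6) ℕ.< 2 ℕ.^ suc s → 3 ℕ.* (j ℕ.+ 6) ℕ.≤ 2 ℕ.^ s
  3[j+6]≤2^s j s <2^1+s = ℕ.*-cancelˡ-≤ 2 (begin
    2 ℕ.* (3 ℕ.* (j ℕ.+ 6))  ≡⟨ ℕ.*-assoc 2 3 (j ℕ.+ 6) ⟨
    6 ℕ.* (j ℕ.+ 6)         ≤⟨ ℕ.<⇒≤ <2^1+s ⟩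
    2 ℕ.* 2 ℕ.^ s           ∎)

  t*2^[s+1]≤ : ∀ L j s → 1 ℕ.≤ L → 2 ℕ.^ s ℕ.≤ 6 ℕ.* (j ℕ.+ 6) →
               (L ℕ.+ 3) ℕ.* 2 ℕ.^ suc s ℕ.≤ 48 ℕ.* (L ℕ.* (j ℕ.+ 6))
  t*2^[s+1]≤ L j s 1≤L 2^s≤ = begin
    (L ℕ.+ 3) ℕ.* (2 ℕ.* 2 ℕ.^ s)               ≤⟨ ℕ.*-mono-≤ (L+3≤4L L 1≤L) (ℕ.*-monoʳ-≤ 2 2^s≤) ⟩
    (4 ℕ.* L) ℕ.* (2 ℕ.* (6 ℕ.* (j ℕ.+ 6)))     ≡⟨ cong (4 ℕ.* L ℕ.*_) (ℕ.*-assoc 2 6 (j ℕ.+ 6)) ⟨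
    (4 ℕ.* L) ℕ.* (12 ℕ.* (j ℕ.+ 6))            ≡⟨ ℕ.[m*n]*[o*p]≡[m*o]*[n*p] 4 L 12 (j ℕ.+ 6) ⟩
    48 ℕ.* (L ℕ.* (j ℕ.+ 6))                   ∎

-- `4p ≤ 2^t` keeps the unevenness of `2j mod p` for `j < 2^t` within a factor 5/4; the next two
-- bounds make the failure probability of a position at most `1/(8t)` after `2^s` copies.
parameters : ∀ {p} → 3 ℕ.≤ p → ∃[ t ] ∃[ a ] ∃[ s ]
  (4 ℕ.* p ℕ.≤ 2 ℕ.^ t × 8 ℕ.* t ℕ.≤ 2 ℕ.^ a × 3 ℕ.* a ℕ.≤ 2 ℕ.^ s ×
   fromℕ (t ℕ.* 2 ℕ.^ suc s) ≤ᴿ fromℕ 11616 *ᴿ (log (fromℕ p) *ᴿ log (log (fromℕ p))))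
parameters {p} 3≤p =
  let L , 2^L≤p , p<2^1+L = dyadic p (ℕ.≤-trans (ℕ.s≤s ℕ.z≤n) 3≤p)
      1≤L = ℕ.≮⇒≥ (λ L<1 → ℕ.<-irrefl refl (ℕ.≤-trans 3≤p
              (ℕ.≤-trans (ℕ.<⇒≤ p<2^1+L) (ℕ.^-monoʳ-≤ 2 L<1))))
      j , 2^j≤L , L<2^1+j = dyadic L 1≤L
      -- Rounding down to a power of two loses up to a factor 2, so the target is twice the required
      -- `3a`, where `a = j + 6`.
      s , 2^s≤ , <2^1+s   = dyadic (6 ℕ.* (j ℕ.+ 6)) (ℕ.≤-trans (ℕ.m≤n+m 1 j) (ℕ.≤-trans (ℕ.+-monoʳ-≤ j (ℕ.s≤s ℕ.z≤n)) (ℕ.m≤n*m (j ℕ.+ 6) 6)))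
  in L ℕ.+ 3 , j ℕ.+ 6 , s ,
     4p≤2^[L+3] p L p<2^1+L ,
     8t≤2^[j+6] L j 1≤L L<2^1+j ,
     3[j+6]≤2^s j s <2^1+s ,
     ≤ᴿ-log*loglog {p} {L} {j} 3≤p 2^L≤p 2^j≤L (t*2^[s+1]≤ L j s 1≤L 2^s≤)

-- Reindexing of finite sums and point masses

sum-reindex : ∀ {n} (π π⁻¹ : Fin n → Fin n) → (∀ x → π (π⁻¹ x) ≡ x) → (∀ x → π⁻¹ (π x) ≡ x) →
              ∀ (f : Fin n → ℚ) → sum f ≡ sum (f ∘ π)
sum-reindex π π⁻¹ inverseˡ inverseʳ f = sum-permute f (permutation π π⁻¹ inverseˡ inverseʳ)

δ-nonNeg : ∀ {n} (x y : Fin n) → 0ℚ ≤ δ x y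
δ-nonNeg zero    zero    = nonNegative⁻¹ 1ℚ
δ-nonNeg zero    (suc y) = ≤-refl
δ-nonNeg (suc x) zero    = ≤-refl
δ-nonNeg (suc x) (suc y) = δ-nonNeg x y

sum-δ : ∀ {n} (a : Fin n) (f : Fin n → ℚ) → ∑[ z < n ] (δ a z * f z) ≡ f a
sum-δ {suc n} zero f = begin
  1ℚ * f zero + ∑[ z < n ] (0ℚ * f (suc z))  ≡⟨ cong₂ _+_ (*-identityˡ (f zero)) (sym (*-distribˡ-sum {n} 0ℚ (f ∘ suc))) ⟩
  f zero + 0ℚ * sum (f ∘ suc)                ≡⟨ cong (f zero +_) (*-zeroˡ (sum (f ∘ suc))) ⟩
  f zero + 0ℚ                                ≡⟨ +-identityʳ (f zero) ⟩
  f zero                                     ∎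
  where open ≡-Reasoning
sum-δ {suc n} (suc a) f =
  trans (cong₂ _+_ (*-zeroˡ (f zero)) (sum-δ a (f ∘ suc))) (+-identityˡ (f (suc a)))

sum-δ-1 : ∀ {n} (a : Fin n) → sum (δ a) ≡ 1ℚ
sum-δ-1 {n} a = trans (sum-cong-≗ {n} (λ z → sym (*-identityʳ (δ a z)))) (sum-δ a (λ _ → 1ℚ))

δ-injective : ∀ {m n} {φ : Fin m → Fin n} {ψ : Fin n → Fin m} → (∀ x → ψ (φ x) ≡ x) →
              ∀ x y → δ (φ x) (φ y) ≡ δ x y
δ-injective {φ = φ} {ψ} ψφ≡id x y with x ≟ᶠ y | φ x ≟ᶠ φ y
... | yes x≡y | yes _     = refl
... | yes x≡y | no φx≢φy  = contradiction (cong φ x≡y) φx≢φy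
... | no x≢y  | yes φx≡φy = contradiction (trans (sym (ψφ≡id x)) (trans (cong ψ φx≡φy) (ψφ≡id y))) x≢y
... | no x≢y  | no _      = refl

-- The group algebra of a finite abelian group

module GroupAlgebra {p : ℕ} {_∙_ : Op₂ (Fin p)} {ε : Fin p} {_⁻¹ : Op₁ (Fin p)}
                    (isAbelianGroup : IsAbelianGroup _≡_ _∙_ ε _⁻¹) where

  private
    G : AbelianGroup _ _
    G = record { isAbelianGroup = isAbelianGroup }

  open AbelianGroup G using (assoc; comm; identityˡ; identityʳ; inverseˡ; inverseʳ)

  open Algebra.Properties.AbelianGroup G using (⁻¹-∙-comm; ⁻¹-involutive; ε⁻¹≈ε)

  infixl 7 _⊖_

  _⊖_ : Op₂ (Fin p)
  x ⊖ y = x ∙ (y ⁻¹)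

  ∙-⊖ : ∀ w z → (w ∙ z) ⊖ z ≡ w
  ∙-⊖ w z = trans (assoc w z (z ⁻¹)) (trans (cong (w ∙_) (inverseʳ z)) (identityʳ w))

  ⊖-∙ : ∀ w z → (w ⊖ z) ∙ z ≡ w
  ⊖-∙ w z = trans (assoc w (z ⁻¹) z) (trans (cong (w ∙_) (inverseˡ z)) (identityʳ w))

  ⊖-∙-⊖ : ∀ y w z → y ⊖ (w ∙ z) ≡ (y ⊖ z) ⊖ w
  ⊖-∙-⊖ y w z = trans (cong (y ∙_) (trans (sym (⁻¹-∙-comm w z)) (comm (w ⁻¹) (z ⁻¹))))
                      (sym (assoc y (z ⁻¹) (w ⁻¹)))

  ⊖-⊖ : ∀ y z → y ⊖ (y ⊖ z) ≡ z
  ⊖-⊖ y z = begin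
    y ⊖ (y ⊖ z)     ≡⟨ ⊖-∙-⊖ y y (z ⁻¹) ⟩
    (y ⊖ z ⁻¹) ⊖ y  ≡⟨ cong (λ v → (y ∙ v) ⊖ y) (⁻¹-involutive z) ⟩
    (y ∙ z) ⊖ y     ≡⟨ cong (_⊖ y) (comm y z) ⟩
    (z ∙ y) ⊖ y     ≡⟨ ∙-⊖ z y ⟩
    z               ∎
    where open ≡-Reasoning

  ⊖-ε : ∀ y → y ⊖ ε ≡ y
  ⊖-ε y = trans (cong (y ∙_) ε⁻¹≈ε) (identityʳ y)

  F : Set
  F = Fin p → ℚ

  infixl 7 _⋆_

  _⋆_ : F → F → F
  (f ⋆ g) y = ∑[ z < p ] (f z * g (y ⊖ z))

  1⋆ : F
  1⋆ = δ ε

  sum-∙ : ∀ (f : F) w → sum f ≡ ∑[ z < p ] f (z ∙ w)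
  sum-∙ f w = sum-reindex (_∙ w) (_⊖ w) (λ z → ⊖-∙ z w) (λ z → ∙-⊖ z w) f

  sum-⊖ : ∀ (f : F) y → sum f ≡ ∑[ z < p ] f (y ⊖ z)
  sum-⊖ f y = sum-reindex (y ⊖_) (y ⊖_) (⊖-⊖ y) (⊖-⊖ y) f

  ⋆-cong : ∀ {f f′ g g′ : F} → f ≗ f′ → g ≗ g′ → f ⋆ g ≗ f′ ⋆ g′
  ⋆-cong f≗f′ g≗g′ y = sum-cong-≗ {p} (λ z → cong₂ _*_ (f≗f′ z) (g≗g′ (y ⊖ z)))

  ⋆-comm : ∀ (f g : F) → f ⋆ g ≗ g ⋆ f
  ⋆-comm f g y = begin
    ∑[ z < p ] (f z * g (y ⊖ z))              ≡⟨ sum-⊖ (λ z → f z * g (y ⊖ z)) y ⟩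
    ∑[ z < p ] (f (y ⊖ z) * g (y ⊖ (y ⊖ z)))  ≡⟨ sum-cong-≗ {p} (λ z → trans (cong (λ w → f (y ⊖ z) * g w) (⊖-⊖ y z))
                                                                       (*-comm (f (y ⊖ z)) (g z))) ⟩
    ∑[ z < p ] (g z * f (y ⊖ z))              ∎
    where open ≡-Reasoning

  ⋆-assoc : ∀ (f g k : F) → (f ⋆ g) ⋆ k ≗ f ⋆ (g ⋆ k)
  ⋆-assoc f g k y = begin
    ∑[ w < p ] (∑[ z < p ] (f z * g (w ⊖ z)) * k (y ⊖ w))
      ≡⟨ sum-cong-≗ {p} (λ w → *-distribʳ-sum {p} (k (y ⊖ w)) (λ z → f z * g (w ⊖ z))) ⟩
    ∑[ w < p ] ∑[ z < p ] (f z * g (w ⊖ z) * k (y ⊖ w))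
      ≡⟨ ∑-comm {p} {p} (λ w z → f z * g (w ⊖ z) * k (y ⊖ w)) ⟩
    ∑[ z < p ] ∑[ w < p ] (f z * g (w ⊖ z) * k (y ⊖ w))
      ≡⟨ sum-cong-≗ {p} (λ z → sum-∙ (λ w → f z * g (w ⊖ z) * k (y ⊖ w)) z) ⟩
    ∑[ z < p ] ∑[ w < p ] (f z * g ((w ∙ z) ⊖ z) * k (y ⊖ (w ∙ z)))
      ≡⟨ sum-cong-≗ {p} (λ z → sum-cong-≗ {p} (λ w →
           trans (cong₂ (λ a b → f z * g a * k b) (∙-⊖ w z) (⊖-∙-⊖ y w z)) (*-assoc (f z) (g w) (k ((y ⊖ z) ⊖ w))))) ⟩
    ∑[ z < p ] ∑[ w < p ] (f z * (g w * k ((y ⊖ z) ⊖ w)))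
      ≡⟨ sum-cong-≗ {p} (λ z → *-distribˡ-sum {p} (f z) (λ w → g w * k ((y ⊖ z) ⊖ w))) ⟨
    ∑[ z < p ] (f z * ∑[ w < p ] (g w * k ((y ⊖ z) ⊖ w))) ∎
    where open ≡-Reasoning

  ⋆-identityˡ : ∀ (f : F) → 1⋆ ⋆ f ≗ f
  ⋆-identityˡ f y = trans (sum-δ ε (λ z → f (y ⊖ z))) (cong f (⊖-ε y))

  ⋆-commutativeMonoid : CommutativeMonoid _ _
  ⋆-commutativeMonoid = record
    { Carrier = F ; _≈_ = _≗_ ; _∙_ = _⋆_ ; ε = 1⋆
    ; isCommutativeMonoid = record
      { isMonoid = record
        { isSemigroup = record
          { isMagma = record
            { isEquivalence = Setoid.isEquivalence (Fin p →-setoid ℚ)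
            ; ∙-cong        = ⋆-cong
            }
          ; assoc = ⋆-assoc
          }
        ; identity = ⋆-identityˡ , λ f y → trans (⋆-comm f 1⋆ y) (⋆-identityˡ f y)
        }
      ; comm = ⋆-comm
      }
    }

  module ⋆-Reasoning where
    open import Relation.Binary.Reasoning.Setoid (CommutativeMonoid.setoid ⋆-commutativeMonoid) public
  open CommutativeMonoid ⋆-commutativeMonoid public using ()
    renaming (∙-congˡ to ⋆-congˡ; ∙-congʳ to ⋆-congʳ; identityʳ to ⋆-identityʳ)
  open Algebra.Properties.CommutativeSemigroup (CommutativeMonoid.commutativeSemigroup ⋆-commutativeMonoid) public
    using () renaming (interchange to ⋆-interchange)

  infixl 6 _⊞_

  _⊞_ : F → F → F
  (f ⊞ g) y = f y + g y

  ⋆-distribʳ-⊞ : ∀ (f g k : F) → (g ⊞ k) ⋆ f ≗ g ⋆ f ⊞ k ⋆ f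
  ⋆-distribʳ-⊞ f g k y = trans
    (sum-cong-≗ {p} (λ z → *-distribʳ-+ (f (y ⊖ z)) (g z) (k z)))
    (∑-distrib-+ {p} (λ z → g z * f (y ⊖ z)) (λ z → k z * f (y ⊖ z)))

  ⋆-distribˡ-⊞ : ∀ (f g k : F) → f ⋆ (g ⊞ k) ≗ f ⋆ g ⊞ f ⋆ k
  ⋆-distribˡ-⊞ f g k y = begin
    (f ⋆ (g ⊞ k)) y          ≡⟨ ⋆-comm f (g ⊞ k) y ⟩
    ((g ⊞ k) ⋆ f) y          ≡⟨ ⋆-distribʳ-⊞ f g k y ⟩
    (g ⋆ f) y + (k ⋆ f) y    ≡⟨ cong₂ _+_ (⋆-comm g f y) (⋆-comm k f y) ⟩
    (f ⋆ g) y + (f ⋆ k) y    ∎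
    where open ≡-Reasoning

  sum-⋆ : ∀ (f g : F) → sum (f ⋆ g) ≡ sum f * sum g
  sum-⋆ f g = begin
    ∑[ y < p ] ∑[ z < p ] (f z * g (y ⊖ z))  ≡⟨ ∑-comm {p} {p} (λ y z → f z * g (y ⊖ z)) ⟩
    ∑[ z < p ] ∑[ y < p ] (f z * g (y ⊖ z))  ≡⟨ sum-cong-≗ {p} (λ z → *-distribˡ-sum {p} (f z) (λ y → g (y ⊖ z))) ⟨
    ∑[ z < p ] (f z * ∑[ y < p ] g (y ⊖ z))  ≡⟨ sum-cong-≗ {p} (λ z → cong (f z *_) (sym (sum-∙ g (z ⁻¹)))) ⟩
    ∑[ z < p ] (f z * sum g)                 ≡⟨ *-distribʳ-sum {p} (sum g) f ⟨
    sum f * sum g                            ∎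
    where open ≡-Reasoning

  NonNeg : F → Set
  NonNeg f = ∀ y → 0ℚ ≤ f y

  ⋆-nonNeg : ∀ {f g} → NonNeg f → NonNeg g → NonNeg (f ⋆ g)
  ⋆-nonNeg {f} {g} 0≤f 0≤g y = sum-nonNeg {p} (λ z → f z * g (y ⊖ z)) (λ z → *-nonNeg (0≤f z) (0≤g (y ⊖ z)))

  ⋆-mono-≤ : ∀ {f f′ g g′} → NonNeg f → NonNeg g′ → (∀ y → f y ≤ f′ y) → (∀ y → g y ≤ g′ y) →
             ∀ y → (f ⋆ g) y ≤ (f′ ⋆ g′) y
  ⋆-mono-≤ {f} {f′} {g} {g′} 0≤f 0≤g′ f≤f′ g≤g′ y =
    sum-mono-≤ {p} (λ z → f z * g (y ⊖ z)) (λ z → f′ z * g′ (y ⊖ z))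
      (λ z → *-mono (0≤f z) (0≤g′ (y ⊖ z)) (f≤f′ z) (g≤g′ (y ⊖ z)))

  ⋆-≤-bound : ∀ {f g c} → NonNeg g → (∀ y → f y ≤ c) → ∀ y → (f ⋆ g) y ≤ c * sum g
  ⋆-≤-bound {f} {g} {c} 0≤g f≤c y = begin
    ∑[ z < p ] (f z * g (y ⊖ z))  ≤⟨ sum-mono-≤ {p} (λ z → f z * g (y ⊖ z)) (λ z → c * g (y ⊖ z))
                                       (λ z → *-monoʳ-≤-nonNeg (g (y ⊖ z)) {{nonNegative (0≤g (y ⊖ z))}} (f≤c z)) ⟩
    ∑[ z < p ] (c * g (y ⊖ z))    ≡⟨ *-distribˡ-sum {p} c (λ z → g (y ⊖ z)) ⟨
    c * ∑[ z < p ] g (y ⊖ z)      ≡⟨ cong (c *_) (sum-⊖ g y) ⟨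
    c * sum g                     ∎
    where open ≤-Reasoning

  -- Norms, reflection and automorphisms in the group algebra

  ‖_‖² : F → ℚ
  ‖ f ‖² = ∑[ z < p ] (f z * f z)

  ‖‖²-cong : ∀ {f g} → f ≗ g → ‖ f ‖² ≡ ‖ g ‖²
  ‖‖²-cong f≗g = sum-cong-≗ {p} (λ z → cong₂ _*_ (f≗g z) (f≗g z))

  -- Cauchy–Schwarz weakened by AM–GM, which avoids square roots.
  ⋆-≤-norms : ∀ (f g : F) y → (f ⋆ g) y ≤ ½ * (‖ f ‖² + ‖ g ‖²)
  ⋆-≤-norms f g y = begin
    ∑[ z < p ] (f z * g (y ⊖ z))
      ≤⟨ sum-mono-≤ {p} (λ z → f z * g (y ⊖ z)) (λ z → ½ * (f z * f z + g (y ⊖ z) * g (y ⊖ z)))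
           (λ z → ab≤½[a²+b²] (f z) (g (y ⊖ z))) ⟩
    ∑[ z < p ] (½ * (f z * f z + g (y ⊖ z) * g (y ⊖ z)))
      ≡⟨ *-distribˡ-sum {p} ½ (λ z → f z * f z + g (y ⊖ z) * g (y ⊖ z)) ⟨
    ½ * ∑[ z < p ] (f z * f z + g (y ⊖ z) * g (y ⊖ z))
      ≡⟨ cong (½ *_) (∑-distrib-+ {p} (λ z → f z * f z) (λ z → g (y ⊖ z) * g (y ⊖ z))) ⟩
    ½ * (‖ f ‖² + ∑[ z < p ] (g (y ⊖ z) * g (y ⊖ z)))
      ≡⟨ cong (λ n → ½ * (‖ f ‖² + n)) (sum-⊖ (λ z → g z * g z) y) ⟨
    ½ * (‖ f ‖² + ‖ g ‖²) ∎
    where open ≤-Reasoning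

  -- `⋆-≤-norms` for `-f`. Separation distance asks for lower bounds on densities, so this sign is
  -- the one applied to centred laws.
  -⋆-≤-norms : ∀ (f g : F) y → - (f ⋆ g) y ≤ ½ * (‖ f ‖² + ‖ g ‖²)
  -⋆-≤-norms f g y = subst₂ _≤_ neg-⋆
    (cong (λ n → ½ * (n + ‖ g ‖²)) (sum-cong-≗ {p} (λ z → solve 1 (λ a → (:- a) :* (:- a) := a :* a) refl (f z))))
    (⋆-≤-norms (-_ ∘ f) g y)
    where
    open +-*-Solver
    open ≡-Reasoning
    neg-⋆ : ((-_ ∘ f) ⋆ g) y ≡ - (f ⋆ g) y
    neg-⋆ = begin
      ∑[ z < p ] (- f z * g (y ⊖ z))
        ≡⟨ sum-cong-≗ {p} (λ z → solve 2 (λ a b → (:- a) :* b := con (- 1ℚ) :* (a :* b)) refl (f z) (g (y ⊖ z))) ⟩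
      ∑[ z < p ] (- 1ℚ * (f z * g (y ⊖ z)))   ≡⟨ *-distribˡ-sum {p} (- 1ℚ) (λ z → f z * g (y ⊖ z)) ⟨
      - 1ℚ * (f ⋆ g) y                        ≡⟨ solve 1 (λ a → con (- 1ℚ) :* a := :- a) refl ((f ⋆ g) y) ⟩
      - (f ⋆ g) y                             ∎

  -- The law of `-X` if `f` is the law of `X`; on the Fourier side, complex conjugation of the
  -- coefficients.
  reflect : F → F
  reflect f z = f (z ⁻¹)

  -- Stands in for Parseval: a squared norm becomes a value at the identity, a form that is
  -- compatible with `⋆`.
  ‖‖²-reflect : ∀ (f : F) → (f ⋆ reflect f) ε ≡ ‖ f ‖²
  ‖‖²-reflect f = sum-cong-≗ {p} (λ z → cong (λ w → f z * f w)
    (trans (cong _⁻¹ (identityˡ (z ⁻¹))) (⁻¹-involutive z)))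

  reflect-reflect : ∀ f → reflect (reflect f) ≗ f
  reflect-reflect f z = cong f (⁻¹-involutive z)

  -- Corresponds to real Fourier coefficients, whose squares are the squares of their absolute
  -- values.
  Even : F → Set
  Even f = reflect f ≗ f

  ‖‖²-even : ∀ {f} → Even f → (f ⋆ f) ε ≡ ‖ f ‖²
  ‖‖²-even {f} even = trans (⋆-congˡ {f} (λ z → sym (even z)) ε) (‖‖²-reflect f)

  record Automorphism (φ φ⁻¹ : Fin p → Fin p) : Set where
    field
      homo    : ∀ x y → φ (x ∙ y) ≡ φ x ∙ φ y
      section : ∀ x → φ (φ⁻¹ x) ≡ x
      retract : ∀ x → φ⁻¹ (φ x) ≡ x

  module _ {φ φ⁻¹ : Fin p → Fin p} (A : Automorphism φ φ⁻¹) where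
    open Automorphism A

    auto-⊖ : ∀ x y → φ (x ⊖ y) ≡ φ x ⊖ φ y
    auto-⊖ x y = begin
      φ (x ⊖ y)                  ≡⟨ ∙-⊖ (φ (x ⊖ y)) (φ y) ⟨
      (φ (x ⊖ y) ∙ φ y) ⊖ φ y    ≡⟨ cong (_⊖ φ y) (homo (x ⊖ y) y) ⟨
      φ ((x ⊖ y) ∙ y) ⊖ φ y      ≡⟨ cong (λ z → φ z ⊖ φ y) (⊖-∙ x y) ⟩
      φ x ⊖ φ y                  ∎
      where open ≡-Reasoning

    auto-ε : φ ε ≡ ε
    auto-ε = trans (cong φ (sym (inverseʳ ε))) (trans (auto-⊖ ε ε) (inverseʳ (φ ε)))

    auto-⁻¹ : ∀ x → φ (x ⁻¹) ≡ φ x ⁻¹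
    auto-⁻¹ x = trans (cong φ (sym (identityˡ (x ⁻¹))))
      (trans (auto-⊖ ε x) (trans (cong (_⊖ φ x) auto-ε) (identityˡ (φ x ⁻¹))))

    sum-auto : ∀ (f : F) → sum f ≡ sum (f ∘ φ)
    sum-auto = sum-reindex φ φ⁻¹ section retract

    ⋆-auto : ∀ (f g : F) → (f ⋆ g) ∘ φ ≗ (f ∘ φ) ⋆ (g ∘ φ)
    ⋆-auto f g y = trans (sum-auto (λ z → f z * g (φ y ⊖ z)))
      (sum-cong-≗ {p} (λ z → cong (λ w → f (φ z) * g w) (sym (auto-⊖ y z))))

    ‖‖²-auto : ∀ (f : F) → ‖ f ∘ φ ‖² ≡ ‖ f ‖²
    ‖‖²-auto f = sym (sum-auto (λ z → f z * f z))

    reflect-auto : ∀ (f : F) → reflect (f ∘ φ) ≗ reflect f ∘ φ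
    reflect-auto f z = cong f (auto-⁻¹ z)

  -- Inversion is an automorphism because the group is abelian.
  ⋆-reflect : ∀ (f g : F) → reflect (f ⋆ g) ≗ reflect f ⋆ reflect g
  ⋆-reflect = ⋆-auto {_⁻¹} {_⁻¹} (record
    { homo    = λ x y → sym (⁻¹-∙-comm x y)
    ; section = ⁻¹-involutive
    ; retract = ⁻¹-involutive
    })

  module Centering (u : ℚ) (pu≡1 : ι p * u ≡ 1ℚ) where

    -- For `f` of mass 1 this removes the trivial Fourier coefficient and keeps the others, which is
    -- why it is compatible with convolution.
    center : F → F
    center f y = f y - u

    private
      sum-u : ∀ (c : ℚ) → ∑[ z < p ] (c * u) ≡ c
      sum-u c = begin
        ∑[ z < p ] (c * u)  ≡⟨ sum-const p (c * u) ⟩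
        ι p * (c * u)       ≡⟨ solve 3 (λ i c u → i :* (c :* u) := c :* (i :* u)) refl (ι p) c u ⟩
        c * (ι p * u)       ≡⟨ cong (c *_) pu≡1 ⟩
        c * 1ℚ              ≡⟨ *-identityʳ c ⟩
        c                   ∎
        where
        open ≡-Reasoning
        open +-*-Solver

      -- The terms containing `u` add up to `-u - u + p u² = -u`. Both `center-⋆` (with `g`
      -- reflected and translated) and `‖center‖²` (with `g = f`) are instances.
      sum-product : ∀ (f g : F) → sum f ≡ 1ℚ → sum g ≡ 1ℚ →
                    ∑[ z < p ] ((f z - u) * (g z - u)) ≡ ∑[ z < p ] (f z * g z) - u
      sum-product f g Σf≡1 Σg≡1 = begin
        ∑[ z < p ] ((f z - u) * (g z - u))
          ≡⟨ sum-cong-≗ {p} (λ z → solve 3 (λ f g u → (f :- u) :* (g :- u) := f :* g :+ (:- u :* f :+ (:- u :* g :+ u :* u))) refl (f z) (g z) u) ⟩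
        ∑[ z < p ] (f z * g z + (- u * f z + (- u * g z + u * u)))
          ≡⟨ ∑-distrib-+ {p} (λ z → f z * g z) (λ z → - u * f z + (- u * g z + u * u)) ⟩
        S + ∑[ z < p ] (- u * f z + (- u * g z + u * u))
          ≡⟨ cong (S +_) (∑-distrib-+ {p} (λ z → - u * f z) (λ z → - u * g z + u * u)) ⟩
        S + (∑[ z < p ] (- u * f z) + ∑[ z < p ] (- u * g z + u * u))
          ≡⟨ cong (λ a → S + (∑[ z < p ] (- u * f z) + a)) (∑-distrib-+ {p} (λ z → - u * g z) (λ z → u * u)) ⟩
        S + (∑[ z < p ] (- u * f z) + (∑[ z < p ] (- u * g z) + ∑[ z < p ] (u * u)))
          ≡⟨ cong₂ (λ a b → S + (a + b)) (mass f Σf≡1) (cong₂ _+_ (mass g Σg≡1) (sum-u u)) ⟩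
        S + (- u + (- u + u))
          ≡⟨ solve 2 (λ s u → s :+ (:- u :+ (:- u :+ u)) := s :- u) refl S u ⟩
        S - u ∎
        where
        open ≡-Reasoning
        open +-*-Solver
        S = ∑[ z < p ] (f z * g z)
        mass : ∀ (f : F) → sum f ≡ 1ℚ → ∑[ z < p ] (- u * f z) ≡ - u
        mass f Σf≡1 = trans (sym (*-distribˡ-sum {p} (- u) f)) (trans (cong (- u *_) Σf≡1) (*-identityʳ (- u)))

    center-⋆ : ∀ (f g : F) → sum f ≡ 1ℚ → sum g ≡ 1ℚ → center f ⋆ center g ≗ center (f ⋆ g)
    center-⋆ f g Σf≡1 Σg≡1 y = sum-product f (λ z → g (y ⊖ z)) Σf≡1 (trans (sym (sum-⊖ g y)) Σg≡1)

    ‖center‖² : ∀ (f : F) → sum f ≡ 1ℚ → ‖ center f ‖² ≡ ‖ f ‖² - u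
    ‖center‖² f Σf≡1 = sum-product f f Σf≡1 Σf≡1

-- The cyclic group ℤ/p

module Cyclic (p : ℕ) .{{_ : ℕ.NonZero p}} where

  ⟦_⟧ : ℕ → Fin p
  ⟦ n ⟧ = n mod p

  toℕ-⟦⟧ : ∀ n → toℕ ⟦ n ⟧ ≡ n % p
  toℕ-⟦⟧ n = toℕ-fromℕ< (m%n<n n p)

  ⟦⟧-cong : ∀ {m n} → m % p ≡ n % p → ⟦ m ⟧ ≡ ⟦ n ⟧
  ⟦⟧-cong {m} {n} eq = toℕ-injective (trans (toℕ-⟦⟧ m) (trans eq (sym (toℕ-⟦⟧ n))))

  ⟦toℕ⟧ : ∀ x → ⟦ toℕ x ⟧ ≡ x
  ⟦toℕ⟧ x = toℕ-injective (trans (toℕ-⟦⟧ (toℕ x)) (m<n⇒m%n≡m (toℕ<n x)))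

  infixl 6 _⊕_

  _⊕_ : Fin p → Fin p → Fin p
  x ⊕ y = ⟦ toℕ x ℕ.+ toℕ y ⟧

  scale : ℕ → Fin p → Fin p
  scale a x = ⟦ a ℕ.* toℕ x ⟧

  ⟦⟧-+ : ∀ m n → ⟦ m ⟧ ⊕ ⟦ n ⟧ ≡ ⟦ m ℕ.+ n ⟧
  ⟦⟧-+ m n = ⟦⟧-cong (trans (cong₂ (λ a b → (a ℕ.+ b) % p) (toℕ-⟦⟧ m) (toℕ-⟦⟧ n)) (sym (%-distribˡ-+ m n p)))

  scale-⟦⟧ : ∀ a n → scale a ⟦ n ⟧ ≡ ⟦ a ℕ.* n ⟧
  scale-⟦⟧ a n = ⟦⟧-cong (begin
    (a ℕ.* toℕ ⟦ n ⟧) % p               ≡⟨ cong (λ m → (a ℕ.* m) % p) (toℕ-⟦⟧ n) ⟩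
    (a ℕ.* (n % p)) % p                 ≡⟨ %-distribˡ-* a (n % p) p ⟩
    ((a % p) ℕ.* (n % p % p)) % p       ≡⟨ cong (λ m → ((a % p) ℕ.* m) % p) (m%n%n≡m%n n p) ⟩
    ((a % p) ℕ.* (n % p)) % p           ≡⟨ %-distribˡ-* a n p ⟨
    (a ℕ.* n) % p                       ∎)
    where open ≡-Reasoning

  ⟦n+kp⟧ : ∀ n k → ⟦ n ℕ.+ k ℕ.* p ⟧ ≡ ⟦ n ⟧
  ⟦n+kp⟧ n k = ⟦⟧-cong ([m+kn]%n≡m%n n k p)

  ⊕-comm : ∀ x y → x ⊕ y ≡ y ⊕ x
  ⊕-comm x y = cong ⟦_⟧ (ℕ.+-comm (toℕ x) (toℕ y))

  ⊕-assoc : ∀ x y z → (x ⊕ y) ⊕ z ≡ x ⊕ (y ⊕ z)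
  ⊕-assoc x y z = begin
    ⟦ a ℕ.+ b ⟧ ⊕ z          ≡⟨ cong (⟦ a ℕ.+ b ⟧ ⊕_) (⟦toℕ⟧ z) ⟨
    ⟦ a ℕ.+ b ⟧ ⊕ ⟦ c ⟧      ≡⟨ ⟦⟧-+ (a ℕ.+ b) c ⟩
    ⟦ a ℕ.+ b ℕ.+ c ⟧        ≡⟨ cong ⟦_⟧ (ℕ.+-assoc a b c) ⟩
    ⟦ a ℕ.+ (b ℕ.+ c) ⟧      ≡⟨ ⟦⟧-+ a (b ℕ.+ c) ⟨
    ⟦ a ⟧ ⊕ ⟦ b ℕ.+ c ⟧      ≡⟨ cong (_⊕ (y ⊕ z)) (⟦toℕ⟧ x) ⟩
    x ⊕ (y ⊕ z)              ∎
    where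
    open ≡-Reasoning
    a = toℕ x
    b = toℕ y
    c = toℕ z

  ⊕-identityˡ : ∀ x → ⟦ 0 ⟧ ⊕ x ≡ x
  ⊕-identityˡ x = trans (cong (⟦ 0 ⟧ ⊕_) (sym (⟦toℕ⟧ x))) (trans (⟦⟧-+ 0 (toℕ x)) (⟦toℕ⟧ x))

  negate : Fin p → Fin p
  negate x = ⟦ p ℕ.∸ toℕ x ⟧

  ⊕-inverseˡ : ∀ x → negate x ⊕ x ≡ ⟦ 0 ⟧
  ⊕-inverseˡ x = begin
    negate x ⊕ x                      ≡⟨ cong (negate x ⊕_) (⟦toℕ⟧ x) ⟨
    negate x ⊕ ⟦ toℕ x ⟧              ≡⟨ ⟦⟧-+ (p ℕ.∸ toℕ x) (toℕ x) ⟩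
    ⟦ p ℕ.∸ toℕ x ℕ.+ toℕ x ⟧         ≡⟨ cong ⟦_⟧ (ℕ.m∸n+n≡m (ℕ.<⇒≤ (toℕ<n x))) ⟩
    ⟦ p ⟧                             ≡⟨ cong ⟦_⟧ (ℕ.+-identityʳ p) ⟨
    ⟦ 0 ℕ.+ 1 ℕ.* p ⟧                 ≡⟨ ⟦n+kp⟧ 0 1 ⟩
    ⟦ 0 ⟧                             ∎
    where open ≡-Reasoning

  isAbelianGroup : IsAbelianGroup _≡_ _⊕_ ⟦ 0 ⟧ negate
  isAbelianGroup = record
    { isGroup = record
      { isMonoid = record
        { isSemigroup = record
          { isMagma = record { isEquivalence = isEquivalence ; ∙-cong = cong₂ _⊕_ }
          ; assoc   = ⊕-assoc
          }
        ; identity = ⊕-identityˡ , λ x → trans (⊕-comm x ⟦ 0 ⟧) (⊕-identityˡ x)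
        }
      ; inverse = ⊕-inverseˡ , λ x → trans (⊕-comm x (negate x)) (⊕-inverseˡ x)
      ; ⁻¹-cong = cong negate
      }
    ; comm = ⊕-comm
    }

  open GroupAlgebra isAbelianGroup public

  scale-⊕ : ∀ a x y → scale a (x ⊕ y) ≡ scale a x ⊕ scale a y
  scale-⊕ a x y = begin
    scale a (x ⊕ y)                          ≡⟨ scale-⟦⟧ a (toℕ x ℕ.+ toℕ y) ⟩
    ⟦ a ℕ.* (toℕ x ℕ.+ toℕ y) ⟧              ≡⟨ cong ⟦_⟧ (ℕ.*-distribˡ-+ a (toℕ x) (toℕ y)) ⟩
    ⟦ a ℕ.* toℕ x ℕ.+ a ℕ.* toℕ y ⟧          ≡⟨ ⟦⟧-+ (a ℕ.* toℕ x) (a ℕ.* toℕ y) ⟨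
    scale a x ⊕ scale a y                    ∎
    where open ≡-Reasoning

  scale-scale : ∀ a b x → scale a (scale b x) ≡ scale (a ℕ.* b) x
  scale-scale a b x = trans (scale-⟦⟧ a (b ℕ.* toℕ x)) (cong ⟦_⟧ (sym (ℕ.*-assoc a b (toℕ x))))

  scale-1 : ∀ x → scale 1 x ≡ x
  scale-1 x = trans (cong ⟦_⟧ (ℕ.*-identityˡ (toℕ x))) (⟦toℕ⟧ x)

  scale-0ᴳ : ∀ a → scale a ⟦ 0 ⟧ ≡ ⟦ 0 ⟧
  scale-0ᴳ a = trans (scale-⟦⟧ a 0) (cong ⟦_⟧ (ℕ.*-zeroʳ a))

  -- `h` is the inverse of 2 modulo `p`; oddness of `p` enters here and makes dilations by powers of
  -- 2 automorphisms.
  module Halving (h : ℕ) (2h≡1+p : 2 ℕ.* h ≡ 1 ℕ.+ p) where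

    scale-2*h : ∀ x → scale (2 ℕ.* h) x ≡ x
    scale-2*h x = begin
      ⟦ 2 ℕ.* h ℕ.* toℕ x ⟧           ≡⟨ cong (λ a → ⟦ a ℕ.* toℕ x ⟧) 2h≡1+p ⟩
      ⟦ toℕ x ℕ.+ p ℕ.* toℕ x ⟧       ≡⟨ cong (λ a → ⟦ toℕ x ℕ.+ a ⟧) (ℕ.*-comm p (toℕ x)) ⟩
      ⟦ toℕ x ℕ.+ toℕ x ℕ.* p ⟧       ≡⟨ ⟦n+kp⟧ (toℕ x) (toℕ x) ⟩
      ⟦ toℕ x ⟧                       ≡⟨ ⟦toℕ⟧ x ⟩
      x                               ∎
      where open ≡-Reasoning

    scale-2^n*h^n : ∀ n x → scale (2 ℕ.^ n ℕ.* h ℕ.^ n) x ≡ x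
    scale-2^n*h^n zero    x = scale-1 x
    scale-2^n*h^n (suc n) x = begin
      scale (2 ℕ.* 2 ℕ.^ n ℕ.* (h ℕ.* h ℕ.^ n)) x
        ≡⟨ cong (λ a → scale a x) (ℕ.[m*n]*[o*p]≡[m*o]*[n*p] 2 (2 ℕ.^ n) h (h ℕ.^ n)) ⟩
      scale (2 ℕ.* h ℕ.* (2 ℕ.^ n ℕ.* h ℕ.^ n)) x          ≡⟨ scale-scale (2 ℕ.* h) (2 ℕ.^ n ℕ.* h ℕ.^ n) x ⟨
      scale (2 ℕ.* h) (scale (2 ℕ.^ n ℕ.* h ℕ.^ n) x)      ≡⟨ scale-2*h _ ⟩
      scale (2 ℕ.^ n ℕ.* h ℕ.^ n) x                        ≡⟨ scale-2^n*h^n n x ⟩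
      x                                                    ∎
      where open ≡-Reasoning

    -- Oriented as division by `2^n`: composing a density with division is the push-forward of the
    -- law under multiplication.
    halving : ∀ n → Automorphism (scale (h ℕ.^ n)) (scale (2 ℕ.^ n))
    halving n = record
      { homo    = scale-⊕ (h ℕ.^ n)
      ; section = λ x → trans (scale-scale (h ℕ.^ n) (2 ℕ.^ n) x)
                    (trans (cong (λ a → scale a x) (ℕ.*-comm (h ℕ.^ n) (2 ℕ.^ n))) (scale-2^n*h^n n x))
      ; retract = λ x → trans (scale-scale (2 ℕ.^ n) (h ℕ.^ n) x) (scale-2^n*h^n n x)
      }

    -- D n f is the law of 2ⁿX if f is the law of X.
    D : ℕ → F → F
    D n f y = f (scale (h ℕ.^ n) y)

    D-+ : ∀ m n f → D m (D n f) ≗ D (m ℕ.+ n) f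
    D-+ m n f y = cong f (trans (scale-scale (h ℕ.^ n) (h ℕ.^ m) y)
      (cong (λ a → scale a y) (trans (ℕ.*-comm (h ℕ.^ n) (h ℕ.^ m)) (sym (ℕ.^-distribˡ-+-* h m n)))))

    D-⋆ : ∀ n f g → D n (f ⋆ g) ≗ D n f ⋆ D n g
    D-⋆ n = ⋆-auto (halving n)

    D-cong : ∀ n {f g} → f ≗ g → D n f ≗ D n g
    D-cong n f≗g y = f≗g (scale (h ℕ.^ n) y)

    sum-D : ∀ n f → sum (D n f) ≡ sum f
    sum-D n f = sym (sum-auto (halving n) f)

    D-δ : ∀ n x → D n (δ x) ≗ δ (scale (2 ℕ.^ n) x)
    D-δ n x y = begin
      δ x (scale (h ℕ.^ n) y)
        ≡⟨ cong (λ z → δ z (scale (h ℕ.^ n) y)) (Automorphism.section (halving n) x) ⟨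
      δ (scale (h ℕ.^ n) (scale (2 ℕ.^ n) x)) (scale (h ℕ.^ n) y)
        ≡⟨ δ-injective {φ = scale (h ℕ.^ n)} {scale (2 ℕ.^ n)} (Automorphism.retract (halving n)) (scale (2 ℕ.^ n) x) y ⟩
      δ (scale (2 ℕ.^ n) x) y                                              ∎
      where open ≡-Reasoning

    -- The law of X₀ + 2X₁ + … + 2ⁿ⁻¹Xₙ₋₁ for independent Xᵢ with law f.
    Γ : ℕ → F → F
    Γ zero    f = 1⋆
    Γ (suc n) f = Γ n f ⋆ D n f

    Γ-+ : ∀ m n f → Γ (m ℕ.+ n) f ≗ Γ m f ⋆ D m (Γ n f)
    Γ-+ m zero f = begin
      Γ (m ℕ.+ 0) f          ≡⟨ cong (λ k → Γ k f) (ℕ.+-identityʳ m) ⟩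
      Γ m f                  ≈⟨ ⋆-identityʳ (Γ m f) ⟨
      Γ m f ⋆ 1⋆
        ≈⟨ ⋆-congˡ {Γ m f} (λ y → trans (cong (λ z → δ z y) (sym (scale-0ᴳ (2 ℕ.^ m)))) (sym (D-δ m ⟦ 0 ⟧ y))) ⟩
      Γ m f ⋆ D m 1⋆         ∎
      where open ⋆-Reasoning
    Γ-+ m (suc n) f = begin
      Γ (m ℕ.+ suc n) f                    ≡⟨ cong (λ k → Γ k f) (ℕ.+-suc m n) ⟩
      Γ (m ℕ.+ n) f ⋆ D (m ℕ.+ n) f        ≈⟨ ⋆-cong (Γ-+ m n f) (λ y → sym (D-+ m n f y)) ⟩
      Γ m f ⋆ D m (Γ n f) ⋆ D m (D n f)    ≈⟨ ⋆-assoc (Γ m f) (D m (Γ n f)) (D m (D n f)) ⟩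
      Γ m f ⋆ (D m (Γ n f) ⋆ D m (D n f))  ≈⟨ ⋆-congˡ {Γ m f} (λ y → sym (D-⋆ m (Γ n f) (D n f) y)) ⟩
      Γ m f ⋆ D m (Γ n f ⋆ D n f)          ∎
      where open ⋆-Reasoning

    -- Two independent blocks added position by position form one block with step law `f ⋆ g`. Thus
    -- copies of a block can be regrouped into copies at each position.
    Γ-⋆ : ∀ n f g → Γ n (f ⋆ g) ≗ Γ n f ⋆ Γ n g
    Γ-⋆ zero    f g = λ y → sym (⋆-identityˡ 1⋆ y)
    Γ-⋆ (suc n) f g = begin
      Γ n (f ⋆ g) ⋆ D n (f ⋆ g)                ≈⟨ ⋆-cong (Γ-⋆ n f g) (D-⋆ n f g) ⟩
      (Γ n f ⋆ Γ n g) ⋆ (D n f ⋆ D n g)        ≈⟨ ⋆-interchange (Γ n f) (Γ n g) (D n f) (D n g) ⟩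
      (Γ n f ⋆ D n f) ⋆ (Γ n g ⋆ D n g)        ∎
      where open ⋆-Reasoning

    sum-Γ : ∀ n f → sum (Γ n f) ≡ sum f ^ n
    sum-Γ zero    f = sum-δ-1 ⟦ 0 ⟧
    sum-Γ (suc n) f = trans (sum-⋆ (Γ n f) (D n f))
      (trans (cong₂ _*_ (sum-Γ n f) (sum-D n f)) (*-comm (sum f ^ n) (sum f)))

    Γ-nonNeg : ∀ n {f} → NonNeg f → NonNeg (Γ n f)
    Γ-nonNeg zero    0≤f = δ-nonNeg ⟦ 0 ⟧
    Γ-nonNeg (suc n) 0≤f = ⋆-nonNeg (Γ-nonNeg n 0≤f) (0≤f ∘ scale (h ℕ.^ n))

    Γ-mono-≤ : ∀ n {f g} → NonNeg f → (∀ y → f y ≤ g y) → ∀ y → Γ n f y ≤ Γ n g y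
    Γ-mono-≤ zero    0≤f f≤g y = ≤-refl
    Γ-mono-≤ (suc n) 0≤f f≤g = ⋆-mono-≤ (Γ-nonNeg n 0≤f) (λ y → ≤-trans (0≤f (scale (h ℕ.^ n) y)) (f≤g (scale (h ℕ.^ n) y)))
      (Γ-mono-≤ n 0≤f f≤g) (f≤g ∘ scale (h ℕ.^ n))

    -- The `2^s`-fold convolution power. Squaring the argument rather than the result matches the
    -- induction in `hölder`, which passes from `f` to `f ⋆ f`.
    square : ℕ → F → F
    square zero    f = f
    square (suc s) f = square s (f ⋆ f)

    square-cong : ∀ s {f g} → f ≗ g → square s f ≗ square s g
    square-cong zero    f≗g = f≗g
    square-cong (suc s) f≗g = square-cong s (⋆-cong f≗g f≗g)

    square-⋆ : ∀ s f g → square s (f ⋆ g) ≗ square s f ⋆ square s g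
    square-⋆ zero    f g = λ _ → refl
    square-⋆ (suc s) f g = begin
      square s ((f ⋆ g) ⋆ (f ⋆ g))              ≈⟨ square-cong s (⋆-interchange f g f g) ⟩
      square s ((f ⋆ f) ⋆ (g ⋆ g))              ≈⟨ square-⋆ s (f ⋆ f) (g ⋆ g) ⟩
      square s (f ⋆ f) ⋆ square s (g ⋆ g)       ∎
      where open ⋆-Reasoning

    square-reflect : ∀ s f → reflect (square s f) ≗ square s (reflect f)
    square-reflect zero    f = λ _ → refl
    square-reflect (suc s) f = λ y → trans (square-reflect s (f ⋆ f) y) (square-cong s (⋆-reflect f f) y)

    sum-square : ∀ s f → sum f ≡ 1ℚ → sum (square s f) ≡ 1ℚ
    sum-square zero    f Σf≡1 = Σf≡1
    sum-square (suc s) f Σf≡1 = sum-square s (f ⋆ f) (trans (sum-⋆ f f) (cong₂ _*_ Σf≡1 Σf≡1))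

    square-nonNeg : ∀ s {f} → NonNeg f → NonNeg (square s f)
    square-nonNeg zero    0≤f = 0≤f
    square-nonNeg (suc s) 0≤f = square-nonNeg s (⋆-nonNeg 0≤f 0≤f)

    square-Γ : ∀ s t f → square s (Γ t f) ≗ Γ t (square s f)
    square-Γ zero    t f = λ _ → refl
    square-Γ (suc s) t f = λ y → trans (square-cong s (λ z → sym (Γ-⋆ t f f z)) y) (square-Γ s t (f ⋆ f) y)

    -- B s f is the product of the 2ˢ dilations D (i t) f, i < 2ˢ.
    module Blocks (t : ℕ) where

      B : ℕ → F → F
      B zero    f = f
      B (suc s) f = B s f ⋆ D (t ℕ.* 2 ℕ.^ s) (B s f)

      B-cong : ∀ s {f g} → f ≗ g → B s f ≗ B s g
      B-cong zero    f≗g = f≗g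
      B-cong (suc s) f≗g = ⋆-cong (B-cong s f≗g) (D-cong (t ℕ.* 2 ℕ.^ s) (B-cong s f≗g))

      B-Γ : ∀ s f → B s (Γ t f) ≗ Γ (t ℕ.* 2 ℕ.^ s) f
      B-Γ zero    f y = cong (λ n → Γ n f y) (sym (ℕ.*-identityʳ t))
      B-Γ (suc s) f = begin
        B s (Γ t f) ⋆ D n (B s (Γ t f))  ≈⟨ ⋆-cong (B-Γ s f) (D-cong n (B-Γ s f)) ⟩
        Γ n f ⋆ D n (Γ n f)              ≈⟨ Γ-+ n n f ⟨
        Γ (n ℕ.+ n) f                    ≡⟨ cong (λ k → Γ k f) (trans (sym (ℕ.*-distribˡ-+ t (2 ℕ.^ s) (2 ℕ.^ s)))
                                              (cong (λ k → t ℕ.* (2 ℕ.^ s ℕ.+ k)) (sym (ℕ.+-identityʳ (2 ℕ.^ s))))) ⟩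
        Γ (t ℕ.* 2 ℕ.^ suc s) f          ∎
        where
        open ⋆-Reasoning
        n = t ℕ.* 2 ℕ.^ s

      B-⋆ : ∀ s f g → B s (f ⋆ g) ≗ B s f ⋆ B s g
      B-⋆ zero    f g = λ _ → refl
      B-⋆ (suc s) f g = begin
        B s (f ⋆ g) ⋆ D n (B s (f ⋆ g))                    ≈⟨ ⋆-cong (B-⋆ s f g) (D-cong n (B-⋆ s f g)) ⟩
        (B s f ⋆ B s g) ⋆ D n (B s f ⋆ B s g)              ≈⟨ ⋆-congˡ {B s f ⋆ B s g} (D-⋆ n (B s f) (B s g)) ⟩
        (B s f ⋆ B s g) ⋆ (D n (B s f) ⋆ D n (B s g))      ≈⟨ ⋆-interchange (B s f) (B s g) (D n (B s f)) (D n (B s g)) ⟩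
        (B s f ⋆ D n (B s f)) ⋆ (B s g ⋆ D n (B s g))      ∎
        where
        open ⋆-Reasoning
        n = t ℕ.* 2 ℕ.^ s

      B-reflect : ∀ s f → reflect (B s f) ≗ B s (reflect f)
      B-reflect zero    f = λ _ → refl
      B-reflect (suc s) f = begin
        reflect (B s f ⋆ D n (B s f))                 ≈⟨ ⋆-reflect (B s f) (D n (B s f)) ⟩
        reflect (B s f) ⋆ reflect (D n (B s f))
          ≈⟨ ⋆-cong (B-reflect s f) (λ y → trans (reflect-auto (halving n) (B s f) y) (D-cong n (B-reflect s f) y)) ⟩
        B s (reflect f) ⋆ D n (B s (reflect f))       ∎
        where
        open ⋆-Reasoning
        n = t ℕ.* 2 ℕ.^ s

      sum-B : ∀ s f → sum f ≡ 1ℚ → sum (B s f) ≡ 1ℚ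
      sum-B zero    f Σf≡1 = Σf≡1
      sum-B (suc s) f Σf≡1 = trans (sum-⋆ (B s f) (D (t ℕ.* 2 ℕ.^ s) (B s f)))
        (cong₂ _*_ (sum-B s f Σf≡1) (trans (sum-D (t ℕ.* 2 ℕ.^ s) (B s f)) (sum-B s f Σf≡1)))

      ½[x+x]≡x : ∀ x → ½ * (x + x) ≡ x
      ½[x+x]≡x = solve 1 (λ x → con ½ :* (x :+ x) := x) refl
        where open +-*-Solver

      -- In terms of Fourier coefficients this is Hölder's inequality ∑ ∏ f̂(2^{it} ℓ) ≤ ∑ f̂(ℓ)^{2ˢ},
      -- whose two ends are p times the values at 0.
      hölder : ∀ s {f} → Even f → B s f ⟦ 0 ⟧ ≤ square s f ⟦ 0 ⟧
      hölder zero    even = ≤-refl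
      hölder (suc s) {f} even = begin
        (b ⋆ D n b) ⟦ 0 ⟧                 ≤⟨ ⋆-≤-norms b (D n b) ⟦ 0 ⟧ ⟩
        -- Dilation preserves the norm, so the two halves, different as functions, contribute
        -- equally.
        ½ * (‖ b ‖² + ‖ D n b ‖²)         ≡⟨ cong (λ x → ½ * (‖ b ‖² + x)) (‖‖²-auto (halving n) b) ⟩
        ½ * (‖ b ‖² + ‖ b ‖²)             ≡⟨ ½[x+x]≡x ‖ b ‖² ⟩
        -- The norm is again a value at 0, now of `B s` at the even function `f ⋆ f`, to which the
        -- induction hypothesis applies.
        ‖ b ‖²                            ≡⟨ ‖‖²-even (λ y → trans (B-reflect s f y) (B-cong s even y)) ⟨
        (b ⋆ b) ⟦ 0 ⟧                     ≡⟨ B-⋆ s f f ⟦ 0 ⟧ ⟨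
        B s (f ⋆ f) ⟦ 0 ⟧                 ≤⟨ hölder s (λ y → trans (⋆-reflect f f y) (⋆-cong even even y)) ⟩
        square s (f ⋆ f) ⟦ 0 ⟧            ∎
        where
        open ≤-Reasoning
        n = t ℕ.* 2 ℕ.^ s
        b = B s f

      -- `hölder` asks for an even function, and `f ⋆ reflect f` is one. Since `B` and `square`
      -- respect `⋆` and `reflect`, both sides of `hölder` at this function are squared norms.
      ‖B‖²≤‖square‖² : ∀ s f → ‖ B s f ‖² ≤ ‖ square s f ‖²
      ‖B‖²≤‖square‖² s f = begin
        ‖ B s f ‖²                                  ≡⟨ ‖‖²-reflect (B s f) ⟨
        (B s f ⋆ reflect (B s f)) ⟦ 0 ⟧             ≡⟨ ⋆-congˡ {B s f} (B-reflect s f) ⟦ 0 ⟧ ⟩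
        (B s f ⋆ B s (reflect f)) ⟦ 0 ⟧             ≡⟨ B-⋆ s f (reflect f) ⟦ 0 ⟧ ⟨
        B s (f ⋆ reflect f) ⟦ 0 ⟧                   ≤⟨ hölder s even ⟩
        square s (f ⋆ reflect f) ⟦ 0 ⟧              ≡⟨ square-⋆ s f (reflect f) ⟦ 0 ⟧ ⟩
        (square s f ⋆ square s (reflect f)) ⟦ 0 ⟧   ≡⟨ ⋆-congˡ {square s f} (square-reflect s f) ⟦ 0 ⟧ ⟨
        (square s f ⋆ reflect (square s f)) ⟦ 0 ⟧   ≡⟨ ‖‖²-reflect (square s f) ⟩
        ‖ square s f ‖²                             ∎
        where
        open ≤-Reasoning
        even : Even (f ⋆ reflect f)
        even y = trans (⋆-reflect f (reflect f) y)
          (trans (⋆-congˡ {reflect f} (reflect-reflect f) y) (⋆-comm (reflect f) f y))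

      -- The last doubling of the number of blocks is spent on passing from a norm to the value at
      -- an arbitrary `y`, hence `suc s` against `s`.
      -B≤‖square‖² : ∀ s f y → - B (suc s) f y ≤ ‖ square s f ‖²
      -B≤‖square‖² s f y = begin
        - (B s f ⋆ D n (B s f)) y                 ≤⟨ -⋆-≤-norms (B s f) (D n (B s f)) y ⟩
        ½ * (‖ B s f ‖² + ‖ D n (B s f) ‖²)       ≡⟨ cong (λ x → ½ * (‖ B s f ‖² + x)) (‖‖²-auto (halving n) (B s f)) ⟩
        ½ * (‖ B s f ‖² + ‖ B s f ‖²)             ≡⟨ ½[x+x]≡x ‖ B s f ‖² ⟩
        ‖ B s f ‖²                                ≤⟨ ‖B‖²≤‖square‖² s f ⟩
        ‖ square s f ‖²                           ∎
        where
        open ≤-Reasoning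
        n = t ℕ.* 2 ℕ.^ s

    -- Distance from the uniform law through centred blocks

    module Mixing (u : ℚ) (pu≡1 : ι p * u ≡ 1ℚ) where
      open Centering u pu≡1

      square-center : ∀ s f → sum f ≡ 1ℚ → square s (center f) ≗ center (square s f)
      square-center zero    f Σf≡1 = λ _ → refl
      square-center (suc s) f Σf≡1 = λ y → trans (square-cong s (center-⋆ f f Σf≡1 Σf≡1) y)
        (square-center s (f ⋆ f) (trans (sum-⋆ f f) (cong₂ _*_ Σf≡1 Σf≡1)) y)

      module _ (t : ℕ) where
        open Blocks t

        B-center : ∀ s f → sum f ≡ 1ℚ → B s (center f) ≗ center (B s f)
        B-center zero    f Σf≡1 = λ _ → refl
        B-center (suc s) f Σf≡1 = begin
          B s (center f) ⋆ D n (B s (center f))     ≈⟨ ⋆-cong (B-center s f Σf≡1) (D-cong n (B-center s f Σf≡1)) ⟩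
          center (B s f) ⋆ center (D n (B s f))
            ≈⟨ center-⋆ (B s f) (D n (B s f)) (sum-B s f Σf≡1) (trans (sum-D n (B s f)) (sum-B s f Σf≡1)) ⟩
          center (B s f ⋆ D n (B s f))              ∎
          where
          open ⋆-Reasoning
          n = t ℕ.* 2 ℕ.^ s

        -- The right-hand side is the squared L²-distance to u of the sum of 2ˢ independent copies
        -- of the same block of t steps.
        u-Γ≤ : ∀ s f y → sum f ≡ 1ℚ → u - Γ (t ℕ.* 2 ℕ.^ suc s) f y ≤ ‖ Γ t (square s f) ‖² - u
        u-Γ≤ s f y Σf≡1 = begin
          u - Γ (t ℕ.* 2 ℕ.^ suc s) f y          ≡⟨ cong (λ x → u - x) (B-Γ (suc s) f y) ⟨
          u - B (suc s) (Γ t f) y                ≡⟨ solve 2 (λ u x → u :- x := :- (x :- u)) refl u (B (suc s) (Γ t f) y) ⟩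
          - center (B (suc s) (Γ t f)) y         ≡⟨ cong -_ (B-center (suc s) (Γ t f) ΣΓ≡1 y) ⟨
          - B (suc s) (center (Γ t f)) y         ≤⟨ -B≤‖square‖² s (center (Γ t f)) y ⟩
          ‖ square s (center (Γ t f)) ‖²         ≡⟨ ‖‖²-cong (square-center s (Γ t f) ΣΓ≡1) ⟩
          ‖ center (square s (Γ t f)) ‖²         ≡⟨ ‖center‖² (square s (Γ t f)) (sum-square s (Γ t f) ΣΓ≡1) ⟩
          ‖ square s (Γ t f) ‖² - u              ≡⟨ cong (_- u) (‖‖²-cong (square-Γ s t f)) ⟩
          ‖ Γ t (square s f) ‖² - u              ∎
          where
          open ≤-Reasoning
          open +-*-Solver
          ΣΓ≡1 : sum (Γ t f) ≡ 1ℚ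
          ΣΓ≡1 = trans (sum-Γ t f) (trans (cong (_^ t) Σf≡1) (1^n≡1 t))

-- Partial sums and numerical estimates for the density of a block

partialSum-+ : ∀ a m n → partialSum a (m ℕ.+ n) ≡ partialSum a m + partialSum (a ∘ (m ℕ.+_)) n
partialSum-+ a zero    n = sym (+-identityˡ (partialSum a n))
partialSum-+ a (suc m) n = trans (cong (a 0 +_) (partialSum-+ (a ∘ suc) m n))
  (sym (+-assoc (a 0) (partialSum (a ∘ suc) m) (partialSum (a ∘ (suc m ℕ.+_)) n)))

partialSum-nonNeg : ∀ {a} n → (∀ i → 0ℚ ≤ a i) → 0ℚ ≤ partialSum a n
partialSum-nonNeg {a} n 0≤a = sum-nonNeg {n} (a ∘ toℕ) (0≤a ∘ toℕ)

partialSum-≤-+ : ∀ {a} m n → (∀ i → 0ℚ ≤ a i) → partialSum a m ≤ partialSum a (m ℕ.+ n)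
partialSum-≤-+ {a} m n 0≤a = begin
  partialSum a m                                        ≡⟨ +-identityʳ (partialSum a m) ⟨
  partialSum a m + 0ℚ
    ≤⟨ +-monoʳ-≤ (partialSum a m) (partialSum-nonNeg n (0≤a ∘ (m ℕ.+_))) ⟩
  partialSum a m + partialSum (a ∘ (m ℕ.+_)) n          ≡⟨ partialSum-+ a m n ⟨
  partialSum a (m ℕ.+ n)                                ∎
  where open ≤-Reasoning

δ-sym : ∀ {n} (x y : Fin n) → δ x y ≡ δ y x
δ-sym zero    zero    = refl
δ-sym zero    (suc y) = refl
δ-sym (suc x) zero    = refl
δ-sym (suc x) (suc y) = δ-sym x y

-- By `q^(2^s) ≤ q^(3a) ≤ 2^(-a) ≤ 1/(8t)`: among `t` positions, the expected number without a
-- uniform bit is at most 1/8.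
q^[2^s]-small : ∀ {q t a s} → 0ℚ ≤ q → q ^ 3 ≤ ½ → 8 ℕ.* t ℕ.≤ 2 ℕ.^ a → 3 ℕ.* a ℕ.≤ 2 ℕ.^ s →
                ι 8 * (ι t * q ^ (2 ℕ.^ s)) ≤ 1ℚ
q^[2^s]-small {q} {t} {a} {s} 0≤q q³≤½ 8t≤2^a 3a≤2^s = begin
  ι 8 * (ι t * q ^ (2 ℕ.^ s))  ≡⟨ *-assoc (ι 8) (ι t) (q ^ (2 ℕ.^ s)) ⟨
  ι 8 * ι t * q ^ (2 ℕ.^ s)    ≡⟨ cong (_* q ^ (2 ℕ.^ s)) (ι-* 8 t) ⟨
  ι (8 ℕ.* t) * q ^ (2 ℕ.^ s)  ≤⟨ *-mono (0≤ι (8 ℕ.* t)) (^-nonNeg a (nonNegative⁻¹ ½)) (ι-mono-≤ 8t≤2^a) q^≤ ⟩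
  ι (2 ℕ.^ a) * ½ ^ a         ≡⟨ cong (_* ½ ^ a) (ι-^ 2 a) ⟩
  ι 2 ^ a * ½ ^ a             ≡⟨ ^-distribʳ-* (ι 2) ½ a ⟨
  1ℚ ^ a                      ≡⟨ 1^n≡1 a ⟩
  1ℚ                          ∎
  where
  open ≤-Reasoning
  q≤1 : q ≤ 1ℚ
  q≤1 with ≤-total q 1ℚ
  ... | inj₁ q≤1 = q≤1
  ... | inj₂ 1≤q = contradiction (≤-trans (subst (_≤ q ^ 3) (1^n≡1 3) (^-mono-≤ 3 (nonNegative⁻¹ 1ℚ) 1≤q)) q³≤½) 1≰½
    where
    1≰½ : ¬ (1ℚ ≤ ½)
    1≰½ 1≤½ with ≤⇒≤ᵇ 1≤½
    ... | ()
  q^≤ : q ^ (2 ℕ.^ s) ≤ ½ ^ a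
  q^≤ = begin
    q ^ (2 ℕ.^ s)   ≤⟨ ^-anti-≤ 0≤q q≤1 3a≤2^s ⟩
    q ^ (3 ℕ.* a)   ≡⟨ ^-assocʳ q 3 a ⟨
    (q ^ 3) ^ a     ≤⟨ ^-mono-≤ a (^-nonNeg 3 0≤q) q³≤½ ⟩
    ½ ^ a           ∎

-- The left side is `(1 + p/2^t) (1 + q)^t`. The first factor is at most 5/4; the second is at most
-- 8/7 by Bernoulli, since `1 - tq ≥ 7/8`. Their product 10/7 lies below 3/2.
[1+p/2^t][1+q]^t≤3/2 : ∀ p t q → 0ℚ ≤ q → 4 ℕ.* p ℕ.≤ 2 ℕ.^ t → ι 8 * (ι t * q) ≤ 1ℚ →
                       ι (2 ℕ.^ t ℕ.+ p) * (½ * (1ℚ + q)) ^ t ≤ ℤ.+ 3 / 2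
[1+p/2^t][1+q]^t≤3/2 p t q 0≤q 4p≤2^t 8tq≤1 = begin
  ι (2 ℕ.^ t ℕ.+ p) * (½ * (1ℚ + q)) ^ t
    ≡⟨ cong₂ _*_ (ι-+ (2 ℕ.^ t) p) (^-distribʳ-* ½ (1ℚ + q) t) ⟩
  (ι (2 ℕ.^ t) + ι p) * (½ ^ t * (1ℚ + q) ^ t)
    ≤⟨ *-mono (+-nonNeg (0≤ι (2 ℕ.^ t)) (0≤ι p)) (*-nonNeg (^-nonNeg t (nonNegative⁻¹ ½)) (nonNegative⁻¹ (ℤ.+ 8 / 7)))
         (+-monoʳ-≤ (ι (2 ℕ.^ t)) p≤2^t/4) (*-monoʳ (^-nonNeg t (nonNegative⁻¹ ½)) [1+q]^t≤8/7) ⟩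
  (ι (2 ℕ.^ t) + ℤ.+ 1 / 4 * ι (2 ℕ.^ t)) * (½ ^ t * (ℤ.+ 8 / 7))
    ≡⟨ solve 2 (λ a b → (a :+ con (ℤ.+ 1 / 4) :* a) :* (b :* con (ℤ.+ 8 / 7)) := a :* b :* con (ℤ.+ 10 / 7)) refl (ι (2 ℕ.^ t)) (½ ^ t) ⟩
  ι (2 ℕ.^ t) * ½ ^ t * (ℤ.+ 10 / 7)
    ≡⟨ cong (_* (ℤ.+ 10 / 7)) (trans (cong (_* ½ ^ t) (ι-^ 2 t)) (trans (sym (^-distribʳ-* (ι 2) ½ t)) (1^n≡1 t))) ⟩
  1ℚ * (ℤ.+ 10 / 7)
    ≤⟨ ≤ᵇ⇒≤ _ ⟩
  ℤ.+ 3 / 2 ∎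
  where
  open ≤-Reasoning
  open +-*-Solver
  p≤2^t/4 : ι p ≤ ℤ.+ 1 / 4 * ι (2 ℕ.^ t)
  p≤2^t/4 = begin
    ι p                          ≡⟨ solve 1 (λ x → x := con (ℤ.+ 1 / 4) :* (con (ι 4) :* x)) refl (ι p) ⟩
    ℤ.+ 1 / 4 * (ι 4 * ι p)      ≡⟨ cong (ℤ.+ 1 / 4 *_) (ι-* 4 p) ⟨
    ℤ.+ 1 / 4 * ι (4 ℕ.* p)      ≤⟨ *-monoʳ (nonNegative⁻¹ (ℤ.+ 1 / 4)) (ι-mono-≤ 4p≤2^t) ⟩
    ℤ.+ 1 / 4 * ι (2 ℕ.^ t)      ∎
  [1+q]^t≤8/7 : (1ℚ + q) ^ t ≤ ℤ.+ 8 / 7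
  [1+q]^t≤8/7 = begin
    (1ℚ + q) ^ t
      ≡⟨ solve 1 (λ x → x := con (ℤ.+ 8 / 7) :* (x :* (con 1ℚ :- con (ℤ.+ 1 / 8)))) refl ((1ℚ + q) ^ t) ⟩
    ℤ.+ 8 / 7 * ((1ℚ + q) ^ t * (1ℚ - ℤ.+ 1 / 8))
      ≤⟨ *-monoʳ (nonNegative⁻¹ (ℤ.+ 8 / 7)) (*-monoʳ (^-nonNeg t (+-nonNeg (nonNegative⁻¹ 1ℚ) 0≤q))
           (+-monoʳ-≤ 1ℚ (neg-antimono-≤ tq≤1/8))) ⟩
    ℤ.+ 8 / 7 * ((1ℚ + q) ^ t * (1ℚ - ι t * q))
      ≤⟨ *-monoʳ (nonNegative⁻¹ (ℤ.+ 8 / 7)) (bernoulli q t 0≤q) ⟩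
    ℤ.+ 8 / 7 * 1ℚ
      ≡⟨⟩
    ℤ.+ 8 / 7 ∎
    where
    tq≤1/8 : ι t * q ≤ ℤ.+ 1 / 8
    tq≤1/8 = begin
      ι t * q                        ≡⟨ solve 1 (λ x → x := con (ℤ.+ 1 / 8) :* (con (ι 8) :* x)) refl (ι t * q) ⟩
      ℤ.+ 1 / 8 * (ι 8 * (ι t * q))  ≤⟨ *-monoʳ (nonNegative⁻¹ (ℤ.+ 1 / 8)) 8tq≤1 ⟩
      ℤ.+ 1 / 8 * 1ℚ                 ≡⟨⟩
      ℤ.+ 1 / 8                      ∎

-- Smoothing by uniform bits

module Smoothing (p : ℕ) .{{_ : ℕ.NonZero p}} (h : ℕ) (2h≡1+p : 2 ℕ.* h ≡ 1 ℕ.+ p)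
                 (u : ℚ) (pu≡1 : ι p * u ≡ 1ℚ) where
  open Cyclic p
  open Halving h 2h≡1+p

  δ-⊕ : ∀ x a y → δ (x ⊕ a) y ≡ δ x (y ⊖ a)
  δ-⊕ x a y = trans (cong (δ (x ⊕ a)) (sym (⊖-∙ y a)))
    (δ-injective {φ = _⊕ a} {_⊖ a} (λ z → ∙-⊖ z a) x (y ⊖ a))

  ⋆-δ : ∀ f a y → (f ⋆ δ a) y ≡ f (y ⊖ a)
  ⋆-δ f a y = trans (⋆-comm f (δ a) y) (sum-δ a (λ z → f (y ⊖ z)))

  -- The number of `j < n` with `2j ≡ y` modulo `p`, that is, `n` times the law of `2j` for uniform
  -- `j`.
  count : ℕ → F
  count n y = partialSum (λ j → δ ⟦ 2 ℕ.* j ⟧ y) n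

  count-+ : ∀ m n y → count (m ℕ.+ n) y ≡ count m y + count n (y ⊖ ⟦ 2 ℕ.* m ⟧)
  count-+ m n y = trans (partialSum-+ (λ j → δ ⟦ 2 ℕ.* j ⟧ y) m n)
    (cong (count m y +_) (sum-cong-≗ {n} (λ i → begin
      δ ⟦ 2 ℕ.* (m ℕ.+ toℕ i) ⟧ y
        ≡⟨ cong (λ k → δ ⟦ k ⟧ y) (trans (ℕ.*-distribˡ-+ 2 m (toℕ i)) (ℕ.+-comm (2 ℕ.* m) (2 ℕ.* toℕ i))) ⟩
      δ ⟦ 2 ℕ.* toℕ i ℕ.+ 2 ℕ.* m ⟧ y           ≡⟨ cong (λ z → δ z y) (⟦⟧-+ (2 ℕ.* toℕ i) (2 ℕ.* m)) ⟨
      δ (⟦ 2 ℕ.* toℕ i ⟧ ⊕ ⟦ 2 ℕ.* m ⟧) y       ≡⟨ δ-⊕ ⟦ 2 ℕ.* toℕ i ⟧ ⟦ 2 ℕ.* m ⟧ y ⟩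
      δ ⟦ 2 ℕ.* toℕ i ⟧ (y ⊖ ⟦ 2 ℕ.* m ⟧)      ∎)))
    where open ≡-Reasoning

  -- Doubling permutes the residues, so each is hit exactly once in a period.
  count-p : ∀ y → count p y ≡ 1ℚ
  count-p y = begin
    ∑[ j < p ] δ (scale 2 j) y                      ≡⟨ sum-auto (halving 1) (λ j → δ (scale 2 j) y) ⟩
    ∑[ j < p ] δ (scale 2 (scale (h ℕ.^ 1) j)) y
      ≡⟨ sum-cong-≗ {p} (λ j → cong (λ z → δ z y) (Automorphism.retract (halving 1) j)) ⟩
    ∑[ j < p ] δ j y                                ≡⟨ sum-cong-≗ {p} (λ j → δ-sym j y) ⟩
    ∑[ j < p ] δ y j                                ≡⟨ sum-δ-1 y ⟩
    1ℚ                                              ∎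
    where open ≡-Reasoning

  count-* : ∀ k y → count (k ℕ.* p) y ≡ ι k
  count-* zero    y = refl
  count-* (suc k) y = trans (count-+ p (k ℕ.* p) y)
    (trans (cong₂ _+_ (count-p y) (count-* k (y ⊖ ⟦ 2 ℕ.* p ⟧))) (sym (ι-+ 1 k)))

  0≤u : 0ℚ ≤ u
  0≤u with ≤-total 0ℚ u
  ... | inj₁ 0≤u = 0≤u
  ... | inj₂ u≤0 = contradiction (subst₂ _≤_ pu≡1 (*-zeroʳ (ι p)) (*-monoʳ (0≤ι p) u≤0)) λ 1≤0 → case ≤⇒≤ᵇ 1≤0 of λ ()

  -- Enlarge `n` to a multiple of `p` that is at most `n + p`; there the count is the same for every
  -- `y`.
  count-≤ : ∀ n y → count n y ≤ ι (n ℕ.+ p) * u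
  count-≤ n y = begin
    count n y                                 ≤⟨ partialSum-≤-+ n (k ℕ.* p ℕ.∸ n) (λ j → δ-nonNeg ⟦ 2 ℕ.* j ⟧ y) ⟩
    count (n ℕ.+ (k ℕ.* p ℕ.∸ n)) y           ≡⟨ cong (λ m → count m y) (ℕ.m+[n∸m]≡n n≤kp) ⟩
    count (k ℕ.* p) y                         ≡⟨ count-* k y ⟩
    ι k
      ≡⟨ trans (sym (*-identityʳ (ι k))) (trans (cong (ι k *_) (sym pu≡1)) (sym (*-assoc (ι k) (ι p) u))) ⟩
    ι k * ι p * u                             ≡⟨ cong (_* u) (ι-* k p) ⟨
    ι (k ℕ.* p) * u                           ≤⟨ *-monoʳ-≤-nonNeg u {{nonNegative 0≤u}} (ι-mono-≤ kp≤n+p) ⟩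
    ι (n ℕ.+ p) * u                           ∎
    where
    open ≤-Reasoning
    k = suc (n ℕ./ p)
    n≤kp : n ℕ.≤ k ℕ.* p
    n≤kp = subst (ℕ._≤ k ℕ.* p) (sym (m≡m%n+[m/n]*n n p)) (ℕ.+-monoˡ-≤ (n ℕ./ p ℕ.* p) (m%n≤n n p))
    kp≤n+p : k ℕ.* p ℕ.≤ n ℕ.+ p
    kp≤n+p = subst (k ℕ.* p ℕ.≤_) (ℕ.+-comm p n) (ℕ.+-monoʳ-≤ p (m/n*n≤m n p))

  -- Twice the law of 2b for a uniform bit b.
  η : F
  η = δ ⟦ 0 ⟧ ⊞ δ ⟦ 2 ⟧

  η-nonNeg : NonNeg η
  η-nonNeg y = +-nonNeg (δ-nonNeg ⟦ 0 ⟧ y) (δ-nonNeg ⟦ 2 ⟧ y)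

  sum-η : sum η ≡ 1ℚ + 1ℚ
  sum-η = trans (∑-distrib-+ {p} (δ ⟦ 0 ⟧) (δ ⟦ 2 ⟧)) (cong₂ _+_ (sum-δ-1 ⟦ 0 ⟧) (sum-δ-1 ⟦ 2 ⟧))

  -- Binary expansion: digits at the positions below `t` produce every `j < 2^t` exactly once, and
  -- `η` carries each digit doubled.
  Γ-η : ∀ t → Γ t η ≗ count (2 ℕ.^ t)
  Γ-η zero    y = sym (+-identityʳ (δ ⟦ 0 ⟧ y))
  Γ-η (suc t) y = begin
    (Γ t η ⋆ D t η) y
      ≡⟨ ⋆-cong (Γ-η t) (λ z → cong₂ _+_ (D-δ t ⟦ 0 ⟧ z) (D-δ t ⟦ 2 ⟧ z)) y ⟩
    (count n ⋆ (δ (scale n ⟦ 0 ⟧) ⊞ δ (scale n ⟦ 2 ⟧))) y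
      ≡⟨ ⋆-distribˡ-⊞ (count n) (δ (scale n ⟦ 0 ⟧)) (δ (scale n ⟦ 2 ⟧)) y ⟩
    (count n ⋆ δ (scale n ⟦ 0 ⟧)) y + (count n ⋆ δ (scale n ⟦ 2 ⟧)) y
      ≡⟨ cong₂ _+_ (⋆-δ (count n) (scale n ⟦ 0 ⟧) y) (⋆-δ (count n) (scale n ⟦ 2 ⟧) y) ⟩
    count n (y ⊖ scale n ⟦ 0 ⟧) + count n (y ⊖ scale n ⟦ 2 ⟧)
      ≡⟨ cong₂ (λ a b → count n a + count n (y ⊖ b)) (trans (cong (y ⊖_) (scale-0ᴳ n)) (⊖-ε y))
           (trans (scale-⟦⟧ n 2) (cong ⟦_⟧ (ℕ.*-comm n 2))) ⟩
    count n y + count n (y ⊖ ⟦ 2 ℕ.* n ⟧)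
      ≡⟨ count-+ n n y ⟨
    count (n ℕ.+ n) y
      ≡⟨ cong (λ k → count (n ℕ.+ k) y) (ℕ.+-identityʳ n) ⟨
    count (2 ℕ.^ suc t) y ∎
    where
    open ≡-Reasoning
    n = 2 ℕ.^ t

  -- f is the law of a variable that, except with probability q, contains an independent uniform bit, doubled.
  record Smooth (q : ℚ) (f : F) : Set where
    field
      κ ρ      : F
      κ-nonNeg : NonNeg κ
      ρ-nonNeg : NonNeg ρ
      splits   : f ≗ η ⋆ κ ⊞ ρ
      sum-ρ    : sum ρ ≡ q

  module _ {q f} (f-smooth : Smooth q f) where
    open Smooth f-smooth

    smooth-nonNeg : NonNeg f
    smooth-nonNeg y = subst (0ℚ ≤_) (sym (splits y)) (+-nonNeg (⋆-nonNeg η-nonNeg κ-nonNeg y) (ρ-nonNeg y))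

    0≤q : 0ℚ ≤ q
    0≤q = subst (0ℚ ≤_) sum-ρ (sum-nonNeg ρ ρ-nonNeg)

    -- From `(ηκ + ρ)² = η(κf + κρ) + ρ²`: a sum of two copies lacks a bit only if both copies do.
    smooth-⋆ : Smooth (q * q) (f ⋆ f)
    smooth-⋆ = record
      { κ        = κ ⋆ f ⊞ κ ⋆ ρ
      ; ρ        = ρ ⋆ ρ
      ; κ-nonNeg = λ y → +-nonNeg (⋆-nonNeg κ-nonNeg smooth-nonNeg y) (⋆-nonNeg κ-nonNeg ρ-nonNeg y)
      ; ρ-nonNeg = ⋆-nonNeg ρ-nonNeg ρ-nonNeg
      ; splits   = λ y → begin
          (f ⋆ f) y                                       ≡⟨ expand f y ⟩
          (η ⋆ (κ ⋆ f)) y + (ρ ⋆ f) y                     ≡⟨ cong ((η ⋆ (κ ⋆ f)) y +_) (trans (⋆-comm ρ f y) (expand ρ y)) ⟩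
          (η ⋆ (κ ⋆ f)) y + ((η ⋆ (κ ⋆ ρ)) y + (ρ ⋆ ρ) y) ≡⟨ +-assoc ((η ⋆ (κ ⋆ f)) y) ((η ⋆ (κ ⋆ ρ)) y) ((ρ ⋆ ρ) y) ⟨
          (η ⋆ (κ ⋆ f)) y + (η ⋆ (κ ⋆ ρ)) y + (ρ ⋆ ρ) y   ≡⟨ cong (_+ (ρ ⋆ ρ) y) (⋆-distribˡ-⊞ η (κ ⋆ f) (κ ⋆ ρ) y) ⟨
          (η ⋆ (κ ⋆ f ⊞ κ ⋆ ρ) ⊞ ρ ⋆ ρ) y                 ∎
      ; sum-ρ    = trans (sum-⋆ ρ ρ) (cong₂ _*_ sum-ρ sum-ρ)
      }
      where
      open ≡-Reasoning
      expand : ∀ g → f ⋆ g ≗ η ⋆ (κ ⋆ g) ⊞ ρ ⋆ g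
      expand g y = trans (⋆-congʳ {g} splits y) (trans (⋆-distribʳ-⊞ g (η ⋆ κ) ρ y)
        (cong (_+ (ρ ⋆ g) y) (⋆-assoc η κ g y)))

    -- Since `1⋆ ≤ η` pointwise, the defective part `ρ` may be enlarged to `η ⋆ ρ`. Then `η` factors
    -- out at every position, and the `2^t` patterns of defective positions need not be told apart.
    dominating : F
    dominating = κ ⊞ ρ

    dominating-nonNeg : NonNeg dominating
    dominating-nonNeg y = +-nonNeg (κ-nonNeg y) (ρ-nonNeg y)

    smooth-≤ : ∀ y → f y ≤ (η ⋆ dominating) y
    smooth-≤ y = begin
      f y                                       ≡⟨ splits y ⟩
      (η ⋆ κ) y + ρ y                           ≤⟨ +-monoʳ-≤ ((η ⋆ κ) y) ρ≤ηρ ⟩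
      (η ⋆ κ) y + (η ⋆ ρ) y                     ≡⟨ ⋆-distribˡ-⊞ η κ ρ y ⟨
      (η ⋆ dominating) y                        ∎
      where
      open ≤-Reasoning
      ρ≤ηρ : ρ y ≤ (η ⋆ ρ) y
      ρ≤ηρ = begin
        ρ y                                     ≡⟨ ⋆-identityˡ ρ y ⟨
        (1⋆ ⋆ ρ) y                              ≡⟨ +-identityʳ _ ⟨
        (1⋆ ⋆ ρ) y + 0ℚ                         ≤⟨ +-monoʳ-≤ ((1⋆ ⋆ ρ) y) (⋆-nonNeg (δ-nonNeg ⟦ 2 ⟧) ρ-nonNeg y) ⟩
        (1⋆ ⋆ ρ) y + (δ ⟦ 2 ⟧ ⋆ ρ) y            ≡⟨ ⋆-distribʳ-⊞ ρ 1⋆ (δ ⟦ 2 ⟧) y ⟨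
        (η ⋆ ρ) y                               ∎

    -- From `2 (sum κ) + q = 1`. As `η` has mass 2, domination raises the mass per position from 1
    -- to only `1 + q`.
    sum-dominating : sum f ≡ 1ℚ → sum dominating ≡ ½ * (1ℚ + q)
    sum-dominating Σf≡1 = begin
      sum (κ ⊞ ρ)                                 ≡⟨ ∑-distrib-+ {p} κ ρ ⟩
      sum κ + sum ρ
        ≡⟨ solve 2 (λ k r → k :+ r := con ½ :* ((con 1ℚ :+ con 1ℚ) :* k :+ r :+ r)) refl (sum κ) (sum ρ) ⟩
      ½ * ((1ℚ + 1ℚ) * sum κ + sum ρ + sum ρ)     ≡⟨ cong₂ (λ a b → ½ * (a * sum κ + sum ρ + b)) (sym sum-η) sum-ρ ⟩
      ½ * (sum η * sum κ + sum ρ + q)             ≡⟨ cong (λ a → ½ * (a + sum ρ + q)) (sum-⋆ η κ) ⟨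
      ½ * (sum (η ⋆ κ) + sum ρ + q)               ≡⟨ cong (λ a → ½ * (a + q)) (∑-distrib-+ {p} (η ⋆ κ) ρ) ⟨
      ½ * (sum (η ⋆ κ ⊞ ρ) + q)                   ≡⟨ cong (λ a → ½ * (a + q)) (trans (sym (sum-cong-≗ {p} splits)) Σf≡1) ⟩
      ½ * (1ℚ + q)                                ∎
      where
      open ≡-Reasoning
      open +-*-Solver hiding (⟦_⟧)

    -- `Γ-⋆` separates the bits from the rest; convolving with the rest multiplies the uniform bound
    -- `count-≤` for the bits by the mass of the rest.
    Γ-smooth-≤ : ∀ t → sum f ≡ 1ℚ → ∀ y → Γ t f y ≤ ι (2 ℕ.^ t ℕ.+ p) * u * (½ * (1ℚ + q)) ^ t
    Γ-smooth-≤ t Σf≡1 y = begin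
      Γ t f y                                             ≤⟨ Γ-mono-≤ t smooth-nonNeg smooth-≤ y ⟩
      Γ t (η ⋆ dominating) y                              ≡⟨ Γ-⋆ t η dominating y ⟩
      (Γ t η ⋆ Γ t dominating) y                          ≤⟨ ⋆-≤-bound (Γ-nonNeg t dominating-nonNeg)
                                                               (λ z → ≤-trans (≤-reflexive (Γ-η t z)) (count-≤ (2 ℕ.^ t) z)) y ⟩
      ι (2 ℕ.^ t ℕ.+ p) * u * sum (Γ t dominating)
        ≡⟨ cong (ι (2 ℕ.^ t ℕ.+ p) * u *_) (trans (sum-Γ t dominating) (cong (_^ t) (sum-dominating Σf≡1))) ⟩
      ι (2 ℕ.^ t ℕ.+ p) * u * (½ * (1ℚ + q)) ^ t          ∎
      where open ≤-Reasoning

    -- From `‖g‖² ≤ (max g) (sum g)` for the law `g = Γ t f` of mass 1.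
    ‖Γ-smooth‖²≤ : ∀ t → sum f ≡ 1ℚ → 4 ℕ.* p ℕ.≤ 2 ℕ.^ t → ι 8 * (ι t * q) ≤ 1ℚ → ‖ Γ t f ‖² ≤ ℤ.+ 3 / 2 * u
    ‖Γ-smooth‖²≤ t Σf≡1 4p≤2^t 8tq≤1 = begin
      ∑[ z < p ] (Γ t f z * Γ t f z)        ≤⟨ sum-mono-≤ {p} (λ z → Γ t f z * Γ t f z) (λ z → ℤ.+ 3 / 2 * u * Γ t f z)
                                                 (λ z → *-monoʳ-≤-nonNeg (Γ t f z) {{nonNegative (Γ-nonNeg t smooth-nonNeg z)}} (Γ≤ z)) ⟩
      ∑[ z < p ] (ℤ.+ 3 / 2 * u * Γ t f z)  ≡⟨ *-distribˡ-sum {p} (ℤ.+ 3 / 2 * u) (Γ t f) ⟨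
      ℤ.+ 3 / 2 * u * sum (Γ t f)
        ≡⟨ cong (ℤ.+ 3 / 2 * u *_) (trans (sum-Γ t f) (trans (cong (_^ t) Σf≡1) (1^n≡1 t))) ⟩
      ℤ.+ 3 / 2 * u * 1ℚ                    ≡⟨ *-identityʳ (ℤ.+ 3 / 2 * u) ⟩
      ℤ.+ 3 / 2 * u                         ∎
      where
      open ≤-Reasoning
      open +-*-Solver
      Γ≤ : ∀ z → Γ t f z ≤ ℤ.+ 3 / 2 * u
      Γ≤ z = begin
        Γ t f z                                      ≤⟨ Γ-smooth-≤ t Σf≡1 z ⟩
        ι (2 ℕ.^ t ℕ.+ p) * u * (½ * (1ℚ + q)) ^ t
          ≡⟨ solve 3 (λ a u b → a :* u :* b := a :* b :* u) refl (ι (2 ℕ.^ t ℕ.+ p)) u ((½ * (1ℚ + q)) ^ t) ⟩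
        ι (2 ℕ.^ t ℕ.+ p) * (½ * (1ℚ + q)) ^ t * u
          ≤⟨ *-monoʳ-≤-nonNeg u {{nonNegative 0≤u}} ([1+p/2^t][1+q]^t≤3/2 p t q 0≤q 4p≤2^t 8tq≤1) ⟩
        ℤ.+ 3 / 2 * u                                ∎

  square-smooth : ∀ s {q f} → Smooth q f → Smooth (q ^ (2 ℕ.^ s)) (square s f)
  square-smooth zero    {q} {f} f-smooth = subst (λ r → Smooth r f) (sym (*-identityʳ q)) f-smooth
  square-smooth (suc s) {q} {f} f-smooth = subst (λ r → Smooth r (square (suc s) f))
    (trans (cong (_^ (2 ℕ.^ s)) (cong (q *_) (sym (*-identityʳ q)))) (^-assocʳ q 2 (2 ℕ.^ s)))
    (square-smooth s (smooth-⋆ f-smooth))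

  open Mixing u pu≡1 using (u-Γ≤)

  -- The squared L²-distance of the copies is at most `3/2 u - u = u/2`, and by `u-Γ≤` it bounds the
  -- deficit `u - Γ` at every point.
  Γ-≥ : ∀ {q f t a s} → Smooth q f → sum f ≡ 1ℚ → q ^ 3 ≤ ½ →
        4 ℕ.* p ℕ.≤ 2 ℕ.^ t → 8 ℕ.* t ℕ.≤ 2 ℕ.^ a → 3 ℕ.* a ℕ.≤ 2 ℕ.^ s →
        ∀ y → ½ * u ≤ Γ (t ℕ.* 2 ℕ.^ suc s) f y
  Γ-≥ {q} {f} {t} {a} {s} f-smooth Σf≡1 q³≤½ 4p≤2^t 8t≤2^a 3a≤2^s y = begin
    ½ * u
      ≡⟨ solve 1 (λ u → con ½ :* u := u :- (con (ℤ.+ 3 / 2) :* u :- u)) refl u ⟩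
    u - (ℤ.+ 3 / 2 * u - u)                          ≤⟨ +-monoʳ-≤ u (neg-antimono-≤ (+-monoˡ-≤ (- u)
                                                          (‖Γ-smooth‖²≤ (square-smooth s f-smooth) t (sum-square s f Σf≡1) 4p≤2^t
                                                            (q^[2^s]-small {q} {t} {a} {s} (0≤q f-smooth) q³≤½ 8t≤2^a 3a≤2^s)))) ⟩
    u - (‖ Γ t (square s f) ‖² - u)                  ≤⟨ +-monoʳ-≤ u (neg-antimono-≤ (u-Γ≤ t s f y Σf≡1)) ⟩
    u - (u - Γ (t ℕ.* 2 ℕ.^ suc s) f y)
      ≡⟨ solve 2 (λ u g → u :- (u :- g) := g) refl u (Γ (t ℕ.* 2 ℕ.^ suc s) f y) ⟩
    Γ (t ℕ.* 2 ℕ.^ suc s) f y                        ∎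
    where
    open ≤-Reasoning
    open +-*-Solver

-- Convergent series

≤-by-ε : ∀ {x y} → (∀ ε → 0ℚ < ε → x ≤ y + ε) → x ≤ y
≤-by-ε {x} {y} x≤y+ε with ≤-total x y
... | inj₁ x≤y = x≤y
... | inj₂ y≤x with x ≤? y
...   | yes x≤y = x≤y
...   | no  x≰y with <-dense (≰⇒> x≰y)
...     | m , y<m , m<x = contradiction (<-≤-trans m<x (subst (x ≤_)
            (solve 2 (λ y m → y :+ (m :- y) := m) refl y m)
            (x≤y+ε (m - y) (subst (_< m - y) (+-inverseʳ y) (+-monoˡ-< (- y) y<m))))) (<-irrefl refl)
  where open +-*-Solver

p≤∣p∣ : ∀ p → p ≤ ∣ p ∣
p≤∣p∣ p with ≤-total 0ℚ p
... | inj₁ 0≤p = ≤-reflexive (sym (0≤p⇒∣p∣≡p 0≤p))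
... | inj₂ p≤0 = ≤-trans p≤0 (0≤∣p∣ p)

p-q≤∣q-p∣ : ∀ p q → p - q ≤ ∣ q - p ∣
p-q≤∣q-p∣ p q = ≤-trans (p≤∣p∣ (p - q)) (≤-reflexive (trans (sym (∣-p∣≡∣p∣ (p - q)))
  (cong ∣_∣ (solve 2 (λ p q → :- (p :- q) := q :- p) refl p q))))
  where open +-*-Solver

hasSum-≤ : ∀ {a s t} → HasSum a s → HasSum a t → s ≤ t
hasSum-≤ {a} {s} {t} a≈s a≈t = ≤-by-ε (λ ε 0<ε →
  let 0<ε/2 = positive⁻¹ (½ * ε) {{pos*pos⇒pos ½ ε {{positive 0<ε}}}}
      M , ≤M = a≈s (½ * ε) 0<ε/2
      N , ≤N = a≈t (½ * ε) 0<ε/2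
      S = partialSum a (M ℕ.+ N)
  in begin
    s                                ≡⟨ solve 3 (λ s t S → s := t :+ ((s :- S) :+ (S :- t))) refl s t S ⟩
    t + ((s - S) + (S - t))          ≤⟨ +-monoʳ-≤ t (+-mono-≤
                                          (≤-trans (p≤∣p∣ (s - S)) (≤M (M ℕ.+ N) (ℕ.m≤m+n M N)))
                                          (≤-trans (p-q≤∣q-p∣ S t) (≤N (M ℕ.+ N) (ℕ.m≤n+m N M)))) ⟩
    t + (½ * ε + ½ * ε)              ≡⟨ cong (t +_) (solve 1 (λ ε → con ½ :* ε :+ con ½ :* ε := ε) refl ε) ⟩
    t + ε                            ∎)
  where
  open ≤-Reasoning
  open +-*-Solver

hasSum-unique : ∀ {a s t} → HasSum a s → HasSum a t → s ≡ t
hasSum-unique {a} a≈s a≈t = ≤-antisym (hasSum-≤ {a} a≈s a≈t) (hasSum-≤ {a} a≈t a≈s)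

hasSum-cong : ∀ {a b s} → (∀ n → a n ≡ b n) → HasSum a s → HasSum b s
hasSum-cong {a} {b} {s} a≗b a≈s ε 0<ε =
  let N , ≤N = a≈s ε 0<ε
  in N , λ n N≤n → subst (λ S → ∣ s - S ∣ ≤ ε) (sum-cong-≗ {n} (a≗b ∘ toℕ)) (≤N n N≤n)

hasSum-+ : ∀ {a b s t} → HasSum a s → HasSum b t → HasSum (λ n → a n + b n) (s + t)
hasSum-+ {a} {b} {s} {t} a≈s b≈t ε 0<ε =
  let 0<ε/2 = positive⁻¹ (½ * ε) {{pos*pos⇒pos ½ ε {{positive 0<ε}}}}
      M , ≤M = a≈s (½ * ε) 0<ε/2
      N , ≤N = b≈t (½ * ε) 0<ε/2
  in M ℕ.+ N , λ n M+N≤n → begin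
    ∣ s + t - partialSum (λ i → a i + b i) n ∣
      ≡⟨ cong (λ S → ∣ s + t - S ∣) (∑-distrib-+ {n} (a ∘ toℕ) (b ∘ toℕ)) ⟩
    ∣ s + t - (partialSum a n + partialSum b n) ∣
      ≡⟨ cong ∣_∣ (solve 4 (λ s t S T → s :+ t :- (S :+ T) := (s :- S) :+ (t :- T)) refl s t (partialSum a n) (partialSum b n)) ⟩
    ∣ (s - partialSum a n) + (t - partialSum b n) ∣
      ≤⟨ ∣p+q∣≤∣p∣+∣q∣ (s - partialSum a n) (t - partialSum b n) ⟩
    ∣ s - partialSum a n ∣ + ∣ t - partialSum b n ∣
      ≤⟨ +-mono-≤ (≤M n (ℕ.≤-trans (ℕ.m≤m+n M N) M+N≤n)) (≤N n (ℕ.≤-trans (ℕ.m≤n+m N M) M+N≤n)) ⟩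
    ½ * ε + ½ * ε
      ≡⟨ solve 1 (λ ε → con ½ :* ε :+ con ½ :* ε := ε) refl ε ⟩
    ε ∎
  where
  open ≤-Reasoning
  open +-*-Solver

-- A factor of at most 1 lets the same `N` serve for the same `ε`.
hasSum-* : ∀ {a s c} → 0ℚ ≤ c → c ≤ 1ℚ → HasSum a s → HasSum (λ n → c * a n) (c * s)
hasSum-* {a} {s} {c} 0≤c c≤1 a≈s ε 0<ε =
  let N , ≤N = a≈s ε 0<ε
  in N , λ n N≤n → begin
    ∣ c * s - partialSum (λ i → c * a i) n ∣   ≡⟨ cong (λ S → ∣ c * s - S ∣) (*-distribˡ-sum {n} c (a ∘ toℕ)) ⟨
    ∣ c * s - c * partialSum a n ∣
      ≡⟨ cong ∣_∣ (solve 3 (λ c s S → c :* s :- c :* S := c :* (s :- S)) refl c s (partialSum a n)) ⟩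
    ∣ c * (s - partialSum a n) ∣               ≡⟨ ∣p*q∣≡∣p∣*∣q∣ c (s - partialSum a n) ⟩
    ∣ c ∣ * ∣ s - partialSum a n ∣             ≡⟨ cong (_* ∣ s - partialSum a n ∣) (0≤p⇒∣p∣≡p 0≤c) ⟩
    c * ∣ s - partialSum a n ∣                 ≤⟨ *-mono 0≤c (<⇒≤ 0<ε) c≤1 (≤N n N≤n) ⟩
    1ℚ * ε                                     ≡⟨ *-identityˡ ε ⟩
    ε                                          ∎
  where
  open ≤-Reasoning
  open +-*-Solver

hasSum-tail : ∀ {a s} → HasSum a s → HasSum (a ∘ suc) (s - a 0)
hasSum-tail {a} {s} a≈s ε 0<ε =
  let N , ≤N = a≈s ε 0<ε
  in N , λ n N≤n → subst (λ e → ∣ e ∣ ≤ ε)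
    (solve 3 (λ s a S → s :- (a :+ S) := s :- a :- S) refl s (a 0) (partialSum (a ∘ suc) n))
    (≤N (suc n) (ℕ.m≤n⇒m≤1+n N≤n))
  where open +-*-Solver

hasSum-∑ : ∀ {m} {a : Fin m → ℕ → ℚ} {s : Fin m → ℚ} → (∀ i → HasSum (a i) (s i)) →
           HasSum (λ n → ∑[ i < m ] a i n) (sum s)
hasSum-∑ {zero}  a≈s ε 0<ε = 0 , λ n _ → subst (λ S → ∣ 0ℚ - S ∣ ≤ ε)
  (sym (trans (sum-const n 0ℚ) (*-zeroʳ (ι n)))) (<⇒≤ 0<ε)
hasSum-∑ {suc m} {a} {s} a≈s = hasSum-+ {a zero} {λ n → ∑[ i < m ] a (suc i) n} {s zero} {sum (s ∘ suc)} (a≈s zero) (hasSum-∑ {m} {a ∘ suc} (a≈s ∘ suc))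

partialSum≤hasSum : ∀ {a s} → (∀ i → 0ℚ ≤ a i) → HasSum a s → ∀ n → partialSum a n ≤ s
partialSum≤hasSum {a} {s} 0≤a a≈s n = ≤-by-ε (λ ε 0<ε →
  let N , ≤N = a≈s ε 0<ε
  in begin
    partialSum a n                              ≤⟨ partialSum-≤-+ n N 0≤a ⟩
    partialSum a (n ℕ.+ N)                      ≡⟨ solve 2 (λ s S → S := s :+ (S :- s)) refl s (partialSum a (n ℕ.+ N)) ⟩
    s + (partialSum a (n ℕ.+ N) - s)
      ≤⟨ +-monoʳ-≤ s (≤-trans (p-q≤∣q-p∣ (partialSum a (n ℕ.+ N)) s) (≤N (n ℕ.+ N) (ℕ.m≤n+m N n))) ⟩
    s + ε                                       ∎)
  where
  open ≤-Reasoning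
  open +-*-Solver

-- The block walk

0≤⅓ : 0ℚ ≤ ⅓
0≤⅓ = nonNegative⁻¹ ⅓

module BlockWalk (p : ℕ) .{{_ : ℕ.NonZero p}} (k : Fin p) (h : ℕ) (2h≡1+p : 2 ℕ.* h ≡ 1 ℕ.+ p) where
  open Cyclic p
  open Halving h 2h≡1+p
  open Smoothing p h 2h≡1+p (ℤ.+ 1 / p) (ι-recip p)

  private
    P : Kernel p
    P = blockWalk p k

  increment≡⊕ : ∀ x → move p k increment x ≡ x ⊕ ⟦ 1 ⟧
  increment≡⊕ x = trans (sym (⟦⟧-+ (toℕ x) 1)) (cong (_⊕ ⟦ 1 ⟧) (⟦toℕ⟧ x))

  increment-⊕ : ∀ x c → move p k increment (x ⊕ c) ≡ move p k increment x ⊕ c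
  increment-⊕ x c = begin
    move p k increment (x ⊕ c)   ≡⟨ increment≡⊕ (x ⊕ c) ⟩
    (x ⊕ c) ⊕ ⟦ 1 ⟧              ≡⟨ swap x c ⟦ 1 ⟧ ⟩
    (x ⊕ ⟦ 1 ⟧) ⊕ c              ≡⟨ cong (_⊕ c) (increment≡⊕ x) ⟨
    move p k increment x ⊕ c     ∎
    where
    open ≡-Reasoning
    swap : ∀ x y z → (x ⊕ y) ⊕ z ≡ (x ⊕ z) ⊕ y
    swap x y z = trans (⊕-assoc x y z) (trans (cong (x ⊕_) (⊕-comm y z)) (sym (⊕-assoc x z y)))

  shift-⊕ : ∀ x c → move p k shift (x ⊕ c) ≡ move p k shift x ⊕ c
  shift-⊕ x c = trans (⊕-assoc x c k) (trans (cong (x ⊕_) (⊕-comm c k)) (sym (⊕-assoc x k c)))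

  -- The moves before the doubling commute with translations, and the doubling turns a translation
  -- by `c` into one by `2c`.
  firstDoubling-translate : ∀ n x y c → firstDoubling p k n (x ⊕ c) (y ⊕ scale 2 c) ≡ firstDoubling p k n x y
  firstDoubling-translate zero    x y c = cong (⅓ *_) (trans
    (cong (λ z → δ z (y ⊕ scale 2 c)) (scale-⊕ 2 x c))
    (δ-injective {φ = _⊕ scale 2 c} {_⊖ scale 2 c} (λ z → ∙-⊖ z (scale 2 c)) (scale 2 x) y))
  firstDoubling-translate (suc n) x y c = cong₂ (λ a b → ⅓ * a + ⅓ * b)
    (trans (cong (λ z → firstDoubling p k n z (y ⊕ scale 2 c)) (increment-⊕ x c)) (firstDoubling-translate n _ y c))
    (trans (cong (λ z → firstDoubling p k n z (y ⊕ scale 2 c)) (shift-⊕ x c)) (firstDoubling-translate n _ y c))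

  firstDoubling-nonNeg : ∀ n x y → 0ℚ ≤ firstDoubling p k n x y
  firstDoubling-nonNeg zero    x y = *-nonNeg 0≤⅓ (δ-nonNeg (move p k double x) y)
  firstDoubling-nonNeg (suc n) x y = +-nonNeg (*-nonNeg 0≤⅓ (firstDoubling-nonNeg n (move p k increment x) y))
                                              (*-nonNeg 0≤⅓ (firstDoubling-nonNeg n (move p k shift x) y))

  -- `Pr[N = n] = (1/3) (2/3)^n`, written in the recursive form of `firstDoubling`.
  geometric : ℕ → ℚ
  geometric zero    = ⅓
  geometric (suc n) = ⅓ * geometric n + ⅓ * geometric n

  sum-firstDoubling : ∀ n x → ∑[ y < p ] firstDoubling p k n x y ≡ geometric n
  sum-firstDoubling zero    x = trans (sym (*-distribˡ-sum {p} ⅓ (δ (move p k double x))))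
    (cong (⅓ *_) (sum-δ-1 (move p k double x)))
  sum-firstDoubling (suc n) x = trans
    (∑-distrib-+ {p} (λ y → ⅓ * firstDoubling p k n (move p k increment x) y) (λ y → ⅓ * firstDoubling p k n (move p k shift x) y))
    (cong₂ _+_ (part (move p k increment x)) (part (move p k shift x)))
    where
    part : ∀ z → ∑[ y < p ] (⅓ * firstDoubling p k n z y) ≡ ⅓ * geometric n
    part z = trans (sym (*-distribˡ-sum {p} ⅓ (firstDoubling p k n z))) (cong (⅓ *_) (sum-firstDoubling n z))

  hasSum-blockWalk : IsBlockWalk p k P
  hasSum-blockWalk = blockWalk-isBlockWalk p k

  γ : F
  γ = P ⟦ 0 ⟧

  -- The kernel is accessible only through its series, so translation covariance passes from the
  -- terms to the sums by uniqueness of limits.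
  blockWalk≡γ : ∀ x y → P x y ≡ γ (y ⊖ scale 2 x)
  blockWalk≡γ x y = hasSum-unique {λ n → firstDoubling p k n x y} (hasSum-blockWalk x y)
    (hasSum-cong {s = γ (y ⊖ scale 2 x)} (λ n → trans
      (sym (firstDoubling-translate n ⟦ 0 ⟧ (y ⊖ scale 2 x) x))
      (cong₂ (firstDoubling p k n) (⊕-identityˡ x) (⊖-∙ y (scale 2 x))))
      (hasSum-blockWalk ⟦ 0 ⟧ (y ⊖ scale 2 x)))

  -- The terms after the first add up to 2/3 of the whole series, so the mass `s` solves
  -- `s - 1/3 = 2/3 s`.
  sum-γ : sum γ ≡ 1ℚ
  sum-γ = begin
    s
      ≡⟨ solve 1 (λ s → s := con (ι 3) :* (s :- con ⅓ :- con (ℤ.+ 2 / 3) :* s) :+ con 1ℚ) refl s ⟩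
    ι 3 * (s - ⅓ - ℤ.+ 2 / 3 * s) + 1ℚ    ≡⟨ cong (λ x → ι 3 * (x - ℤ.+ 2 / 3 * s) + 1ℚ) tail≡⅔s ⟩
    ι 3 * (ℤ.+ 2 / 3 * s - ℤ.+ 2 / 3 * s) + 1ℚ
      ≡⟨ solve 1 (λ s → con (ι 3) :* (s :- s) :+ con 1ℚ := con 1ℚ) refl (ℤ.+ 2 / 3 * s) ⟩
    1ℚ                                    ∎
    where
    open ≡-Reasoning
    open +-*-Solver hiding (⟦_⟧)
    s = sum γ
    geometric≈s : HasSum geometric s
    geometric≈s = hasSum-cong {s = s} (λ n → sum-firstDoubling n ⟦ 0 ⟧)
      (hasSum-∑ {p} {λ y n → firstDoubling p k n ⟦ 0 ⟧ y} (hasSum-blockWalk ⟦ 0 ⟧))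
    tail≡⅔s : s - ⅓ ≡ ℤ.+ 2 / 3 * s
    tail≡⅔s = hasSum-unique {geometric ∘ suc} (hasSum-tail {geometric} {s} geometric≈s)
      (hasSum-cong {s = ℤ.+ 2 / 3 * s} (λ n → solve 1 (λ g → con (ℤ.+ 2 / 3) :* g := con ⅓ :* g :+ con ⅓ :* g) refl (geometric n))
        (hasSum-* {geometric} {s} (nonNegative⁻¹ (ℤ.+ 2 / 3)) (≤ᵇ⇒≤ _) geometric≈s))

  -- The walks with at most one move before the doubling already suffice.
  η/9≤γ : ∀ y → ℤ.+ 1 / 9 * η y ≤ γ y
  η/9≤γ y = begin
    ℤ.+ 1 / 9 * (a + b)
      -- Added here are the surplus `1/3 - 1/9 = 2/9` at 0 and the path through `shift`.
      ≤⟨ p≤p+q {b = ℤ.+ 2 / 9 * a + ⅓ * c} (+-nonNeg (*-nonNeg (nonNegative⁻¹ (ℤ.+ 2 / 9)) (δ-nonNeg ⟦ 0 ⟧ y)) (*-nonNeg 0≤⅓ (firstDoubling-nonNeg 0 (move p k shift ⟦ 0 ⟧) y))) ⟩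
    ℤ.+ 1 / 9 * (a + b) + (ℤ.+ 2 / 9 * a + ⅓ * c)
      ≡⟨ solve 3 (λ a b c → con (ℤ.+ 1 / 9) :* (a :+ b) :+ (con (ℤ.+ 2 / 9) :* a :+ con ⅓ :* c)
                         := con ⅓ :* a :+ ((con ⅓ :* (con ⅓ :* b) :+ con ⅓ :* c) :+ con 0ℚ)) refl a b c ⟩
    ⅓ * a + ((⅓ * (⅓ * b) + ⅓ * c) + 0ℚ)
      ≡⟨ cong₂ (λ z w → ⅓ * δ z y + ((⅓ * (⅓ * δ w y) + ⅓ * c) + 0ℚ)) (sym (scale-0ᴳ 2)) (sym doubled) ⟩
    partialSum (λ n → firstDoubling p k n ⟦ 0 ⟧ y) 2
      ≤⟨ partialSum≤hasSum {λ n → firstDoubling p k n ⟦ 0 ⟧ y} (λ n → firstDoubling-nonNeg n ⟦ 0 ⟧ y) (hasSum-blockWalk ⟦ 0 ⟧ y) 2 ⟩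
    γ y ∎
    where
    open ≤-Reasoning
    open +-*-Solver hiding (⟦_⟧)
    a = δ ⟦ 0 ⟧ y
    b = δ ⟦ 2 ⟧ y
    c = firstDoubling p k 0 (move p k shift ⟦ 0 ⟧) y
    p≤p+q : ∀ {a b} → 0ℚ ≤ b → a ≤ a + b
    p≤p+q {a} {b} 0≤b = subst (_≤ a + b) (+-identityʳ a) (+-monoʳ-≤ a 0≤b)
    doubled : move p k double (move p k increment ⟦ 0 ⟧) ≡ ⟦ 2 ⟧
    doubled = trans (cong (scale 2) (trans (increment≡⊕ ⟦ 0 ⟧) (⊕-identityˡ ⟦ 1 ⟧))) (scale-⟦⟧ 2 1)

  γ-smooth : Smooth (ℤ.+ 7 / 9) γ
  γ-smooth = record
    { κ        = κ
    ; ρ        = ρ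
    ; κ-nonNeg = λ y → *-nonNeg (nonNegative⁻¹ (ℤ.+ 1 / 9)) (δ-nonNeg ⟦ 0 ⟧ y)
    ; ρ-nonNeg = λ y → p-q≥0 (η/9≤γ y)
    ; splits   = λ y → trans (solve 2 (λ g e → g := e :+ (g :- e)) refl (γ y) (ℤ.+ 1 / 9 * η y))
                   (cong (_+ ρ y) (sym (ηκ≡η/9 y)))
    ; sum-ρ    = trans (∑-distrib-+ {p} γ (λ y → - (ℤ.+ 1 / 9 * η y)))
                   (cong₂ _+_ sum-γ sum-η/9)
    }
    where
    open ≡-Reasoning
    open +-*-Solver hiding (⟦_⟧)
    κ ρ : F
    κ y = ℤ.+ 1 / 9 * 1⋆ y
    ρ y = γ y - ℤ.+ 1 / 9 * η y
    ηκ≡η/9 : ∀ y → (η ⋆ κ) y ≡ ℤ.+ 1 / 9 * η y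
    ηκ≡η/9 y = begin
      (η ⋆ κ) y                                                ≡⟨ ⋆-comm η κ y ⟩
      ∑[ z < p ] (ℤ.+ 1 / 9 * 1⋆ z * η (y ⊖ z))
        ≡⟨ sum-cong-≗ {p} (λ z → *-assoc (ℤ.+ 1 / 9) (1⋆ z) (η (y ⊖ z))) ⟩
      ∑[ z < p ] (ℤ.+ 1 / 9 * (1⋆ z * η (y ⊖ z)))              ≡⟨ *-distribˡ-sum {p} (ℤ.+ 1 / 9) (λ z → 1⋆ z * η (y ⊖ z)) ⟨
      ℤ.+ 1 / 9 * (1⋆ ⋆ η) y                                   ≡⟨ cong (ℤ.+ 1 / 9 *_) (⋆-identityˡ η y) ⟩
      ℤ.+ 1 / 9 * η y                                          ∎
    sum-η/9 : ∑[ y < p ] (- (ℤ.+ 1 / 9 * η y)) ≡ - (ℤ.+ 2 / 9)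
    sum-η/9 = begin
      ∑[ y < p ] (- (ℤ.+ 1 / 9 * η y))     ≡⟨ sum-cong-≗ {p} (λ y → neg-distribˡ-* (ℤ.+ 1 / 9) (η y)) ⟩
      ∑[ y < p ] (- (ℤ.+ 1 / 9) * η y)     ≡⟨ *-distribˡ-sum {p} (- (ℤ.+ 1 / 9)) η ⟨
      - (ℤ.+ 1 / 9) * sum η                ≡⟨ cong (- (ℤ.+ 1 / 9) *_) sum-η ⟩
      - (ℤ.+ 2 / 9)                        ∎

  -- After `n` steps the walk is at `2^n x` plus the increments, the earliest one carrying the
  -- largest power of 2. `power` splits off the first step, which is therefore the last factor
  -- `D n γ` of `Γ (suc n) γ`.
  power≡Γ : ∀ n x y → power P n x y ≡ Γ n γ (y ⊖ scale (2 ℕ.^ n) x)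
  power≡Γ zero    x y = begin
    δ x y                             ≡⟨ cong₂ δ (sym (⊕-identityˡ x)) refl ⟩
    δ (⟦ 0 ⟧ ⊕ x) y                   ≡⟨ δ-⊕ ⟦ 0 ⟧ x y ⟩
    δ ⟦ 0 ⟧ (y ⊖ x)                   ≡⟨ cong (λ z → δ ⟦ 0 ⟧ (y ⊖ z)) (scale-1 x) ⟨
    δ ⟦ 0 ⟧ (y ⊖ scale 1 x)           ∎
    where open ≡-Reasoning
  power≡Γ (suc n) x y = begin
    ∑[ z < p ] (P x z * power P n z y)
      ≡⟨ sum-cong-≗ {p} (λ z → cong₂ _*_ (blockWalk≡γ x z) (power≡Γ n z y)) ⟩
    ∑[ z < p ] (γ (z ⊖ scale 2 x) * Γ n γ (y ⊖ scale m z))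
      -- The new variable `w = z - 2x` is the random part of the first step.
      ≡⟨ sum-∙ (λ z → γ (z ⊖ scale 2 x) * Γ n γ (y ⊖ scale m z)) (scale 2 x) ⟩
    ∑[ w < p ] (γ ((w ⊕ scale 2 x) ⊖ scale 2 x) * Γ n γ (y ⊖ scale m (w ⊕ scale 2 x)))
      ≡⟨ sum-cong-≗ {p} (λ w → cong₂ (λ a b → γ a * Γ n γ b) (∙-⊖ w (scale 2 x)) (begin
           y ⊖ scale m (w ⊕ scale 2 x)                ≡⟨ cong (y ⊖_) (scale-⊕ m w (scale 2 x)) ⟩
           y ⊖ (scale m w ⊕ scale m (scale 2 x))      ≡⟨ ⊖-∙-⊖ y (scale m w) (scale m (scale 2 x)) ⟩
           (y ⊖ scale m (scale 2 x)) ⊖ scale m w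
             ≡⟨ cong (λ z → (y ⊖ z) ⊖ scale m w) (trans (scale-scale m 2 x) (cong (λ a → scale a x) (ℕ.*-comm m 2))) ⟩
           y′ ⊖ scale m w                             ∎)) ⟩
    ∑[ w < p ] (γ w * Γ n γ (y′ ⊖ scale m w))
      -- Replacing `w` by `w / 2^n` turns the sum into a convolution with the dilated law.
      ≡⟨ sum-auto (halving n) (λ w → γ w * Γ n γ (y′ ⊖ scale m w)) ⟩
    ∑[ w < p ] (D n γ w * Γ n γ (y′ ⊖ scale m (scale (h ℕ.^ n) w)))
      ≡⟨ sum-cong-≗ {p} (λ w → cong (λ z → D n γ w * Γ n γ (y′ ⊖ z)) (Automorphism.retract (halving n) w)) ⟩
    (D n γ ⋆ Γ n γ) y′
      ≡⟨ ⋆-comm (D n γ) (Γ n γ) y′ ⟩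
    Γ (suc n) γ y′ ∎
    where
    open ≡-Reasoning
    m = 2 ℕ.^ n
    y′ = y ⊖ scale (2 ℕ.^ suc n) x

  separatedWithin : ∀ t a s → 4 ℕ.* p ℕ.≤ 2 ℕ.^ t → 8 ℕ.* t ℕ.≤ 2 ℕ.^ a → 3 ℕ.* a ℕ.≤ 2 ℕ.^ s →
                    SeparatedWithin P (uniform p) (uniform≢0 p) ½ (t ℕ.* 2 ℕ.^ suc s)
  separatedWithin t a s 4p≤2^t 8t≤2^a 3a≤2^s x y = begin
    1ℚ - power P n x y ÷u          ≤⟨ +-monoʳ-≤ 1ℚ (neg-antimono-≤ (*-monoʳ-≤-nonNeg (1/ u) {{1/u≥0}} ½u≤Pⁿ)) ⟩
    1ℚ - ½ * u ÷u                  ≡⟨ cong (λ z → 1ℚ - z) (trans (*-assoc ½ u (1/ u)) (cong (½ *_) (*-inverseʳ u))) ⟩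
    ½                              ∎
    where
    open ≤-Reasoning
    n = t ℕ.* 2 ℕ.^ suc s
    u = uniform p y
    instance
      u>0 : Positive u
      u>0 = normalize-pos 1 p
      u≢0 : NonZero u
      u≢0 = uniform≢0 p y
    1/u≥0 : NonNegative (1/ u)
    1/u≥0 = pos⇒nonNeg (1/ u) {{1/pos⇒pos u}}
    infixl 7 _÷u
    _÷u : ℚ → ℚ
    q ÷u = q * 1/ u
    ½u≤Pⁿ : ½ * u ≤ power P n x y
    ½u≤Pⁿ = subst (½ * u ≤_) (sym (power≡Γ n x y))
      -- The comparison decided by evaluation is `(7/9)^3 = 343/729 ≤ ½`.
      (Γ-≥ {f = γ} {t} {a} {s} γ-smooth sum-γ (≤ᵇ⇒≤ _) 4p≤2^t 8t≤2^a 3a≤2^s (y ⊖ scale (2 ℕ.^ n) x))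

-- Existence of the mixing time and conclusion

least : ∀ {Q : ℕ → Set} → (∀ n → Dec (Q n)) → ∀ N → Q N → ∃[ n ] (n ℕ.≤ N × Q n × (∀ m → Q m → n ℕ.≤ m))
least Q? N QN with Q? 0
... | yes Q0 = 0 , ℕ.z≤n , Q0 , λ _ _ → ℕ.z≤n
least Q? zero    QN | no ¬Q0 = contradiction QN ¬Q0
least Q? (suc N) QN | no ¬Q0 with least (Q? ∘ suc) N QN
... | n , n≤N , Qn , n≤ = suc n , ℕ.s≤s n≤N , Qn , λ where
  zero    Q0 → contradiction Q0 ¬Q0
  (suc m) Qm → ℕ.s≤s (n≤ m Qm)

-- Only finitely many rational inequalities are involved, so the minimum defining the mixing time is
-- found by bounded search with `least`.
separatedWithin? : ∀ {m} P (π : Fin m → ℚ) π≢0 ε n → Dec (SeparatedWithin P π π≢0 ε n)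
separatedWithin? P π π≢0 ε n = all? (λ x → all? (λ y → _ ≤? _))

odd⇒half : ∀ p → ¬ (2 ∣ p) → ∃[ h ] 2 ℕ.* h ≡ 1 ℕ.+ p
odd⇒half p 2∤p with p % 2 in eq | m%n<n p 2
... | 0 | _ = contradiction (m%n≡0⇒n∣m p 2 eq) 2∤p
... | 1 | _ = suc (p ℕ./ 2) , (begin
  2 ℕ.* suc (p ℕ./ 2)               ≡⟨ ℕ.*-comm 2 (suc (p ℕ./ 2)) ⟩
  1 ℕ.+ (1 ℕ.+ p ℕ./ 2 ℕ.* 2)       ≡⟨ cong (λ r → 1 ℕ.+ (r ℕ.+ p ℕ./ 2 ℕ.* 2)) eq ⟨
  1 ℕ.+ (p % 2 ℕ.+ p ℕ./ 2 ℕ.* 2)   ≡⟨ cong suc (m≡m%n+[m/n]*n p 2) ⟨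
  1 ℕ.+ p                           ∎)
  where open ≡-Reasoning
... | suc (suc _) | ℕ.s≤s (ℕ.s≤s ())

fromℕ-mono-≤ᴿ : ∀ {m n x} → m ℕ.≤ n → fromℕ n ≤ᴿ x → fromℕ m ≤ᴿ x
fromℕ-mono-≤ᴿ m≤n n≤x q x<q = ≤-<-trans (ι-mono-≤ m≤n) (n≤x q x<q)

mainTheorem2 : ∃[ C ] (∀ (p : ℕ) .{{_ : ℕ.NonZero p}} → 3 ℕ.≤ p → ¬ (2 ∣ p) → (k : Fin p) →
    ∃[ τ ] (IsSeparationMixingTime (blockWalk p k) (uniform p) (uniform≢0 p) ½ τ
    × fromℕ τ ≤ᴿ C *ᴿ (log (fromℕ p) *ᴿ log (log (fromℕ p)))))
mainTheorem2 = fromℕ 11616 , λ p 3≤p 2∤p k →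
  let h , 2h≡1+p = odd⇒half p 2∤p
      t , a , s , 4p≤2^t , 8t≤2^a , 3a≤2^s , n≤ = parameters 3≤p
      τ , τ≤n , τ-separated , τ-least = least (separatedWithin? (blockWalk p k) (uniform p) (uniform≢0 p) ½)
        (t ℕ.* 2 ℕ.^ suc s) (BlockWalk.separatedWithin p k h 2h≡1+p t a s 4p≤2^t 8t≤2^a 3a≤2^s)
  in τ , (τ-separated , τ-least) , fromℕ-mono-≤ᴿ {x = fromℕ 11616 *ᴿ (log (fromℕ p) *ᴿ log (log (fromℕ p)))} τ≤n n≤
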